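{- Let $G$ be a weakly connected oriented graph on $n\ge 2$ vertices that contains cycles, with non-zero edge weights in $\mathbb{C}\setminus\mathbb{R}^-$ and complex signless incidence matrix $N$. (a) If $wt(C)\in\mathbb{R}^+$ for every even cycle $C$ in $G$ and $wt(C)\in\mathbb{R}^-$ for every odd cycle $C$ in $G$, then $$\operatorname{vol}^2(N)=n\sum_{T\in\mathcal{T}(G)}|W_T|,$$ where $\mathcal{T}(G)$ denotes the set of all oriented spanning trees $T$ of $G$. (b) If $G$ contains at least one even cycle $C$ with $wt(C)\notin\mathbb{R}^+$ or at least one odd cycle $C$ with $wt(C)\notin\mathbb{R}^-$, then $$\operatorname{vol}^2(N)=\sum_{H\in\mathcal{U}(G)}\ \prod_{i=1}^{c(H)}2|W_{U_i\setminus C_i}|\cdot\alpha(C_i),$$ where $\mathcal{U}(G)$ denotes the set of all spanning subgraphs $H$ of $G$ whose connected components $U_1,\dots,U_{c(H)}$ are all unicyclic, $C_i$ is the cycle of $U_i$, and $$\alpha(C_i)=\begin{cases}|wt(C_i)|-\operatorname{Re}(wt(C_i)) & \text{if } C_i \text{ is an even cycle},\\ |wt(C_i)|+\operatorname{Re}(wt(C_i)) & \text{if } C_i \text{ is an odd cycle}.\end{cases}$$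
   Context: An oriented graph $G$ is obtained from a finite simple undirected graph $G_u$ (its underlying graph) by giving each edge exactly one direction; it is weakly connected if $G_u$ is connected. Write $V(G)=\{1,\dots,n\}$ and $E(G)=\{e_1,\dots,e_m\}$. Each directed edge $(u,v)$ (from $u$ to $v$) has a non-zero complex weight $w_{uv}$. $\mathbb{R}^+$ and $\mathbb{R}^-$ denote the positive and the negative real numbers, and $\sqrt{\cdot}$ is the principal square root. The complex signless incidence matrix of $G$ is the $n\times m$ matrix $N=(n_{ij})$ where, for $e_j=(u,v)$, $n_{ij}=\sqrt{w_{uv}}$ if $i=u$, $n_{ij}=\sqrt{\overline{w_{uv}}}$ if $i=v$, and $n_{ij}=0$ otherwise. For a complex matrix $A$ of rank $r>0$, $\operatorname{vol}^2(A)$ is the sum of $|\det B|^2$ over all $r\times r$ submatrices $B$ of $A$. Put $a_{ij}=w_{ij}$ if $(i,j)\in E(G)$, $a_{ij}=\overline{w_{ji}}$ if $(j,i)\in E(G)$, and $a_{ij}=0$ otherwise. The weight of a walk $\gamma=(i_1,\dots,i_k)$ in $G_u$ is $wt(\gamma)=\prod_{s=1}^{k-1}a_{i_si_{s+1}}$. A cycle of $G$ means a cycle of $G_u$; $wt(C)$ is the weight of the closed walk going once around $C$ in either direction (the two directions give complex conjugate values, so conditions such as $wt(C)\in\mathbb{R}^\pm$ and the value $\operatorname{Re}(wt(C))$ do not depend on the choice). A unicyclic graph is a (weakly) connected graph with exactly one cycle; a spanning subgraph of $G$ has vertex set $V(G)$. $U_i\setminus C_i$ is obtained from $U_i$ by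 removing the edges of $C_i$, and $W_F$ is the product of all edge weights of an oriented graph $F$ (equal to $1$ if $F$ has no edges). -}

module Defs where

open import Level using (_⊔_) renaming (suc to lsuc)
open import Algebra.Bundles using (CommutativeRing; RawRing)
import Algebra.Definitions.RawMonoid as RawMonoidOps
open import Data.Bool.Base using (if_then_else_; _∧_)
open import Data.Bool.Properties using () renaming (_≟_ to _≟ᵇ_)
open import Data.Fin.Base using (Fin; zero; suc; punchIn)
open import Data.Fin.Properties using (_≟_; any?; all?; injective⇒≤)
open import Data.Fin.Subset
  using (Subset; inside; outside; _∈_; _⊆_; ⊤; ⊥; _∩_; _∪_; _─_; Nonempty)
open import Data.Fin.Subset.Properties using (_∈?_; _⊆?_; nonempty?)
open import Data.List.Base as List
  using (List; []; _∷_; _++_; _∷ʳ_; map; length; allFin; filter; mapMaybe)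
open import Data.List.Membership.Propositional using () renaming (_∈_ to _∈ₗ_)
open import Data.List.Membership.Propositional.Properties using (∈-allFin; ∈-lookup)
open import Data.List.Relation.Unary.All as All using (All; []; _∷_; reduce)
open import Data.List.Relation.Unary.Any using (here; there)
open import Data.List.Relation.Unary.AllPairs using ([]; _∷_)
open import Data.List.Relation.Unary.Linked using (Linked; linked?)
open import Data.List.Relation.Unary.Unique.Propositional using (Unique)
import Data.List.Relation.Unary.Unique.DecPropositional as DecUnique
import Data.Maybe.Base as Maybe
open import Data.Nat.Base as ℕ using (ℕ; zero; suc; z≤n; s≤s)
import Data.Nat.Properties as ℕ
open import Data.Nat.Divisibility using (_∣_; _∣?_)
open import Data.Product.Base using (Σ; ∃; _×_; _,_; proj₁; proj₂)
open import Data.Sum.Base using (_⊎_; inj₁; inj₂; [_,_]′)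
open import Data.Unit.Base using (tt)
open import Data.Vec.Base as Vec using (Vec; []; _∷_; lookup; tabulate)
open import Data.Vec.Properties using (≡-dec)
open import Function.Base using (_∘_; id)
open import Relation.Binary.Construct.Closure.ReflexiveTransitive
  using (Star; ε; _◅_; _◅◅_)
import Relation.Binary.Construct.NonStrictToStrict as ToStrict
open import Relation.Binary.Core using (Rel)
open import Relation.Binary.Definitions using (Decidable)
open import Relation.Binary.PropositionalEquality
  using (_≡_; _≢_; refl; cong; sym)
open import Relation.Binary.Structures using (IsDecTotalOrder)
open import Relation.Nullary using (Dec; yes; no; does; ¬_; contradiction)
open import Relation.Nullary.Decidable
  using (map′; _×-dec_; _⊎-dec_; _→-dec_; ¬?; dec⇒maybe; decidable-stable)
open import Relation.Unary using (Pred) renaming (Decidable to Decidable₁)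

------------------------------------------------------------------------
-- The real numbers

-- The standard library has no real numbers, so ℝ is given by its
-- categorical axioms: a Dedekind-complete ordered field (unique up to
-- isomorphism).  The order is decidable, i.e. ℝ is the classical field of
-- reals.  The total functions _⁻¹ and √_ are constrained only where they
-- are meaningful; √_ adds no assumption, since completeness yields the
-- square root of every x ≥ 0 and the two axioms for √_ determine it there.

record RealField c ℓ₁ ℓ₂ : Set (lsuc (c ⊔ ℓ₁ ⊔ ℓ₂)) where
  infix  4 _≤_ _<_
  infix  9 _⁻¹
  infix  9 √_
  field
    commutativeRing : CommutativeRing c ℓ₁

  open CommutativeRing commutativeRing public

  field
    _≤_             : Rel Carrier ℓ₂
    isDecTotalOrder : IsDecTotalOrder _≈_ _≤_
    0≉1             : 0# ≉ 1#
    _⁻¹             : Carrier → Carrier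
    *-inverseʳ      : ∀ x → x ≉ 0# → x * x ⁻¹ ≈ 1#
    +-monoˡ-≤       : ∀ z {x y} → x ≤ y → x + z ≤ y + z
    *-nonNeg        : ∀ {x y} → 0# ≤ x → 0# ≤ y → 0# ≤ x * y

  open IsDecTotalOrder isDecTotalOrder public using (_≤?_)

  _<_ : Rel Carrier (ℓ₁ ⊔ ℓ₂)
  _<_ = ToStrict._<_ _≈_ _≤_

  UpperBound : ∀ {p} → Pred Carrier p → Pred Carrier (c ⊔ ℓ₂ ⊔ p)
  UpperBound P b = ∀ x → P x → x ≤ b

  field
    supremum : (P : Pred Carrier (c ⊔ ℓ₁ ⊔ ℓ₂)) → ∃ P → ∃ (UpperBound P) →
               ∃ λ s → UpperBound P s × (∀ b → UpperBound P b → s ≤ b)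
    √_       : Carrier → Carrier
    √-nonNeg : ∀ x → 0# ≤ x → 0# ≤ √ x
    √-square : ∀ x → 0# ≤ x → √ x * √ x ≈ x

------------------------------------------------------------------------
-- Matrices over a ring

module MatrixOver {a ℓ} (R : RawRing a ℓ) where
  open RawRing R
  open RawMonoidOps +-rawMonoid using (sum)

  Matrix : ℕ → ℕ → Set a
  Matrix p q = Fin p → Fin q → Carrier

  alternating : ∀ {r} → (Fin r → Carrier) → Fin r → Carrier
  alternating f zero    = f zero
  alternating f (suc j) = - alternating (f ∘ suc) j

  -- Laplace expansion along the first row.
  det : ∀ {r} → Matrix r r → Carrier
  det {zero}  A = 1#
  det {suc r} A = sum (alternating λ j →
    A zero j * det λ i k → A (suc i) (punchIn j k))

  submatrix : ∀ {p q r s} → Matrix p q → Vec (Fin p) r → Vec (Fin q) s → Matrix r s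
  submatrix A ρ κ i j = A (lookup ρ i) (lookup κ j)

  RowsIndependent : ∀ {p q r} → Matrix p q → (Fin r → Fin p) → Set (a ⊔ ℓ)
  RowsIndependent {r = r} A ρ = (x : Fin r → Carrier) →
    (∀ j → sum (λ i → x i * A (ρ i) j) ≈ 0#) → ∀ i → x i ≈ 0#

  -- The maximal number of linearly independent rows (independence forces
  -- the selected rows to be distinct).
  IsRank : ∀ {p q} → Matrix p q → ℕ → Set (a ⊔ ℓ)
  IsRank {p} A r =
    ∃ (RowsIndependent {r = r} A) ×
    (∀ {s} (ρ : Fin s → Fin p) → RowsIndependent A ρ → s ℕ.≤ r)

-- All strictly increasing sequences of length r in Fin n.
choose : ∀ n r → List (Vec (Fin n) r)
choose n       zero    = [] ∷ []
choose zero    (suc r) = []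
choose (suc n) (suc r) =
  map (λ v → zero ∷ Vec.map suc v) (choose n r) ++ map (Vec.map suc) (choose n (suc r))

allSubsets : ∀ n → List (Subset n)
allSubsets zero    = [] ∷ []
allSubsets (suc n) = map (inside ∷_) (allSubsets n) ++ map (outside ∷_) (allSubsets n)

------------------------------------------------------------------------
-- Complex numbers

module ComplexNumbers {c ℓ₁ ℓ₂} (ℝ : RealField c ℓ₁ ℓ₂) where
  open RealField ℝ

  ∑ ∏ : ∀ {a} {A : Set a} → List A → (A → Carrier) → Carrier
  ∑ xs f = List.foldr (λ x s → f x + s) 0# xs
  ∏ xs f = List.foldr (λ x p → f x * p) 1# xs

  2# : Carrier
  2# = 1# + 1#

  infix 5 _+i_
  record ℂ : Set c where
    constructor _+i_
    field
      Re Im : Carrier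
  open ℂ public

  ℂ-rawRing : RawRing c ℓ₁
  ℂ-rawRing = record
    { Carrier = ℂ
    ; _≈_     = λ z w → Re z ≈ Re w × Im z ≈ Im w
    ; _+_     = λ z w → (Re z + Re w) +i (Im z + Im w)
    ; _*_     = λ z w → (Re z * Re w - Im z * Im w) +i (Re z * Im w + Im z * Re w)
    ; -_      = λ z → (- Re z) +i (- Im z)
    ; 0#      = 0# +i 0#
    ; 1#      = 1# +i 0#
    }

  open RawRing ℂ-rawRing public using () renaming
    (_≈_ to _≈ᶜ_; _+_ to _+ᶜ_; _*_ to _*ᶜ_; -_ to -ᶜ_; 0# to 0ᶜ; 1# to 1ᶜ)

  conj : ℂ → ℂ
  conj z = Re z +i (- Im z)

  ∣_∣ : ℂ → Carrier
  ∣ z ∣ = √ (Re z * Re z + Im z * Im z)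

  ℝ⁺ ℝ⁻ : Pred ℂ (ℓ₁ ⊔ ℓ₂)
  ℝ⁺ z = 0# < Re z × Im z ≈ 0#
  ℝ⁻ z = Re z < 0# × Im z ≈ 0#

  -- The principal square root in Cartesian form: the square root with
  -- positive real part, or, on the closed negative real axis, the one with
  -- zero real part and non-negative imaginary part.
  √ᶜ_ : ℂ → ℂ
  √ᶜ z = √ ((∣ z ∣ + Re z) * 2# ⁻¹) +i
         (if does (0# ≤? Im z) then v else - v)
    where v = √ ((∣ z ∣ - Re z) * 2# ⁻¹)

  open MatrixOver ℂ-rawRing public

  -- vol²(A) = v.  Submatrices are counted by their row and column positions.
  IsVol² : ∀ {p q} → Matrix p q → Carrier → Set (c ⊔ ℓ₁)
  IsVol² {p} {q} A v = ∃ λ r → IsRank A r × 0 ℕ.< r ×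
    v ≈ ∑ (choose p r) λ ρ → ∑ (choose q r) λ κ →
      ∣ det (submatrix A ρ κ) ∣ * ∣ det (submatrix A ρ κ) ∣

------------------------------------------------------------------------
-- Oriented graphs

-- Vertices are Fin n and edges are indexed by Fin m; edge e is directed
-- from src e to tgt e.  The condition `simple` says that distinct edges
-- have distinct underlying undirected edges.
record OrientedGraph (n m : ℕ) : Set where
  field
    src tgt  : Fin m → Fin n
    loopless : ∀ e → src e ≢ tgt e
    simple   : ∀ e f →
      (src e ≡ src f × tgt e ≡ tgt f) ⊎ (src e ≡ tgt f × tgt e ≡ src f) → e ≡ f

  HasDirection : Fin m → Fin n → Fin n → Set
  HasDirection e i j = src e ≡ i × tgt e ≡ j

  Joins : Fin m → Fin n → Fin n → Set
  Joins e i j = HasDirection e i j ⊎ HasDirection e j i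

  hasDirection? : ∀ e i j → Dec (HasDirection e i j)
  hasDirection? e i j = src e ≟ i ×-dec tgt e ≟ j

  joins? : ∀ e i j → Dec (Joins e i j)
  joins? e i j = hasDirection? e i j ⊎-dec hasDirection? e j i

-- Reflexive-transitive closure of a decidable relation on Fin n is
-- decidable: Via ks is reachability through intermediate vertices in ks.
module Reachability {n} {ℓ} {R : Rel (Fin n) ℓ} (R? : Decidable R) where

  Via : List (Fin n) → Rel (Fin n) ℓ
  Via []       i j = i ≡ j ⊎ R i j
  Via (k ∷ ks) i j = Via ks i j ⊎ (Via ks i k × Via ks k j)

  via? : ∀ ks → Decidable (Via ks)
  via? []       i j = i ≟ j ⊎-dec R? i j
  via? (k ∷ ks) i j = via? ks i j ⊎-dec (via? ks i k ×-dec via? ks k j)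

  via⇒star : ∀ ks {i j} → Via ks i j → Star R i j
  via⇒star []       (inj₁ refl)    = ε
  via⇒star []       (inj₂ r)       = r ◅ ε
  via⇒star (k ∷ ks) (inj₁ v)       = via⇒star ks v
  via⇒star (k ∷ ks) (inj₂ (u , v)) = via⇒star ks u ◅◅ via⇒star ks v

  base : ∀ ks {i j} → Via [] i j → Via ks i j
  base []       v = v
  base (k ∷ ks) v = inj₁ (base ks v)

  join : ∀ {ks i j k} → k ∈ₗ ks → Via ks i k → Via ks k j → Via ks i j
  join (here refl) u v = inj₂ ([ id , proj₁ ]′ u , [ id , proj₂ ]′ v)
  join (there k∈)  (inj₁ u)       (inj₁ v)       = inj₁ (join k∈ u v)
  join (there k∈)  (inj₁ u)       (inj₂ (v , t)) = inj₂ (join k∈ u v , t)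
  join (there k∈)  (inj₂ (s , u)) (inj₁ v)       = inj₂ (s , join k∈ u v)
  join (there k∈)  (inj₂ (s , u)) (inj₂ (v , t)) = inj₂ (s , t)

  star⇒via : ∀ {i j} → Star R i j → Via (allFin n) i j
  star⇒via ε        = base (allFin n) (inj₁ refl)
  star⇒via (r ◅ rs) =
    join (∈-allFin _) (base (allFin n) (inj₂ r)) (star⇒via rs)

  star? : Decidable (Star R)
  star? i j = map′ (via⇒star (allFin n)) star⇒via (via? (allFin n) i j)

unique⇒length≤ : ∀ {n} {xs : List (Fin n)} → Unique xs → length xs ℕ.≤ n
unique⇒length≤ {n} u = injective⇒≤ (inj u)
  where
  inj : ∀ {xs : List (Fin n)} → Unique xs → ∀ {i j} →
        List.lookup xs i ≡ List.lookup xs j → i ≡ j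
  inj (x∉ ∷ u) {zero}  {zero}  eq = refl
  inj (x∉ ∷ u) {zero}  {suc j} eq = contradiction eq (All.lookup x∉ (∈-lookup j))
  inj (x∉ ∷ u) {suc i} {zero}  eq = contradiction (sym eq) (All.lookup x∉ (∈-lookup i))
  inj (x∉ ∷ u) {suc i} {suc j} eq = cong suc (inj u eq)

anyList≤? : ∀ {n p} k {P : Pred (List (Fin n)) p} → Decidable₁ P →
            Dec (∃ λ xs → length xs ℕ.≤ k × P xs)
anyList≤? zero    P? = map′ (λ p → [] , z≤n , p) (λ { ([] , _ , p) → p }) (P? [])
anyList≤? (suc k) P? = map′
  [ (λ p → [] , z≤n , p) , (λ { (x , xs , l , p) → x ∷ xs , s≤s l , p }) ]′
  (λ { ([] , _ , p) → inj₁ p ; (x ∷ xs , s≤s l , p) → inj₂ (x , xs , l , p) })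
  (P? [] ⊎-dec any? λ x → anyList≤? k (P? ∘ (x ∷_)))

module Graphs {n m} (G : OrientedGraph n m) where
  open OrientedGraph G

  record Subgraph : Set where
    constructor ⟨_,_⟩
    field
      V : Subset n
      E : Subset m
  open Subgraph public

  spanning : Subset m → Subgraph
  spanning S = ⟨ ⊤ , S ⟩

  whole : Subgraph
  whole = spanning ⊤

  spanningSubgraphs : List Subgraph
  spanningSubgraphs = map spanning (allSubsets m)

  -- Adjacency in the underlying undirected graph.
  Adj : Subgraph → Rel (Fin n) _
  Adj H i j = ∃ λ e → e ∈ E H × Joins e i j

  Connected : Subgraph → Set
  Connected H = Nonempty (V H) × (∀ i → i ∈ V H → ∀ j → j ∈ V H → Star (Adj H) i j)

  -- A component is given by its vertex set X: the subgraph induced on X is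
  -- connected and no edge of H leaves X.
  induced : Subgraph → Subset n → Subgraph
  induced H X = ⟨ X , E H ∩ tabulate (λ e → does (src e ∈? X) ∧ does (tgt e ∈? X)) ⟩

  IsComponent : Subgraph → Subset n → Set
  IsComponent H X = X ⊆ V H × Connected (induced H X) ×
    (∀ e → e ∈ E H → (src e ∈ X → tgt e ∈ X) × (tgt e ∈ X → src e ∈ X))

  closeUp : List (Fin n) → List (Fin n)
  closeUp []       = []
  closeUp (x ∷ xs) = (x ∷ xs) ∷ʳ x

  IsCycle : Subgraph → List (Fin n) → Set
  IsCycle H vs = 3 ℕ.≤ length vs × Unique vs × Linked (Adj H) (closeUp vs)

  -- A cycle presented by a starting vertex and a direction of traversal.
  record Cycle (H : Subgraph) : Set where
    constructor cycle
    field
      vertices : List (Fin n)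
      isCycle  : IsCycle H vertices

    walk : List (Fin n)
    walk = closeUp vertices

    Even Odd : Set
    Even = 2 ∣ length vertices
    Odd  = ¬ Even

    even? : Dec Even
    even? = 2 ∣? length vertices

  edgesOf : List (Fin n) → Subset m
  edgesOf (x ∷ y ∷ ys) = tabulate (λ e → does (joins? e x y)) ∪ edgesOf (y ∷ ys)
  edgesOf _            = ⊥

  cycleEdges : ∀ {H} → Cycle H → Subset m
  cycleEdges C = edgesOf (Cycle.walk C)

  IsTree : Subgraph → Set
  IsTree H = Connected H × ¬ Cycle H

  -- Presentations with the same edges are the same cycle.
  Unicyclic : Subgraph → Set
  Unicyclic H = Connected H ×
    Σ (Cycle H) λ C → (D : Cycle H) → cycleEdges D ≡ cycleEdges C

  adj? : ∀ H → Decidable (Adj H)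
  adj? H i j = any? λ e → e ∈? E H ×-dec joins? e i j

  connected? : Decidable₁ Connected
  connected? H = nonempty? (V H) ×-dec
    all? λ i → i ∈? V H →-dec all? λ j → j ∈? V H →-dec star? i j
    where open Reachability (adj? H)

  isComponent? : ∀ H → Decidable₁ (IsComponent H)
  isComponent? H X = X ⊆? V H ×-dec connected? (induced H X) ×-dec
    all? λ e → e ∈? E H →-dec
      ((src e ∈? X →-dec tgt e ∈? X) ×-dec (tgt e ∈? X →-dec src e ∈? X))

  isCycle? : ∀ H → Decidable₁ (IsCycle H)
  isCycle? H vs =
    3 ℕ.≤? length vs ×-dec DecUnique.unique? _≟_ vs ×-dec linked? (adj? H) (closeUp vs)

  anyCycle? : ∀ {p} H {P : Pred (List (Fin n)) p} → Decidable₁ P →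
              Dec (Σ (Cycle H) (P ∘ Cycle.vertices))
  anyCycle? H P? = map′
    (λ { (vs , _ , c , p) → cycle vs c , p })
    (λ { (cycle vs c , p) → vs , unique⇒length≤ (proj₁ (proj₂ c)) , c , p })
    (anyList≤? n λ vs → isCycle? H vs ×-dec P? vs)

  isTree? : Decidable₁ IsTree
  isTree? H = connected? H ×-dec ¬? (map′ proj₁ (_, tt) (anyCycle? H λ _ → yes tt))

  unicyclic? : Decidable₁ Unicyclic
  unicyclic? H = connected? H ×-dec anyCycle? H λ vs → map′
    (λ ¬other D → decidable-stable (cycleEdges D ≟ˢ edgesOf (closeUp vs))
      λ D≢ → ¬other (D , D≢))
    (λ same (D , D≢) → D≢ (same D))
    (¬? (anyCycle? H λ ws → ¬? (edgesOf (closeUp ws) ≟ˢ edgesOf (closeUp vs))))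
    where
    _≟ˢ_ : Decidable {A = Subset m} _≡_
    _≟ˢ_ = ≡-dec _≟ᵇ_

  components : Subgraph → List Subgraph
  components H = map (induced H) (filter (isComponent? H) (allSubsets n))

  spanningTrees : List Subgraph
  spanningTrees = filter isTree? spanningSubgraphs

  AllUnicyclic : Subgraph → Set
  AllUnicyclic H = All Unicyclic (components H)

  -- 𝒰(G), each member paired with the cycles of its components.
  unicyclicSpanningSubgraphs : List (Σ Subgraph AllUnicyclic)
  unicyclicSpanningSubgraphs = mapMaybe
    (λ H → Maybe.map (H ,_) (dec⇒maybe (All.all? unicyclic? (components H))))
    spanningSubgraphs

------------------------------------------------------------------------
-- Weighted oriented graphs

module WeightedGraphs {c ℓ₁ ℓ₂} (ℝ : RealField c ℓ₁ ℓ₂) {n m} (G : OrientedGraph n m)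
                      (w : Fin m → ComplexNumbers.ℂ ℝ) where
  open RealField ℝ
  open ComplexNumbers ℝ public
  open OrientedGraph G
  open Graphs G public
  open RawMonoidOps +-rawMonoid public using () renaming (_×_ to _·_)

  N : Matrix n m
  N i e = if does (i ≟ src e) then √ᶜ (w e)
          else if does (i ≟ tgt e) then √ᶜ (conj (w e))
          else 0ᶜ

  a : Matrix n n
  a i j with any? (λ e → hasDirection? e i j) | any? (λ e → hasDirection? e j i)
  ... | yes (e , _) | _           = w e
  ... | no _        | yes (e , _) = conj (w e)
  ... | no _        | no _        = 0ᶜ

  walkWeight : List (Fin n) → ℂ
  walkWeight (i ∷ j ∷ γ) = a i j *ᶜ walkWeight (j ∷ γ)
  walkWeight _           = 1ᶜ

  wt : ∀ {H} → Cycle H → ℂ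
  wt C = walkWeight (Cycle.walk C)

  W : Subset m → ℂ
  W S = List.foldr (λ e z → w e *ᶜ z) 1ᶜ (filter (_∈? S) (allFin m))

  α : ∀ {H} → Cycle H → Carrier
  α C = if does (Cycle.even? C) then ∣ wt C ∣ - Re (wt C) else ∣ wt C ∣ + Re (wt C)

  componentFactor : ∀ {U} → Unicyclic U → Carrier
  componentFactor {U} (_ , C , _) = 2# * ∣ W (E U ─ cycleEdges C) ∣ * α C

  unicyclicTerm : Σ Subgraph AllUnicyclic → Carrier
  unicyclicTerm (H , us) = List.foldr _*_ 1# (reduce componentFactor us)

module Submission where

-- Each n × n minor of N belongs to a set S of n edges, and after a
-- simultaneous reordering it is block diagonal over the components of S.
-- A component contributes 0 unless it has as many edges as vertices, i.e. is
-- unicyclic; it is then grown from its cycle by adding leaves.  A leaf e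
-- multiplies the squared modulus of the determinant by |w_e|, and the cycle
-- itself has determinant A ∓ B, where A and B are the products of the
-- entries of N along the two orientations and A · conj B = wt(C), whence
-- |A ∓ B|² = 2 α(C).
--
-- In (b) some α(C) is non-zero.  The relation x_u N_ue + x_v N_ve = 0 along
-- the edges then forces a left null vector x to vanish on C, hence everywhere,
-- so the rank is n.  In (a) all α(C) vanish, hence so do all n × n minors and
-- the rank is n - 1.  A minor omitting row k is |W_T| when S is a spanning
-- tree T (grown from k), and otherwise 0: the columns are too many, or some
-- component avoids k.

-- Only squared moduli of minors enter vol², so no sign of a permutation is ever computed: minors
-- are a function `d` of a list of rows and a list of columns, and the combinatorics takes place on
-- lists up to `↭`. The one sign that matters is that of the cyclic shift along a cycle, which
-- separates even from odd cycles. The weights avoid ℝ⁻ because √(conj w) = conj(√w) fails exactly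
-- there. This identity gives N_ue · conj(N_ve) = a_uv for an edge e between u and v, and hence the
-- link between determinants and walk weights. The 2 in front of α(C) arises from |A|² = |B|² =
-- |wt(C)| together with the cross term of |A ∓ B|². The factor n in (a) counts the choices of the
-- omitted row: the sum over trees is the same for each of them. Rank is defined through independent
-- rows. The bound n - 1 in (a) therefore needs an explicit dependency among any n rows, and
-- cofactors supply it: all n × n minors vanish, while the minor of one spanning tree does not.

open import Defs
open import Algebra.Bundles using (CommutativeRing; RawRing)
import Algebra.Definitions.RawMonoid as RawMonoidOps
import Algebra.Properties.Ring as RingProperties
import Algebra.Properties.Semiring.Mult as Mult
import Algebra.Solver.Ring as RingSolver
open import Algebra.Solver.Ring.AlmostCommutativeRing using (fromCommutativeRing; _-Raw-AlmostCommutative⟶_)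
open import Data.Bool.Base using (if_then_else_)
open import Data.Empty using (⊥; ⊥-elim)
open import Data.Fin.Base using (Fin; zero; suc; punchIn)
open import Data.Fin.Properties using (_≟_; any?; ¬∀⟶∃¬; injective⇒≤)
open import Data.Fin.Subset using (Subset; inside; outside; ⊤; _─_) renaming (_∈_ to _∈ˢ_; _⊆_ to _⊆ˢ_)
import Data.Fin.Subset.Properties as Subset
open import Data.List.Base as List using (List; []; _∷_; [_]; _++_; _∷ʳ_; length; filter; allFin; concatMap; map; mapMaybe)
import Data.List.Properties as List
open import Data.List.Membership.Propositional using (_∈_; _∉_)
open import Data.List.Membership.Propositional.Properties using (∈-++⁺ˡ; ∈-++⁺ʳ; ∈-++⁻; ∈-∃++; ∈-filter⁺; ∈-filter⁻; ∈-allFin; ∈-map⁺; ∈-map⁻)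
import Data.List.Membership.DecPropositional as DecMembership
open import Data.List.Relation.Binary.Permutation.Propositional as ↭ using (_↭_; prep; swap; ↭-sym; ↭-trans; ↭-refl; ↭-reflexive)
open import Data.List.Relation.Binary.Permutation.Propositional.Properties using (All-resp-↭; ∈-resp-↭; shift; ↭-length; ∷↭∷ʳ; drop-∷; ++⁺ʳ; ++-comm) renaming (map⁺ to ↭-map⁺)
open import Data.List.Relation.Unary.All as All using (All; []; _∷_; reduce)
import Data.List.Relation.Unary.All.Properties as All
open import Data.List.Relation.Unary.AllPairs using ([]; _∷_)
open import Data.List.Relation.Unary.Any using (here; there)
open import Data.List.Relation.Unary.Linked as Linked using (Linked; []; [-]; _∷_)
open import Data.List.Relation.Unary.Unique.Propositional using (Unique)
import Data.List.Relation.Unary.Unique.DecPropositional as DecUnique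
import Data.List.Relation.Unary.Unique.Propositional.Properties as Unique
open import Data.Maybe.Base as Maybe using (Maybe)
open import Data.Nat.Base as ℕ using (ℕ; zero; suc; z≤n; s≤s)
open import Data.Nat.Divisibility using (_∣_; _∣?_; ∣m+n∣m⇒∣n; ∣m∣n⇒∣m+n; ∣-refl; _∣0; ∣⇒≤)
import Data.Nat.Properties as ℕ
open import Data.Product.Base using (Σ; ∃; ∃₂; _×_; _,_; proj₁; proj₂)
open import Data.Sum.Base as Sum using (_⊎_; inj₁; inj₂; [_,_]′)
open import Data.Vec.Base as Vec using (Vec; []; _∷_)
import Data.Vec.Properties as Vec
open import Function.Base using (_∘_; id)
open import Level using (0ℓ)
open import Relation.Binary.Construct.Closure.ReflexiveTransitive as Star using (Star; ε; _◅_; _◅◅_)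
open import Relation.Binary.Core using (Rel)
open import Relation.Binary.PropositionalEquality as ≡ using (_≡_; _≢_)
import Relation.Binary.Reasoning.Setoid as SetoidReasoning
open import Relation.Binary.Structures using (IsDecTotalOrder)
open import Relation.Nullary using (Dec; yes; no; does; ¬_; contradiction)
open import Relation.Nullary.Decidable using (dec-true; dec⇒maybe; ¬?; _×-dec_)
open import Relation.Unary using (Pred) renaming (Decidable to Decidable₁)

-- The ring solver with coefficients in ℤ, encoded as formal differences
-- (m , n) of natural numbers; coefficients in the ring itself would not
-- cancel, its equality being abstract.
module IntegerSolver {a ℓ} (R : CommutativeRing a ℓ) where
  open CommutativeRing R
  open Mult semiring using (×-homo-+; ×1-homo-*; ×-congˡ) renaming (_×_ to _·ⁿ_)
  open RingProperties ring using (-0#≈0#; -‿+-comm; -‿distribˡ-*; -‿distribʳ-*; -‿involutive)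
  open import Relation.Binary.Reasoning.Setoid setoid
  open import Algebra.Properties.CommutativeSemigroup +-commutativeSemigroup using (interchange)

  ⟦_⟧ⁿ : ℕ → Carrier
  ⟦ n ⟧ⁿ = n ·ⁿ 1#

  differences : RawRing _ _
  differences = record
    { Carrier = ℕ × ℕ
    ; _≈_     = _≡_
    ; _+_     = λ (a , b) (c , d) → a ℕ.+ c , b ℕ.+ d
    ; _*_     = λ (a , b) (c , d) → a ℕ.* c ℕ.+ b ℕ.* d , a ℕ.* d ℕ.+ b ℕ.* c
    ; -_      = λ (a , b) → b , a
    ; 0#      = 0 , 0
    ; 1#      = 1 , 0
    }

  -- 0 and 1 are interpreted by 0# and 1# on the nose, so that they can
  -- occur in solver equations.
  ⟦_⟧ᵈ : ℕ × ℕ → Carrier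
  ⟦ 0 , 0 ⟧ᵈ = 0#
  ⟦ 1 , 0 ⟧ᵈ = 1#
  ⟦ a , b ⟧ᵈ = ⟦ a ⟧ⁿ - ⟦ b ⟧ⁿ

  private
    -- The interpretation without special values at 0 and 1. The homomorphism laws are proved for it
    -- without case distinctions and then carried over along `d≈g`.
    ⟦_⟧ᵍ : ℕ × ℕ → Carrier
    ⟦ a , b ⟧ᵍ = ⟦ a ⟧ⁿ - ⟦ b ⟧ⁿ

    d≈g : ∀ p → ⟦ p ⟧ᵈ ≈ ⟦ p ⟧ᵍ
    d≈g (0 , 0)           = sym (-‿inverseʳ 0#)
    d≈g (1 , 0)           = begin
      1#              ≈⟨ +-identityʳ 1# ⟨
      1# + 0#         ≈⟨ +-cong (+-identityʳ 1#) -0#≈0# ⟨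
      (1# + 0#) - 0#  ∎
    d≈g (0 , suc b)       = refl
    d≈g (1 , suc b)       = refl
    d≈g (suc (suc a) , b) = refl

    x+y-[x′+y′] : ∀ x y x′ y′ → (x + y) - (x′ + y′) ≈ (x - x′) + (y - y′)
    x+y-[x′+y′] x y x′ y′ = begin
      (x + y) - (x′ + y′)     ≈⟨ +-congˡ (-‿+-comm x′ y′) ⟨
      (x + y) + (- x′ - y′)   ≈⟨ interchange x y (- x′) (- y′) ⟩
      (x - x′) + (y - y′)     ∎

    -‿flip : ∀ x y → x - y ≈ - (y - x)
    -‿flip x y = begin
      x - y         ≈⟨ +-comm _ _ ⟩
      - y + x       ≈⟨ +-congˡ (-‿involutive x) ⟨
      - y - - x     ≈⟨ -‿+-comm y (- x) ⟩
      - (y - x)     ∎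

    [x-y]z : ∀ x y z → (x - y) * z ≈ x * z - y * z
    [x-y]z x y z = trans (distribʳ z x (- y)) (+-congˡ (sym (-‿distribˡ-* y z)))

    z[x-y] : ∀ z x y → z * (x - y) ≈ z * x - z * y
    z[x-y] z x y = trans (distribˡ z x (- y)) (+-congˡ (sym (-‿distribʳ-* z y)))

    +-homo : ∀ p q → ⟦ RawRing._+_ differences p q ⟧ᵍ ≈ ⟦ p ⟧ᵍ + ⟦ q ⟧ᵍ
    +-homo (a , b) (c , d) = trans
      (+-cong (×-homo-+ 1# a c) (-‿cong (×-homo-+ 1# b d))) (x+y-[x′+y′] _ _ _ _)

    ⟦⟧-+-* : ∀ a b c d → ⟦ a ℕ.* b ℕ.+ c ℕ.* d ⟧ⁿ ≈ ⟦ a ⟧ⁿ * ⟦ b ⟧ⁿ + ⟦ c ⟧ⁿ * ⟦ d ⟧ⁿ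
    ⟦⟧-+-* a b c d = trans (×-homo-+ 1# (a ℕ.* b) (c ℕ.* d)) (+-cong (×1-homo-* a b) (×1-homo-* c d))

    *-homo : ∀ p q → ⟦ RawRing._*_ differences p q ⟧ᵍ ≈ ⟦ p ⟧ᵍ * ⟦ q ⟧ᵍ
    *-homo (a , b) (c , d) = begin
      ⟦ a ℕ.* c ℕ.+ b ℕ.* d ⟧ⁿ - ⟦ a ℕ.* d ℕ.+ b ℕ.* c ⟧ⁿ
        ≈⟨ +-cong (⟦⟧-+-* a c b d) (-‿cong (⟦⟧-+-* a d b c)) ⟩
      (A * C + B * D) - (A * D + B * C)  ≈⟨ x+y-[x′+y′] _ _ _ _ ⟩
      (A * C - A * D) + (B * D - B * C)  ≈⟨ +-congˡ (-‿flip _ _) ⟩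
      (A * C - A * D) - (B * C - B * D)  ≈⟨ +-cong (z[x-y] A C D) (-‿cong (z[x-y] B C D)) ⟨
      A * (C - D) - B * (C - D)          ≈⟨ [x-y]z A B (C - D) ⟨
      (A - B) * (C - D)                  ∎
      where A = ⟦ a ⟧ⁿ ; B = ⟦ b ⟧ⁿ ; C = ⟦ c ⟧ⁿ ; D = ⟦ d ⟧ⁿ

    morphism : differences -Raw-AlmostCommutative⟶ fromCommutativeRing R
    morphism = record
      { ⟦_⟧    = ⟦_⟧ᵈ
      ; +-homo = λ p q → trans (d≈g (RawRing._+_ differences p q)) (trans (+-homo p q) (sym (+-cong (d≈g p) (d≈g q))))
      ; *-homo = λ p q → trans (d≈g (RawRing._*_ differences p q)) (trans (*-homo p q) (sym (*-cong (d≈g p) (d≈g q))))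
      ; -‿homo = λ (a , b) → trans (d≈g (b , a)) (trans (-‿flip ⟦ b ⟧ⁿ ⟦ a ⟧ⁿ) (-‿cong (sym (d≈g (a , b)))))
      ; 0-homo = refl
      ; 1-homo = refl
      }

    -- Cross sums identify formal differences such as `(1 , 1)` and `(0 , 0)`, which literal
    -- equality of pairs would keep apart; this is what lets the solver cancel.
    ≈-from-ℕ : ∀ a b c d → a ℕ.+ d ≡ c ℕ.+ b → ⟦ a , b ⟧ᵍ ≈ ⟦ c , d ⟧ᵍ
    ≈-from-ℕ a b c d eq = begin
      A - B                  ≈⟨ +-identityʳ _ ⟨
      (A - B) + 0#           ≈⟨ +-congˡ (-‿inverseʳ D) ⟨
      (A - B) + (D - D)      ≈⟨ interchange A (- B) D (- D) ⟩
      (A + D) + (- B - D)    ≈⟨ +-congʳ (trans (sym (×-homo-+ 1# a d)) (trans (×-congˡ eq) (×-homo-+ 1# c b))) ⟩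
      (C + B) + (- B - D)    ≈⟨ +-congˡ (+-comm _ _) ⟩
      (C + B) + (- D - B)    ≈⟨ interchange C B (- D) (- B) ⟩
      (C - D) + (B - B)      ≈⟨ +-congˡ (-‿inverseʳ B) ⟩
      (C - D) + 0#           ≈⟨ +-identityʳ _ ⟩
      C - D                  ∎
      where A = ⟦ a ⟧ⁿ ; B = ⟦ b ⟧ⁿ ; C = ⟦ c ⟧ⁿ ; D = ⟦ d ⟧ⁿ

    weaklyDecidable : ∀ p q → Maybe (⟦ p ⟧ᵈ ≈ ⟦ q ⟧ᵈ)
    weaklyDecidable (a , b) (c , d) =
      Maybe.map (λ eq → trans (d≈g (a , b)) (trans (≈-from-ℕ a b c d eq) (sym (d≈g (c , d))))) (dec⇒maybe (a ℕ.+ d ℕ.≟ c ℕ.+ b))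

  open RingSolver differences (fromCommutativeRing R) morphism weaklyDecidable public
    using (solve; _:=_; _:+_; _:*_; _:-_; :-_; con; Polynomial)

  :0 :1 : ∀ {n} → Polynomial n
  :0 = con (0 , 0)
  :1 = con (1 , 0)

-- Ordered field arithmetic and real square roots

module RealFacts {c ℓ₁ ℓ₂} (ℝ : RealField c ℓ₁ ℓ₂) where
  open RealField ℝ
  open ComplexNumbers ℝ
  private module O = IsDecTotalOrder isDecTotalOrder
  open O using () renaming (trans to ≤-trans; antisym to ≤-antisym; total to ≤-total; reflexive to ≤-reflexive)
  open IntegerSolver commutativeRing
  open RingProperties ring using (x∙y⁻¹≈ε⇒x≈y)
  open import Relation.Binary.Reasoning.Setoid setoid

  ≤-resp : ∀ {x x′ y y′} → x ≈ x′ → y ≈ y′ → x ≤ y → x′ ≤ y′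
  ≤-resp e f p = ≤-trans (≤-reflexive (sym e)) (≤-trans p (≤-reflexive f))

  +-nonNeg : ∀ {x y} → 0# ≤ x → 0# ≤ y → 0# ≤ x + y
  +-nonNeg {x} {y} p q = ≤-trans q (≤-resp (+-identityˡ y) refl (+-monoˡ-≤ y p))

  ≤⇒0≤- : ∀ {x y} → x ≤ y → 0# ≤ y - x
  ≤⇒0≤- {x} p = ≤-resp (-‿inverseʳ x) refl (+-monoˡ-≤ (- x) p)

  0≤-⇒≤ : ∀ {x y} → 0# ≤ y - x → x ≤ y
  0≤-⇒≤ {x} {y} p = ≤-resp (+-identityˡ x)
    (solve 2 (λ x y → (y :- x) :+ x := y) refl x y) (+-monoˡ-≤ x p)

  ≤0⇒0≤- : ∀ {x} → x ≤ 0# → 0# ≤ - x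
  ≤0⇒0≤- {x} p = ≤-resp refl (+-identityˡ (- x)) (≤⇒0≤- p)

  square-nonNeg : ∀ x → 0# ≤ x * x
  square-nonNeg x with ≤-total 0# x
  ... | inj₁ p = *-nonNeg p p
  ... | inj₂ p = ≤-resp refl (solve 1 (λ x → (:- x) :* (:- x) := x :* x) refl x)
                   (*-nonNeg (≤0⇒0≤- p) (≤0⇒0≤- p))

  0≤1 : 0# ≤ 1#
  0≤1 = ≤-resp refl (*-identityˡ 1#) (square-nonNeg 1#)

  nonNeg-sum≈0 : ∀ {x y} → 0# ≤ x → 0# ≤ y → x + y ≈ 0# → x ≈ 0#
  nonNeg-sum≈0 {x} {y} p q e = ≤-antisym
    (0≤-⇒≤ (≤-resp refl (begin
      y             ≈⟨ solve 2 (λ x y → y := (x :+ y) :- x) refl x y ⟩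
      (x + y) - x   ≈⟨ +-congʳ e ⟩
      0# - x        ∎) q)) p

  nonNeg-sum≈0ʳ : ∀ {x y} → 0# ≤ x → 0# ≤ y → x + y ≈ 0# → y ≈ 0#
  nonNeg-sum≈0ʳ p q e = nonNeg-sum≈0 q p (trans (+-comm _ _) e)

  2≉0 : 2# ≉ 0#
  2≉0 e = 0≉1 (sym (nonNeg-sum≈0 0≤1 0≤1 e))

  0≤2 : 0# ≤ 2#
  0≤2 = +-nonNeg 0≤1 0≤1

  integral : ∀ {x y} → x * y ≈ 0# → x ≈ 0# ⊎ y ≈ 0#
  integral {x} {y} e with O._≟_ x 0#
  ... | yes p = inj₁ p
  ... | no ¬p = inj₂ (begin
    y                ≈⟨ *-identityˡ y ⟨
    1# * y           ≈⟨ *-congʳ (*-inverseʳ x ¬p) ⟨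
    (x * x ⁻¹) * y   ≈⟨ solve 3 (λ x i y → (x :* i) :* y := i :* (x :* y)) refl x (x ⁻¹) y ⟩
    x ⁻¹ * (x * y)   ≈⟨ *-congˡ e ⟩
    x ⁻¹ * 0#        ≈⟨ zeroʳ _ ⟩
    0#               ∎)

  square≈0 : ∀ {x} → x * x ≈ 0# → x ≈ 0#
  square≈0 e = [ id , id ]′ (integral e)

  *-cancelˡ-nonZero : ∀ {x y z} → x ≉ 0# → x * y ≈ x * z → y ≈ z
  *-cancelˡ-nonZero {x} {y} {z} x≉0 e
    with integral {x} {y - z} (trans (solve 3 (λ x y z → x :* (y :- z) := x :* y :- x :* z) refl x y z)
                                (trans (+-congʳ e) (-‿inverseʳ _)))
  ... | inj₁ p = contradiction p x≉0
  ... | inj₂ p = x∙y⁻¹≈ε⇒x≈y y z p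

  -- From (x - y)(x + y) = 0. If the second factor vanishes, nonnegativity makes both x and y zero.
  square-injective : ∀ {x y} → 0# ≤ x → 0# ≤ y → x * x ≈ y * y → x ≈ y
  square-injective {x} {y} p q e
    with integral {x - y} {x + y} (trans (solve 2 (λ x y → (x :- y) :* (x :+ y) := x :* x :- y :* y) refl x y)
                                (trans (+-congʳ e) (-‿inverseʳ _)))
  ... | inj₁ r = x∙y⁻¹≈ε⇒x≈y x y r
  ... | inj₂ r = trans (nonNeg-sum≈0 p q r) (sym (nonNeg-sum≈0ʳ p q r))

  √-unique : ∀ {x y} → 0# ≤ x → 0# ≤ y → y * y ≈ x → √ x ≈ y
  √-unique p q e = square-injective (√-nonNeg _ p) q (trans (√-square _ p) (sym e))

  -- The axioms do not postulate that `√_` respects `≈`; on nonnegative arguments it does, because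
  -- they determine its value there.
  √-cong : ∀ {x y} → 0# ≤ x → x ≈ y → √ x ≈ √ y
  √-cong p e = √-unique p (√-nonNeg _ p′) (trans (√-square _ p′) (sym e))
    where p′ = ≤-resp refl e p

  half : ∀ {x} → 2# * (x * 2# ⁻¹) ≈ x
  half {x} = begin
    2# * (x * 2# ⁻¹)  ≈⟨ solve 3 (λ t x i → t :* (x :* i) := (t :* i) :* x) refl 2# x (2# ⁻¹) ⟩
    (2# * 2# ⁻¹) * x  ≈⟨ *-congʳ (*-inverseʳ 2# 2≉0) ⟩
    1# * x            ≈⟨ *-identityˡ x ⟩
    x                 ∎

  -- The sign of `2# ⁻¹` is never determined. If x/2 were at most 0, then so would be its double x,
  -- so x and with it x/2 would be 0.
  half-nonNeg : ∀ {x} → 0# ≤ x → 0# ≤ x * 2# ⁻¹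
  half-nonNeg {x} p with ≤-total 0# (x * 2# ⁻¹)
  ... | inj₁ q = q
  ... | inj₂ q = ≤-reflexive (sym (trans (*-congʳ x≈0) (zeroˡ _)))
    where
    x≈0 : x ≈ 0#
    x≈0 = ≤-antisym (0≤-⇒≤ (≤-resp refl
      (trans (solve 2 (λ t y → t :* (:- y) := :0 :- t :* y) refl 2# (x * 2# ⁻¹)) (+-congˡ (-‿cong half)))
      (*-nonNeg 0≤2 (≤0⇒0≤- q)))) p

  nonZero-* : ∀ {x y} → x ≉ 0# → y ≉ 0# → x * y ≉ 0#
  nonZero-* p q e = [ p , q ]′ (integral e)

-- Complex moduli and the principal square root

module ComplexFacts {c ℓ₁ ℓ₂} (ℝ : RealField c ℓ₁ ℓ₂) where
  open RealField ℝ
  open ComplexNumbers ℝ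
  open RealFacts ℝ
  private module O = IsDecTotalOrder isDecTotalOrder
  open O using () renaming (trans to ≤-trans; antisym to ≤-antisym; total to ≤-total; reflexive to ≤-reflexive)
  open IntegerSolver commutativeRing
  open RingProperties ring using (-0#≈0#; -‿involutive)
  open import Relation.Binary.Reasoning.Setoid setoid

  ℂ-commutativeRing : CommutativeRing c ℓ₁
  ℂ-commutativeRing = record
    { Carrier = ℂ
    ; _≈_     = _≈ᶜ_
    ; _+_     = _+ᶜ_
    ; _*_     = _*ᶜ_
    ; -_      = -ᶜ_
    ; 0#      = 0ᶜ
    ; 1#      = 1ᶜ
    ; isCommutativeRing = record
      { isRing = record
        { +-isAbelianGroup = record
          { isGroup = record
            { isMonoid = record
              { isSemigroup = record
                { isMagma = record
                  { isEquivalence = record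
                    { refl  = refl , refl
                    ; sym   = λ (p , q) → sym p , sym q
                    ; trans = λ (p , q) (r , s) → trans p r , trans q s
                    }
                  ; ∙-cong = λ (p , q) (r , s) → +-cong p r , +-cong q s
                  }
                ; assoc = λ x y z → +-assoc _ _ _ , +-assoc _ _ _
                }
              ; identity = (λ x → +-identityˡ _ , +-identityˡ _) , (λ x → +-identityʳ _ , +-identityʳ _)
              }
            ; inverse = (λ x → -‿inverseˡ _ , -‿inverseˡ _) , (λ x → -‿inverseʳ _ , -‿inverseʳ _)
            ; ⁻¹-cong = λ (p , q) → -‿cong p , -‿cong q
            }
          ; comm = λ x y → +-comm _ _ , +-comm _ _
          }
        ; *-cong = λ (p , q) (r , s) →
            +-cong (*-cong p r) (-‿cong (*-cong q s)) , +-cong (*-cong p s) (*-cong q r)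
        ; *-assoc = λ x y z →
            solve 6 (λ a b c d e f → (a :* c :- b :* d) :* e :- (a :* d :+ b :* c) :* f
                                  := a :* (c :* e :- d :* f) :- b :* (c :* f :+ d :* e)) refl
              (Re x) (Im x) (Re y) (Im y) (Re z) (Im z) ,
            solve 6 (λ a b c d e f → (a :* c :- b :* d) :* f :+ (a :* d :+ b :* c) :* e
                                  := a :* (c :* f :+ d :* e) :+ b :* (c :* e :- d :* f)) refl
              (Re x) (Im x) (Re y) (Im y) (Re z) (Im z)
        ; *-identity =
            (λ x → solve 2 (λ a b → :1 :* a :- :0 :* b := a) refl (Re x) (Im x) ,
                   solve 2 (λ a b → :1 :* b :+ :0 :* a := b) refl (Re x) (Im x)) ,
            (λ x → solve 2 (λ a b → a :* :1 :- b :* :0 := a) refl (Re x) (Im x) ,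
                   solve 2 (λ a b → a :* :0 :+ b :* :1 := b) refl (Re x) (Im x))
        ; distrib =
            (λ x y z →
              solve 6 (λ a b c d e f → a :* (c :+ e) :- b :* (d :+ f)
                                    := (a :* c :- b :* d) :+ (a :* e :- b :* f)) refl
                (Re x) (Im x) (Re y) (Im y) (Re z) (Im z) ,
              solve 6 (λ a b c d e f → a :* (d :+ f) :+ b :* (c :+ e)
                                    := (a :* d :+ b :* c) :+ (a :* f :+ b :* e)) refl
                (Re x) (Im x) (Re y) (Im y) (Re z) (Im z)) ,
            (λ x y z →
              solve 6 (λ a b c d e f → (c :+ e) :* a :- (d :+ f) :* b
                                    := (c :* a :- d :* b) :+ (e :* a :- f :* b)) refl
                (Re x) (Im x) (Re y) (Im y) (Re z) (Im z) ,
              solve 6 (λ a b c d e f → (c :+ e) :* b :+ (d :+ f) :* a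
                                    := (c :* b :+ d :* a) :+ (e :* b :+ f :* a)) refl
                (Re x) (Im x) (Re y) (Im y) (Re z) (Im z))
        }
      ; *-comm = λ x y →
          solve 4 (λ a b c d → a :* c :- b :* d := c :* a :- d :* b) refl (Re x) (Im x) (Re y) (Im y) ,
          solve 4 (λ a b c d → a :* d :+ b :* c := c :* b :+ d :* a) refl (Re x) (Im x) (Re y) (Im y)
      }
    }

  open CommutativeRing ℂ-commutativeRing public using () renaming
    ( refl to reflᶜ; reflexive to reflexiveᶜ; sym to symᶜ; trans to transᶜ; setoid to ℂ-setoid
    ; +-cong to +ᶜ-cong; +-identityˡ to +ᶜ-identityˡ; *-cong to *ᶜ-cong; -‿cong to -ᶜ-cong; zeroˡ to zeroˡᶜ; zeroʳ to zeroʳᶜ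
    ; *-assoc to *ᶜ-assoc; *-comm to *ᶜ-comm; *-identityʳ to *ᶜ-identityʳ; *-identityˡ to *ᶜ-identityˡ)

  -- Free of `√_`, hence accessible to the ring solver; determinants are measured in this form
  -- throughout.
  ∣_∣² : ℂ → Carrier
  ∣ z ∣² = Re z * Re z + Im z * Im z

  ∣∣²-cong : ∀ {z z′} → z ≈ᶜ z′ → ∣ z ∣² ≈ ∣ z′ ∣²
  ∣∣²-cong (p , q) = +-cong (*-cong p p) (*-cong q q)

  ∣∣²-nonNeg : ∀ z → 0# ≤ ∣ z ∣²
  ∣∣²-nonNeg z = +-nonNeg (square-nonNeg _) (square-nonNeg _)

  ∣∣²-* : ∀ z z′ → ∣ z *ᶜ z′ ∣² ≈ ∣ z ∣² * ∣ z′ ∣²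
  ∣∣²-* z z′ = solve 4 (λ a b c d →
    (a :* c :- b :* d) :* (a :* c :- b :* d) :+ (a :* d :+ b :* c) :* (a :* d :+ b :* c)
    := (a :* a :+ b :* b) :* (c :* c :+ d :* d)) refl (Re z) (Im z) (Re z′) (Im z′)

  ∣∣²-neg : ∀ z → ∣ -ᶜ z ∣² ≈ ∣ z ∣²
  ∣∣²-neg z = solve 2 (λ a b → (:- a) :* (:- a) :+ (:- b) :* (:- b) := a :* a :+ b :* b) refl (Re z) (Im z)

  ∣∣²-conj : ∀ z → ∣ conj z ∣² ≈ ∣ z ∣²
  ∣∣²-conj z = solve 2 (λ a b → a :* a :+ (:- b) :* (:- b) := a :* a :+ b :* b) refl (Re z) (Im z)

  -- For the two orientation products of a cycle the cross term becomes ± 2 Re(wt(C)); this is how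
  -- the real part enters α.
  ∣∣²-+ : ∀ z z′ → ∣ z +ᶜ z′ ∣² ≈ ∣ z ∣² + ∣ z′ ∣² + 2# * Re (z *ᶜ conj z′)
  ∣∣²-+ z z′ = solve 4 (λ a b c d →
    (a :+ c) :* (a :+ c) :+ (b :+ d) :* (b :+ d)
    := ((a :* a :+ b :* b) :+ (c :* c :+ d :* d)) :+ (:1 :+ :1) :* (a :* c :- b :* (:- d))) refl
    (Re z) (Im z) (Re z′) (Im z′)

  ∣1∣²≈1 : ∣ 1ᶜ ∣² ≈ 1#
  ∣1∣²≈1 = solve 0 (:1 :* :1 :+ :0 :* :0 := :1) refl

  ∣0∣²≈0 : ∣ 0ᶜ ∣² ≈ 0#
  ∣0∣²≈0 = solve 0 (:0 :* :0 :+ :0 :* :0 := :0) refl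

  ∣∣²≈0⇒≈0 : ∀ {z} → ∣ z ∣² ≈ 0# → z ≈ᶜ 0ᶜ
  ∣∣²≈0⇒≈0 e = square≈0 (nonNeg-sum≈0 (square-nonNeg _) (square-nonNeg _) e) ,
               square≈0 (nonNeg-sum≈0ʳ (square-nonNeg _) (square-nonNeg _) e)

  ≈0⇒∣∣²≈0 : ∀ {z} → z ≈ᶜ 0ᶜ → ∣ z ∣² ≈ 0#
  ≈0⇒∣∣²≈0 e = trans (∣∣²-cong e) ∣0∣²≈0

  -- Multiplicativity of `∣_∣²` reduces this to the real field, so no inverse in ℂ has to be
  -- constructed.
  integralᶜ : ∀ {z z′} → z *ᶜ z′ ≈ᶜ 0ᶜ → z ≈ᶜ 0ᶜ ⊎ z′ ≈ᶜ 0ᶜ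
  integralᶜ {z} {z′} e =
    [ inj₁ ∘ ∣∣²≈0⇒≈0 , inj₂ ∘ ∣∣²≈0⇒≈0 ]′ (integral (trans (sym (∣∣²-* z z′)) (≈0⇒∣∣²≈0 e)))

  ∣∣-nonNeg : ∀ z → 0# ≤ ∣ z ∣
  ∣∣-nonNeg z = √-nonNeg _ (∣∣²-nonNeg z)

  ∣∣*∣∣ : ∀ z → ∣ z ∣ * ∣ z ∣ ≈ ∣ z ∣²
  ∣∣*∣∣ z = √-square _ (∣∣²-nonNeg z)

  ∣∣-unique : ∀ {z x} → 0# ≤ x → x * x ≈ ∣ z ∣² → ∣ z ∣ ≈ x
  ∣∣-unique {z} p e = √-unique (∣∣²-nonNeg z) p e

  ∣∣-* : ∀ z z′ → ∣ z *ᶜ z′ ∣ ≈ ∣ z ∣ * ∣ z′ ∣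
  ∣∣-* z z′ = ∣∣-unique (*-nonNeg (∣∣-nonNeg z) (∣∣-nonNeg z′)) (begin
    (∣ z ∣ * ∣ z′ ∣) * (∣ z ∣ * ∣ z′ ∣)  ≈⟨ solve 2 (λ a b → (a :* b) :* (a :* b) := (a :* a) :* (b :* b)) refl ∣ z ∣ ∣ z′ ∣ ⟩
    (∣ z ∣ * ∣ z ∣) * (∣ z′ ∣ * ∣ z′ ∣)  ≈⟨ *-cong (∣∣*∣∣ z) (∣∣*∣∣ z′) ⟩
    ∣ z ∣² * ∣ z′ ∣²                     ≈⟨ ∣∣²-* z z′ ⟨
    ∣ z *ᶜ z′ ∣²                         ∎)

  ∣1∣≈1 : ∣ 1ᶜ ∣ ≈ 1#
  ∣1∣≈1 = ∣∣-unique 0≤1 (trans (*-identityˡ 1#) (sym ∣1∣²≈1))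

  ∣∣-conj : ∀ z → ∣ conj z ∣ ≈ ∣ z ∣
  ∣∣-conj z = √-cong (∣∣²-nonNeg (conj z)) (∣∣²-conj z)

  ∣∣≉0 : ∀ {z} → ¬ (z ≈ᶜ 0ᶜ) → ∣ z ∣ ≉ 0#
  ∣∣≉0 {z} z≉0 e = z≉0 (∣∣²≈0⇒≈0 (trans (sym (∣∣*∣∣ z)) (trans (*-congʳ e) (zeroˡ _))))

  conj-* : ∀ z z′ → conj (z *ᶜ z′) ≈ᶜ conj z *ᶜ conj z′
  conj-* z z′ =
    solve 4 (λ a b c d → a :* c :- b :* d := a :* c :- (:- b) :* (:- d)) refl (Re z) (Im z) (Re z′) (Im z′) ,
    solve 4 (λ a b c d → :- (a :* d :+ b :* c) := a :* (:- d) :+ (:- b) :* c) refl (Re z) (Im z) (Re z′) (Im z′)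

  conj-cong : ∀ {z z′} → z ≈ᶜ z′ → conj z ≈ᶜ conj z′
  conj-cong (p , q) = p , -‿cong q

  conj-conj : ∀ z → conj (conj z) ≈ᶜ z
  conj-conj z = refl , -‿involutive _

  private
    ≤-from-squares : ∀ {x y} → 0# ≤ y → 0# ≤ y * y - x * x → x ≤ y
    ≤-from-squares {x} {y} p q with ≤-total x y
    ... | inj₁ r = r
    ... | inj₂ r = ≤-reflexive (square-injective (≤-trans p r) p (≤-antisym (0≤-⇒≤ q) (0≤-⇒≤
          (≤-resp refl (solve 2 (λ x y → (x :- y) :* (x :+ y) := x :* x :- y :* y) refl x y)
            (*-nonNeg (≤⇒0≤- r) (+-nonNeg (≤-trans p r) p))))))

  Re≤∣∣ : ∀ z → 0# ≤ ∣ z ∣ - Re z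
  Re≤∣∣ z = ≤⇒0≤- (≤-from-squares (∣∣-nonNeg z) (≤-resp refl
    (trans (solve 2 (λ a b → b :* b := (a :* a :+ b :* b) :- a :* a) refl (Re z) (Im z))
           (+-congʳ (sym (∣∣*∣∣ z)))) (square-nonNeg (Im z))))

  -Re≤∣∣ : ∀ z → 0# ≤ ∣ z ∣ + Re z
  -Re≤∣∣ z = ≤-resp refl (trans (+-congʳ (∣∣-cong′)) (+-congˡ (-‿involutive _))) (Re≤∣∣ (-ᶜ z))
    where
    ∣∣-cong′ : ∣ -ᶜ z ∣ ≈ ∣ z ∣
    ∣∣-cong′ = √-cong (∣∣²-nonNeg (-ᶜ z)) (∣∣²-neg z)

  -- The half-angle formulas: 2u² = |z| + Re z and 2v² = |z| - Re z give u² + v² = |z|, u² - v² = Re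
  -- z and (2uv)² = (Im z)². The branch in `√ᶜ_` then matches the sign of Im z.
  module PrincipalRoot (z : ℂ) where
    u v : Carrier
    u = √ ((∣ z ∣ + Re z) * 2# ⁻¹)
    v = √ ((∣ z ∣ - Re z) * 2# ⁻¹)

    u≥0 : 0# ≤ u
    u≥0 = √-nonNeg _ (half-nonNeg (-Re≤∣∣ z))

    v≥0 : 0# ≤ v
    v≥0 = √-nonNeg _ (half-nonNeg (Re≤∣∣ z))

    2u² : 2# * (u * u) ≈ ∣ z ∣ + Re z
    2u² = trans (*-congˡ (√-square _ (half-nonNeg (-Re≤∣∣ z)))) half

    2v² : 2# * (v * v) ≈ ∣ z ∣ - Re z
    2v² = trans (*-congˡ (√-square _ (half-nonNeg (Re≤∣∣ z)))) half

    u²+v² : u * u + v * v ≈ ∣ z ∣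
    u²+v² = *-cancelˡ-nonZero 2≉0 (begin
      2# * (u * u + v * v)             ≈⟨ distribˡ 2# _ _ ⟩
      2# * (u * u) + 2# * (v * v)      ≈⟨ +-cong 2u² 2v² ⟩
      (∣ z ∣ + Re z) + (∣ z ∣ - Re z)  ≈⟨ solve 2 (λ m x → (m :+ x) :+ (m :- x) := (:1 :+ :1) :* m) refl ∣ z ∣ (Re z) ⟩
      2# * ∣ z ∣                       ∎)

    u²-v² : u * u - v * v ≈ Re z
    u²-v² = *-cancelˡ-nonZero 2≉0 (begin
      2# * (u * u - v * v)             ≈⟨ solve 3 (λ t p q → t :* (p :- q) := t :* p :- t :* q) refl 2# (u * u) (v * v) ⟩
      2# * (u * u) - 2# * (v * v)      ≈⟨ +-cong 2u² (-‿cong 2v²) ⟩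
      (∣ z ∣ + Re z) - (∣ z ∣ - Re z)  ≈⟨ solve 2 (λ m x → (m :+ x) :- (m :- x) := (:1 :+ :1) :* x) refl ∣ z ∣ (Re z) ⟩
      2# * Re z                        ∎)

    [2uv]² : (2# * (u * v)) * (2# * (u * v)) ≈ Im z * Im z
    [2uv]² = begin
      (2# * (u * v)) * (2# * (u * v))    ≈⟨ solve 3 (λ t u v → (t :* (u :* v)) :* (t :* (u :* v)) := (t :* (u :* u)) :* (t :* (v :* v))) refl 2# u v ⟩
      (2# * (u * u)) * (2# * (v * v))    ≈⟨ *-cong 2u² 2v² ⟩
      (∣ z ∣ + Re z) * (∣ z ∣ - Re z)    ≈⟨ solve 2 (λ m x → (m :+ x) :* (m :- x) := m :* m :- x :* x) refl ∣ z ∣ (Re z) ⟩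
      ∣ z ∣ * ∣ z ∣ - Re z * Re z        ≈⟨ +-congʳ (∣∣*∣∣ z) ⟩
      ∣ z ∣² - Re z * Re z               ≈⟨ solve 2 (λ a b → (a :* a :+ b :* b) :- a :* a := b :* b) refl (Re z) (Im z) ⟩
      Im z * Im z                        ∎

    2uv≥0 : 0# ≤ 2# * (u * v)
    2uv≥0 = *-nonNeg 0≤2 (*-nonNeg u≥0 v≥0)

    ∣√ᶜ∣² : ∣ √ᶜ z ∣² ≈ ∣ z ∣
    ∣√ᶜ∣² with 0# ≤? Im z
    ... | yes _ = u²+v²
    ... | no  _ = trans (solve 2 (λ u v → u :* u :+ (:- v) :* (:- v) := u :* u :+ v :* v) refl u v) u²+v²

    √ᶜ-square : √ᶜ z *ᶜ √ᶜ z ≈ᶜ z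
    √ᶜ-square with 0# ≤? Im z
    ... | yes p = u²-v² , trans (solve 2 (λ u v → u :* v :+ v :* u := (:1 :+ :1) :* (u :* v)) refl u v)
                            (square-injective 2uv≥0 p [2uv]²)
    ... | no ¬p =
      trans (solve 2 (λ u v → u :* u :- (:- v) :* (:- v) := u :* u :- v :* v) refl u v) u²-v² ,
      (begin
        u * (- v) + (- v) * u  ≈⟨ solve 2 (λ u v → u :* (:- v) :+ (:- v) :* u := :- ((:1 :+ :1) :* (u :* v))) refl u v ⟩
        - (2# * (u * v))       ≈⟨ -‿cong (square-injective 2uv≥0 (≤0⇒0≤- ([ (λ p → contradiction p ¬p) , id ]′ (≤-total 0# (Im z))))
                                    (trans [2uv]² (solve 1 (λ y → y :* y := (:- y) :* (:- y)) refl (Im z)))) ⟩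
        - - Im z               ≈⟨ -‿involutive _ ⟩
        Im z                   ∎)

    -- A real z outside ℝ⁻ has Re z ≥ 0, hence |z| = Re z.
    Im≈0⇒v≈0 : ¬ ℝ⁻ z → Im z ≈ 0# → v ≈ 0#
    Im≈0⇒v≈0 ¬neg y≈0 = square≈0 ([ (λ e → contradiction e 2≉0) , id ]′ (integral (trans 2v² ∣z∣-x≈0)))
      where
      x≥0 : 0# ≤ Re z
      x≥0 with ≤-total 0# (Re z)
      ... | inj₁ p = p
      ... | inj₂ p with O._≟_ (Re z) 0#
      ...   | yes e = ≤-reflexive (sym e)
      ...   | no ¬e = contradiction ((p , ¬e) , y≈0) ¬neg
      ∣z∣-x≈0 : ∣ z ∣ - Re z ≈ 0#
      ∣z∣-x≈0 = trans (+-congʳ (∣∣-unique x≥0 (begin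
        Re z * Re z                 ≈⟨ solve 1 (λ a → a :* a := a :* a :+ :0 :* :0) refl (Re z) ⟩
        Re z * Re z + 0# * 0#       ≈⟨ +-congˡ (*-cong y≈0 y≈0) ⟨
        ∣ z ∣²                      ∎))) (-‿inverseʳ _)

  -- Conjugation switches the branch of `√ᶜ_`, unless both Im z and - Im z pass the sign test; then
  -- z is real and v = 0. For z = -1 the two sides would be i and -i.
  √ᶜ-conj : ∀ z → ¬ ℝ⁻ z → √ᶜ (conj z) ≈ᶜ conj (√ᶜ z)
  √ᶜ-conj z ¬neg = √-cong (half-nonNeg (-Re≤∣∣ (conj z))) (*-congʳ (+-congʳ (∣∣-conj z))) , im
    where
    open PrincipalRoot z using (v; Im≈0⇒v≈0)
    v′ = √ ((∣ conj z ∣ - Re z) * 2# ⁻¹)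
    v′≈v : v′ ≈ v
    v′≈v = √-cong (half-nonNeg (Re≤∣∣ (conj z))) (*-congʳ (+-congʳ (∣∣-conj z)))
    im : Im (√ᶜ (conj z)) ≈ - Im (√ᶜ z)
    im with 0# ≤? (- Im z) | 0# ≤? Im z
    ... | yes p | yes q = trans v′≈v (trans v≈0 (trans (sym -0#≈0#) (-‿cong (sym v≈0))))
      where
      v≈0 : v ≈ 0#
      v≈0 = Im≈0⇒v≈0 ¬neg (nonNeg-sum≈0 q p (-‿inverseʳ _))
    ... | yes p | no ¬q = trans v′≈v (sym (-‿involutive v))
    ... | no ¬p | yes q = -‿cong v′≈v
    ... | no ¬p | no ¬q = [ (λ q → contradiction q ¬q) , (λ p → contradiction (≤0⇒0≤- p) ¬p) ]′ (≤-total 0# (Im z))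

-- Determinants as functions of lists of rows and columns

module Laplace {a ℓ} (R : CommutativeRing a ℓ) where
  open CommutativeRing R hiding (zero)
  open IntegerSolver R
  open RingProperties ring using (-0#≈0#; -‿involutive)
  open import Relation.Binary.Reasoning.Setoid setoid

  module _ {x} {X : Set x} where

    -- Expansion along a row f with the minors abstracted to `F`, which receives the columns left
    -- after one is deleted. Columns passed over are put back in front by `F ∘ (x ∷_)`, and the
    -- nested subtraction alternates the signs.
    laplace : (X → Carrier) → (List X → Carrier) → List X → Carrier
    laplace f F []       = 0#
    laplace f F (x ∷ xs) = f x * F xs - laplace f (F ∘ (x ∷_)) xs

    laplace-cong-All : ∀ {p} {P : X → Set p} f {F G : List X → Carrier} {xs} →
      (∀ {ys} → All P ys → F ys ≈ G ys) → All P xs → laplace f F xs ≈ laplace f G xs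
    laplace-cong-All f eq []         = refl
    laplace-cong-All f eq (px ∷ pxs) =
      +-cong (*-congˡ (eq pxs)) (-‿cong (laplace-cong-All f (λ pys → eq (px ∷ pys)) pxs))

    laplace-cong : ∀ f {F G : List X → Carrier} → (∀ xs → F xs ≈ G xs) → ∀ xs → laplace f F xs ≈ laplace f G xs
    laplace-cong f eq []       = refl
    laplace-cong f eq (x ∷ xs) = +-cong (*-congˡ (eq xs)) (-‿cong (laplace-cong f (eq ∘ (x ∷_)) xs))

    -- The shape c F - G is what unfolding an inner `laplace` produces, as in `laplace-swap`.
    -- Negation and scaling from the right are special cases.
    laplace-linear : ∀ f c F G xs → laplace f (λ ys → c * F ys - G ys) xs ≈ c * laplace f F xs - laplace f G xs
    laplace-linear f c F G []       = solve 1 (λ c → :0 := c :* :0 :- :0) refl c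
    laplace-linear f c F G (x ∷ xs) = begin
      f x * (c * F xs - G xs) - laplace f (λ ys → c * F (x ∷ ys) - G (x ∷ ys)) xs
        ≈⟨ +-congˡ (-‿cong (laplace-linear f c (F ∘ (x ∷_)) (G ∘ (x ∷_)) xs)) ⟩
      f x * (c * F xs - G xs) - (c * laplace f (F ∘ (x ∷_)) xs - laplace f (G ∘ (x ∷_)) xs)
        ≈⟨ solve 6 (λ a c F G K L → a :* (c :* F :- G) :- (c :* K :- L) := c :* (a :* F :- K) :- (a :* G :- L))
             refl (f x) c (F xs) (G xs) _ _ ⟩
      c * laplace f F (x ∷ xs) - laplace f G (x ∷ xs)  ∎

    laplace-zero : ∀ f {F : List X → Carrier} xs → (∀ ys → suc (length ys) ≡ length xs → F ys ≈ 0#) → laplace f F xs ≈ 0#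
    laplace-zero f []       eq = refl
    laplace-zero f {F} (x ∷ xs) eq = begin
      f x * F xs - laplace f (F ∘ (x ∷_)) xs  ≈⟨ +-cong (*-congˡ (eq xs ≡.refl)) (-‿cong (laplace-zero f xs (λ ys e → eq (x ∷ ys) (≡.cong suc e)))) ⟩
      f x * 0# - 0#                           ≈⟨ solve 1 (λ a → a :* :0 :- :0 := :0) refl (f x) ⟩
      0#                                      ∎

    laplace-neg : ∀ f F xs → laplace f (λ ys → - F ys) xs ≈ - laplace f F xs
    laplace-neg f F xs = begin
      laplace f (λ ys → - F ys) xs             ≈⟨ laplace-cong f (λ ys → solve 1 (λ a → :- a := :0 :* a :- a) refl (F ys)) xs ⟩
      laplace f (λ ys → 0# * F ys - F ys) xs   ≈⟨ laplace-linear f 0# F F xs ⟩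
      0# * laplace f F xs - laplace f F xs     ≈⟨ solve 1 (λ a → :0 :* a :- a := :- a) refl _ ⟩
      - laplace f F xs                         ∎

    laplace-*ʳ : ∀ f F c xs → laplace f (λ ys → F ys * c) xs ≈ laplace f F xs * c
    laplace-*ʳ f F c xs = begin
      laplace f (λ ys → F ys * c) xs             ≈⟨ laplace-cong f (λ ys → solve 2 (λ a c → a :* c := c :* a :- :0) refl (F ys) c) xs ⟩
      laplace f (λ ys → c * F ys - 0#) xs        ≈⟨ laplace-linear f c F (λ _ → 0#) xs ⟩
      c * laplace f F xs - laplace f (λ _ → 0#) xs  ≈⟨ +-congˡ (-‿cong (laplace-zero f xs (λ _ _ → refl))) ⟩
      c * laplace f F xs - 0#                    ≈⟨ solve 2 (λ a c → c :* a :- :0 := a :* c) refl _ c ⟩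
      laplace f F xs * c                         ∎

    -- Antisymmetry in two adjacent rows. The induction on columns succeeds for arbitrary `F`, since
    -- each unfolding merely replaces `F` by `F ∘ (x ∷_)`.
    laplace-swap : ∀ f g F xs → laplace f (laplace g F) xs ≈ - laplace g (laplace f F) xs
    laplace-swap f g F []       = sym -0#≈0#
    laplace-swap f g F (x ∷ xs) = begin
      f x * laplace g F xs - laplace f (λ ys → g x * F ys - laplace g (F ∘ (x ∷_)) ys) xs
        ≈⟨ +-congˡ (-‿cong (trans (laplace-linear f (g x) F (laplace g (F ∘ (x ∷_))) xs)
             (+-congˡ (-‿cong (laplace-swap f g (F ∘ (x ∷_)) xs))))) ⟩
      f x * laplace g F xs - (g x * laplace f F xs - - laplace g (laplace f (F ∘ (x ∷_))) xs)
        ≈⟨ solve 5 (λ a b F G K → a :* G :- (b :* F :- (:- K)) := :- (b :* F :- (a :* G :- K))) refl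
             (f x) (g x) (laplace f F xs) (laplace g F xs) _ ⟩
      - (g x * laplace f F xs - (f x * laplace g F xs - laplace g (laplace f (F ∘ (x ∷_))) xs))
        ≈⟨ -‿cong (+-congˡ (-‿cong (laplace-linear g (f x) F (laplace f (F ∘ (x ∷_))) xs))) ⟨
      - (g x * laplace f F xs - laplace g (λ ys → f x * F ys - laplace f (F ∘ (x ∷_)) ys) xs)  ∎

    laplace-vanish : ∀ {f} F {xs} → All (λ x → f x ≈ 0#) xs → laplace f F xs ≈ 0#
    laplace-vanish F []           = refl
    laplace-vanish F (fx≈0 ∷ fxs) = trans
      (+-cong (trans (*-congʳ fx≈0) (zeroˡ _)) (trans (-‿cong (laplace-vanish _ fxs)) -0#≈0#)) (+-identityˡ 0#)

    laplace-head : ∀ {f} F {x xs} → All (λ x → f x ≈ 0#) xs → laplace f F (x ∷ xs) ≈ f x * F xs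
    laplace-head F fxs = trans (+-congˡ (trans (-‿cong (laplace-vanish _ fxs)) -0#≈0#)) (+-identityʳ _)

    laplace-++ : ∀ {f} F xs {ys} → All (λ x → f x ≈ 0#) ys → laplace f F (xs ++ ys) ≈ laplace f (λ zs → F (zs ++ ys)) xs
    laplace-++ F []       fys = laplace-vanish F fys
    laplace-++ F (x ∷ xs) fys = +-congˡ (-‿cong (laplace-++ (F ∘ (x ∷_)) xs fys))

    Alternating : (List X → Carrier) → Set _
    Alternating F = ∀ xs x y ys → F (xs ++ x ∷ y ∷ ys) ≈ - F (xs ++ y ∷ x ∷ ys)

    laplace-alternating : ∀ f {F} → Alternating F → Alternating (laplace f F)
    laplace-alternating f {F} alt [] x y ys = begin
      f x * F (y ∷ ys) - (f y * F (x ∷ ys) - laplace f (λ zs → F (x ∷ y ∷ zs)) ys)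
        ≈⟨ +-congˡ (-‿cong (+-congˡ (-‿cong (trans (laplace-cong f (alt [] x y) ys) (laplace-neg f _ ys))))) ⟩
      f x * F (y ∷ ys) - (f y * F (x ∷ ys) - - laplace f (λ zs → F (y ∷ x ∷ zs)) ys)
        ≈⟨ solve 3 (λ a b c → a :- (b :- (:- c)) := :- (b :- (a :- c))) refl _ _ _ ⟩
      - (f y * F (x ∷ ys) - (f x * F (y ∷ ys) - laplace f (λ zs → F (y ∷ x ∷ zs)) ys))  ∎
    laplace-alternating f {F} alt (z ∷ xs) x y ys = begin
      f z * F (xs ++ x ∷ y ∷ ys) - laplace f (F ∘ (z ∷_)) (xs ++ x ∷ y ∷ ys)
        ≈⟨ +-cong (*-congˡ (alt xs x y ys)) (-‿cong (laplace-alternating f (λ xs → alt (z ∷ xs)) xs x y ys)) ⟩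
      f z * (- F (xs ++ y ∷ x ∷ ys)) - - laplace f (F ∘ (z ∷_)) (xs ++ y ∷ x ∷ ys)
        ≈⟨ solve 3 (λ a b c → a :* (:- b) :- (:- c) := :- (a :* b :- c)) refl (f z) _ _ ⟩
      - (f z * F (xs ++ y ∷ x ∷ ys) - laplace f (F ∘ (z ∷_)) (xs ++ y ∷ x ∷ ys))  ∎

  infix 4 _≈±_
  -- Equality up to sign suffices for every reordering, because the sign disappears in the squared
  -- modulus.
  _≈±_ : Carrier → Carrier → Set ℓ
  x ≈± y = x ≈ y ⊎ x ≈ - y

  ≈±-trans : ∀ {x y z} → x ≈± y → y ≈± z → x ≈± z
  ≈±-trans (inj₁ p) (inj₁ q) = inj₁ (trans p q)
  ≈±-trans (inj₁ p) (inj₂ q) = inj₂ (trans p q)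
  ≈±-trans (inj₂ p) (inj₁ q) = inj₂ (trans p (-‿cong q))
  ≈±-trans (inj₂ p) (inj₂ q) = inj₁ (trans p (trans (-‿cong q) (-‿involutive _)))

  alternating-↭ : ∀ {x} {X : Set x} {F : List X → Carrier} → Alternating F → ∀ {xs ys} → xs ↭ ys → F xs ≈± F ys
  alternating-↭ alt ↭.refl       = inj₁ refl
  alternating-↭ alt (prep x p)   = alternating-↭ (λ xs → alt (x ∷ xs)) p
  alternating-↭ alt (swap x y p) = ≈±-trans (inj₂ (alt [] x y _)) (alternating-↭ (λ xs → alt (y ∷ x ∷ xs)) p)
  alternating-↭ alt (↭.trans p q) = ≈±-trans (alternating-↭ alt p) (alternating-↭ alt q)

  open MatrixOver rawRing using (alternating; det)
  open RawMonoidOps (RawRing.+-rawMonoid rawRing) using (sum)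

  sum-cong : ∀ {n} {f g : Fin n → Carrier} → (∀ i → f i ≈ g i) → sum f ≈ sum g
  sum-cong {zero}  eq = refl
  sum-cong {suc n} eq = +-cong (eq zero) (sum-cong (eq ∘ suc))

  sum-neg : ∀ {n} (f : Fin n → Carrier) → sum (λ i → - f i) ≈ - sum f
  sum-neg {zero}  f = sym -0#≈0#
  sum-neg {suc n} f = trans (+-congˡ (sum-neg (f ∘ suc)))
    (solve 2 (λ a b → (:- a) :+ (:- b) := :- (a :+ b)) refl (f zero) (sum (f ∘ suc)))

  sum-zero : ∀ {k} {f : Fin k → Carrier} → (∀ i → f i ≈ 0#) → sum f ≈ 0#
  sum-zero {zero}  z = refl
  sum-zero {suc k} z = trans (+-cong (z zero) (sum-zero (z ∘ suc))) (solve 0 (:0 :+ :0 := :0) refl)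

  sum-single : ∀ {k} {f : Fin k → Carrier} u → (∀ i → i ≢ u → f i ≈ 0#) → sum f ≈ f u
  sum-single {f = f} zero    z = trans (+-cong refl (sum-zero (λ i → z (suc i) λ ()))) (solve 1 (λ a → a :+ :0 := a) refl (f zero))
  sum-single {f = f} (suc u) z = trans (+-cong (z zero λ ()) (sum-single u (λ i i≢ → z (suc i) (λ { ≡.refl → i≢ ≡.refl }))))
    (solve 1 (λ a → :0 :+ a := a) refl (f (suc u)))

  sum-pair : ∀ {k} {f : Fin k → Carrier} u v → u ≢ v → (∀ i → i ≢ u → i ≢ v → f i ≈ 0#) → sum f ≈ f u + f v
  sum-pair zero    zero    u≢v z = contradiction ≡.refl u≢v
  sum-pair zero    (suc v) u≢v z = +-cong refl (sum-single v (λ i i≢ → z (suc i) (λ ()) (λ { ≡.refl → i≢ ≡.refl })))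
  sum-pair {f = f} (suc u) zero u≢v z = trans (+-cong refl (sum-single u (λ i i≢ → z (suc i) (λ { ≡.refl → i≢ ≡.refl }) (λ ()))))
    (solve 2 (λ a b → a :+ b := b :+ a) refl (f zero) (f (suc u)))
  sum-pair {f = f} (suc u) (suc v) u≢v z = trans
    (+-cong (z zero (λ ()) (λ ())) (sum-pair u v (u≢v ∘ ≡.cong suc) (λ i i≢u i≢v → z (suc i) (λ { ≡.refl → i≢u ≡.refl }) (λ { ≡.refl → i≢v ≡.refl }))))
    (solve 2 (λ a b → :0 :+ (a :+ b) := a :+ b) refl (f (suc u)) (f (suc v)))

  laplace-tabulate : ∀ {x} {X : Set x} f F {r} (xs : Fin (suc r) → X) →
    laplace f F (List.tabulate xs) ≈ sum (alternating λ j → f (xs j) * F (List.tabulate (xs ∘ punchIn j)))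
  laplace-tabulate f F {zero}  xs = +-congˡ -0#≈0#
  laplace-tabulate f F {suc r} xs = +-congˡ (trans
    (-‿cong (laplace-tabulate f (F ∘ (xs zero ∷_)) (xs ∘ suc)))
    (sym (sum-neg (alternating λ j → f (xs (suc j)) * F (xs zero ∷ List.tabulate (xs ∘ suc ∘ punchIn j))))))

  alternating-*ʳ : ∀ {r} (f g : Fin r → Carrier) i → alternating (λ j → f j * g j) i ≈ alternating g i * f i
  alternating-*ʳ f g zero    = *-comm _ _
  alternating-*ʳ f g (suc i) = trans (-‿cong (alternating-*ʳ (f ∘ suc) (g ∘ suc) i))
    (solve 2 (λ a b → :- (a :* b) := (:- a) :* b) refl _ _)

  module ListDet {x y} {V : Set x} {E : Set y} (A : V → E → Carrier) where

    -- Zero unless the two lists have equal length, so that the columns of a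
    -- minor may range over all subsets.
    d : List V → List E → Carrier
    d []      []      = 1#
    d []      (_ ∷ _) = 0#
    d (v ∷ ρ) κ       = laplace (A v) (d ρ) κ

    d-alternating : ∀ ρ → Alternating (d ρ)
    d-alternating []      []      x y ys = sym -0#≈0#
    d-alternating []      (_ ∷ _) x y ys = sym -0#≈0#
    d-alternating (v ∷ ρ) = laplace-alternating (A v) (d-alternating ρ)

    private
      -- The sign is fixed before κ: under `prep` the hypothesis is applied to all minors of one
      -- expansion at once, and these must share a sign.
      d-rows : ∀ {ρ ρ′} → ρ ↭ ρ′ → (∀ κ → d ρ κ ≈ d ρ′ κ) ⊎ (∀ κ → d ρ κ ≈ - d ρ′ κ)
      d-rows ↭.refl       = inj₁ (λ κ → refl)
      d-rows (prep v p)   = Sum.map (laplace-cong (A v)) (λ eq κ → trans (laplace-cong (A v) eq κ) (laplace-neg (A v) _ κ)) (d-rows p)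
      d-rows {_ ∷ _ ∷ ρ} {_ ∷ _ ∷ ρ′} (swap u v p) with d-rows p
      ... | inj₁ eq = inj₂ (λ κ → trans (laplace-swap (A u) (A v) (d ρ) κ)
                        (-‿cong (laplace-cong (A v) (laplace-cong (A u) eq) κ)))
      ... | inj₂ eq = inj₁ (λ κ → trans (laplace-swap (A u) (A v) (d ρ) κ)
                        (trans (-‿cong (trans
                          (laplace-cong (A v) (λ κ → trans (laplace-cong (A u) eq κ) (laplace-neg (A u) (d ρ′) κ)) κ)
                          (laplace-neg (A v) (laplace (A u) (d ρ′)) κ)))
                        (-‿involutive _)))
      d-rows (↭.trans p q) with d-rows p | d-rows q
      ... | inj₁ e | inj₁ f = inj₁ (λ κ → trans (e κ) (f κ))
      ... | inj₁ e | inj₂ f = inj₂ (λ κ → trans (e κ) (f κ))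
      ... | inj₂ e | inj₁ f = inj₂ (λ κ → trans (e κ) (-‿cong (f κ)))
      ... | inj₂ e | inj₂ f = inj₁ (λ κ → trans (e κ) (trans (-‿cong (f κ)) (-‿involutive _)))

    d-↭ : ∀ {ρ ρ′ κ κ′} → ρ ↭ ρ′ → κ ↭ κ′ → d ρ κ ≈± d ρ′ κ′
    d-↭ {ρ′ = ρ′} {κ} p q = ≈±-trans (Sum.map (λ eq → eq κ) (λ eq → eq κ) (d-rows p)) (alternating-↭ (d-alternating ρ′) q)

    d-length : ∀ ρ κ → length ρ ≢ length κ → d ρ κ ≈ 0#
    d-length []      []      ≢ = contradiction ≡.refl ≢
    d-length []      (_ ∷ _) ≢ = refl
    d-length (v ∷ ρ) κ       ≢ = laplace-zero (A v) κ
      (λ ys eq → d-length ρ ys (λ eq′ → ≢ (≡.trans (≡.cong suc eq′) eq)))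

    -- The first two terms of the expansion cancel. Alternation alone would give x = - x, which does
    -- not imply x = 0 in an arbitrary commutative ring.
    d-repeated-column : ∀ ρ e κ → d ρ (e ∷ e ∷ κ) ≈ 0#
    d-repeated-column []      e κ = refl
    d-repeated-column (v ∷ ρ) e κ = trans
      (+-congˡ (-‿cong (+-congˡ (-‿cong (laplace-zero (A v) κ (λ ys _ → d-repeated-column ρ e ys))))))
      (solve 1 (λ a → a :- (a :- :0) := :0) refl _)

    d-zero-column : ∀ {ρ e κ} → All (λ v → A v e ≈ 0#) ρ → d ρ (e ∷ κ) ≈ 0#
    d-zero-column []           = refl
    d-zero-column {v ∷ ρ} {e} {κ} (Ave ∷ Aρe) = trans
      (+-cong (trans (*-congʳ Ave) (zeroˡ _))
              (trans (-‿cong (laplace-zero (A v) κ (λ ys _ → d-zero-column Aρe))) -0#≈0#))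
      (+-identityˡ 0#)

    d-leaf-row : ∀ {v ρ e κ} → All (λ e → A v e ≈ 0#) κ → d (v ∷ ρ) (e ∷ κ) ≈ A v e * d ρ κ
    d-leaf-row {ρ = ρ} Avκ = laplace-head (d ρ) Avκ

    d-leaf-column : ∀ {v ρ e κ} → All (λ v → A v e ≈ 0#) ρ → d (v ∷ ρ) (e ∷ κ) ≈ A v e * d ρ κ
    d-leaf-column {v} {κ = κ} Aρe = trans
      (+-congˡ (trans (-‿cong (laplace-zero (A v) κ (λ ys _ → d-zero-column Aρe))) -0#≈0#)) (+-identityʳ _)

    -- The blocks may be of any shape. Each expansion removes a row of ρ₁ and a column of κ₁; a
    -- column of κ₁ left over when the rows run out is zero on ρ₂, and both sides are then 0.
    d-block : ∀ {ρ₁ ρ₂ κ₁ κ₂} → All (λ v → All (λ e → A v e ≈ 0#) κ₂) ρ₁ → All (λ e → All (λ v → A v e ≈ 0#) ρ₂) κ₁ →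
      d (ρ₁ ++ ρ₂) (κ₁ ++ κ₂) ≈ d ρ₁ κ₁ * d ρ₂ κ₂
    d-block {[]}     {κ₁ = []}    p       q       = sym (*-identityˡ _)
    d-block {[]}     {κ₁ = _ ∷ _} p       (q ∷ _) = trans (d-zero-column q) (sym (zeroˡ _))
    d-block {v ∷ ρ₁} {ρ₂} {κ₁} {κ₂} (p ∷ ps) q = begin
      laplace (A v) (d (ρ₁ ++ ρ₂)) (κ₁ ++ κ₂)              ≈⟨ laplace-++ _ κ₁ p ⟩
      laplace (A v) (λ κ → d (ρ₁ ++ ρ₂) (κ ++ κ₂)) κ₁      ≈⟨ laplace-cong-All (A v) (d-block ps) q ⟩
      laplace (A v) (λ κ → d ρ₁ κ * d ρ₂ κ₂) κ₁            ≈⟨ laplace-*ʳ (A v) (d ρ₁) (d ρ₂ κ₂) κ₁ ⟩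
      laplace (A v) (d ρ₁) κ₁ * d ρ₂ κ₂                    ∎

    -- Column expansion from row expansion, by interchanging the expansion along the row v with the
    -- one along the column e. `commute` is stated for arbitrary `H` because its induction on ρ
    -- replaces `H` by `H ∘ (u ∷_)`.
    d-first-column : ∀ ρ e κ → d ρ (e ∷ κ) ≈ laplace (λ v → A v e) (λ ρ → d ρ κ) ρ
    d-first-column []      e κ = refl
    d-first-column (v ∷ ρ) e κ = +-congˡ (-‿cong (trans
      (laplace-cong (A v) (d-first-column ρ e) κ) (commute ρ d)))
      where
      commute : ∀ ρ (H : List V → List E → Carrier) →
        laplace (A v) (λ κ → laplace (λ v → A v e) (λ ρ → H ρ κ) ρ) κ ≈
        laplace (λ v → A v e) (λ ρ → laplace (A v) (H ρ) κ) ρ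
      commute []      H = laplace-zero (A v) κ (λ _ _ → refl)
      commute (u ∷ ρ) H = trans (laplace-linear (A v) (A u e) (H ρ) _ κ) (+-congˡ (-‿cong (commute ρ (H ∘ (u ∷_)))))

    det≈d : ∀ {r} (ρ : Fin r → V) (κ : Fin r → E) → det (λ i k → A (ρ i) (κ k)) ≈ d (List.tabulate ρ) (List.tabulate κ)
    det≈d {zero}  ρ κ = refl
    det≈d {suc r} ρ κ = trans
      (sum-cong (alternating-cong (λ j → *-congˡ {A (ρ zero) (κ j)} (det≈d (ρ ∘ suc) (κ ∘ punchIn j)))))
      (sym (laplace-tabulate (A (ρ zero)) (d (List.tabulate (ρ ∘ suc))) κ))
      where
      alternating-cong : ∀ {r} {f g : Fin r → Carrier} → (∀ j → f j ≈ g j) → ∀ j → alternating f j ≈ alternating g j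
      alternating-cong eq zero    = eq zero
      alternating-cong eq (suc j) = -‿cong (alternating-cong (eq ∘ suc) j)

    -- If every `d` on the right is 0, the alternating cofactors on the left form a linear relation
    -- between the rows ρ.
    cofactors-column : ∀ {r} (ρ : Fin (suc r) → V) e κ →
      sum (λ i → alternating (λ j → d (List.tabulate (ρ ∘ punchIn j)) κ) i * A (ρ i) e) ≈ d (List.tabulate ρ) (e ∷ κ)
    cofactors-column ρ e κ = begin
      sum (λ i → alternating minors i * A (ρ i) e)                     ≈⟨ sum-cong (λ i → alternating-*ʳ (λ i → A (ρ i) e) minors i) ⟨
      sum (alternating λ j → A (ρ j) e * minors j)                     ≈⟨ laplace-tabulate (λ v → A v e) (λ ρ → d ρ κ) ρ ⟨
      laplace (λ v → A v e) (λ ρ → d ρ κ) (List.tabulate ρ)            ≈⟨ d-first-column (List.tabulate ρ) e κ ⟨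
      d (List.tabulate ρ) (e ∷ κ)                                      ∎
      where
      minors : Fin _ → Carrier
      minors j = d (List.tabulate (ρ ∘ punchIn j)) κ

-- Duplicate-free lists, permutations and finite subsets

module _ {a} {A : Set a} where

  Unique-resp-↭ : ∀ {xs ys : List A} → xs ↭ ys → Unique xs → Unique ys
  Unique-resp-↭ ↭.refl        u                         = u
  Unique-resp-↭ (prep x p)    (x∉ ∷ u)                  = All-resp-↭ p x∉ ∷ Unique-resp-↭ p u
  Unique-resp-↭ (swap x y p)  ((x≢y ∷ x∉) ∷ y∉ ∷ u)     =
    ((x≢y ∘ ≡.sym) ∷ All-resp-↭ p y∉) ∷ All-resp-↭ p x∉ ∷ Unique-resp-↭ p u
  Unique-resp-↭ (↭.trans p q) u                         = Unique-resp-↭ q (Unique-resp-↭ p u)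

  ∉⇒All≢ : ∀ {x : A} {xs} → x ∉ xs → All (x ≢_) xs
  ∉⇒All≢ x∉xs = All.tabulate (λ y∈xs x≡y → x∉xs (≡.subst (_∈ _) (≡.sym x≡y) y∈xs))

  Unique-head∉ : ∀ {x : A} {xs} → Unique (x ∷ xs) → x ∉ xs
  Unique-head∉ (x≢ ∷ _) x∈xs = All.lookup x≢ x∈xs ≡.refl

  Unique-++ʳ : ∀ xs {ys : List A} → Unique (xs ++ ys) → Unique ys
  Unique-++ʳ []       u       = u
  Unique-++ʳ (x ∷ xs) (_ ∷ u) = Unique-++ʳ xs u

  Unique-++-disjoint : ∀ xs {ys : List A} {x} → Unique (xs ++ ys) → x ∈ xs → x ∉ ys
  Unique-++-disjoint (x ∷ xs) u       (here ≡.refl) x∈ys = Unique-head∉ u (∈-++⁺ʳ xs x∈ys)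
  Unique-++-disjoint (x ∷ xs) (_ ∷ u) (there x∈)  x∈ys = Unique-++-disjoint xs u x∈ x∈ys

  -- The complement is returned as a witness; applied to edges it becomes the list of surplus edges.
  ⊆⇒complement : ∀ {xs ys : List A} → Unique xs → (∀ {x} → x ∈ xs → x ∈ ys) → ∃ λ zs → xs ++ zs ↭ ys
  ⊆⇒complement {[]}     {ys} u ⊆ = ys , ↭-refl
  ⊆⇒complement {x ∷ xs} {ys} u@(_ ∷ u′) ⊆ with ∈-∃++ (⊆ (here ≡.refl))
  ... | as , bs , ≡.refl with ⊆⇒complement {xs} {as ++ bs} u′ ⊆′
    where
    ⊆′ : ∀ {y} → y ∈ xs → y ∈ as ++ bs
    ⊆′ y∈ with ∈-++⁻ as (⊆ (there y∈))
    ... | inj₁ y∈as         = ∈-++⁺ˡ y∈as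
    ... | inj₂ (here ≡.refl)  = ⊥-elim (Unique-head∉ u y∈)
    ... | inj₂ (there y∈bs) = ∈-++⁺ʳ as y∈bs
  ... | zs , p = zs , ↭-trans (prep x p) (↭-sym (shift x as bs))

  ⊆⊇⇒↭ : ∀ {xs ys : List A} → Unique xs → Unique ys → (∀ {x} → x ∈ xs → x ∈ ys) → (∀ {x} → x ∈ ys → x ∈ xs) → xs ↭ ys
  ⊆⊇⇒↭ {xs} ux uy ⊆ ⊇ with ⊆⇒complement ux ⊆
  ... | []     , p = ≡.subst (_↭ _) (List.++-identityʳ xs) p
  ... | z ∷ zs , p = ⊥-elim (Unique-++-disjoint xs (Unique-resp-↭ (↭-sym p) uy)
                       (⊇ (∈-resp-↭ p (∈-++⁺ʳ xs (here ≡.refl)))) (here ≡.refl))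

  filter-partition : ∀ {p} {P : Pred A p} (P? : Decidable₁ P) xs → filter P? xs ++ filter (¬? ∘ P?) xs ↭ xs
  filter-partition P? []       = ↭-refl
  filter-partition P? (x ∷ xs) with P? x
  ... | yes _ = prep x (filter-partition P? xs)
  ... | no  _ = ↭-trans (shift x (filter P? xs) (filter (¬? ∘ P?) xs)) (prep x (filter-partition P? xs))

∈-concatMap⁻ : ∀ {a b} {A : Set a} {B : Set b} (f : A → List B) {y} xs → y ∈ concatMap f xs → ∃ λ x → x ∈ xs × y ∈ f x
∈-concatMap⁻ f (x ∷ xs) y∈ with ∈-++⁻ (f x) y∈
... | inj₁ p = x , here ≡.refl , p
... | inj₂ q with ∈-concatMap⁻ f xs q
...   | z , z∈ , r = z , there z∈ , r

∈-concatMap⁺ : ∀ {a b} {A : Set a} {B : Set b} (f : A → List B) {x y xs} → x ∈ xs → y ∈ f x → y ∈ concatMap f xs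
∈-concatMap⁺ f (here ≡.refl)        y∈ = ∈-++⁺ˡ y∈
∈-concatMap⁺ f (there {x = x} x∈) y∈ = ∈-++⁺ʳ (f x) (∈-concatMap⁺ f x∈ y∈)

Unique-++ˡ : ∀ {a} {A : Set a} xs {ys : List A} → Unique (xs ++ ys) → Unique xs
Unique-++ˡ []       u        = []
Unique-++ˡ (x ∷ xs) (x∉ ∷ u) = All.++⁻ˡ xs x∉ ∷ Unique-++ˡ xs u

module _ {n : ℕ} where

  elements : Subset n → List (Fin n)
  elements X = filter (Subset._∈? X) (allFin n)

  elements-Unique : ∀ X → Unique (elements X)
  elements-Unique X = Unique.filter⁺ (Subset._∈? X) (Unique.allFin⁺ n)

  ∈-elements⁺ : ∀ {X i} → i ∈ˢ X → i ∈ elements X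
  ∈-elements⁺ {X} i∈X = ∈-filter⁺ (Subset._∈? X) (∈-allFin _) i∈X

  ∈-elements⁻ : ∀ {X i} → i ∈ elements X → i ∈ˢ X
  ∈-elements⁻ {X} i∈ = proj₂ (∈-filter⁻ (Subset._∈? X) {xs = allFin n} i∈)

  ∈-tabulate⁺ : ∀ {p} {P : Pred (Fin n) p} (P? : Decidable₁ P) {i} → P i → i ∈ˢ Vec.tabulate (does ∘ P?)
  ∈-tabulate⁺ P? {i} pi = Vec.lookup⇒[]= i _ (≡.trans (Vec.lookup∘tabulate (does ∘ P?) i) (dec-true (P? i) pi))

  ∈-tabulate⁻ : ∀ {p} {P : Pred (Fin n) p} (P? : Decidable₁ P) {i} → i ∈ˢ Vec.tabulate (does ∘ P?) → P i
  ∈-tabulate⁻ P? {i} i∈ with P? i | ≡.trans (≡.sym (Vec.lookup∘tabulate (does ∘ P?) i)) (Vec.[]=⇒lookup i∈)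
  ... | yes pi | _ = pi

x∈p─q⇒x∉q : ∀ {n} (p q : Subset n) {x} → x ∈ˢ p ─ q → ¬ (x ∈ˢ q)
x∈p─q⇒x∉q (_ ∷ p) (_ ∷ q) (Vec.there x∈) (Vec.there x∈q) = x∈p─q⇒x∉q p q x∈ x∈q
x∈p─q⇒x∉q (inside ∷ p) (inside ∷ q) () Vec.here

repetition : ∀ {m} (xs : List (Fin m)) → ¬ Unique xs → ∃₂ λ x ys → xs ↭ x ∷ x ∷ ys
repetition []       ¬u = contradiction [] ¬u
repetition (x ∷ xs) ¬u with DecMembership._∈?_ _≟_ x xs
... | yes x∈ with ∈-∃++ x∈
...   | as , bs , ≡.refl = x , as ++ bs , prep x (shift x as bs)
repetition (x ∷ xs) ¬u | no x∉ with repetition xs (λ u → ¬u (∉⇒All≢ x∉ ∷ u))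
... | y , ys , p = y , x ∷ ys , ↭-trans (prep x p) (↭-trans (swap x y ↭-refl) (prep y (swap x y ↭-refl)))

Unique-↭-allFin : ∀ {n} {xs : List (Fin n)} → Unique xs → length xs ≡ n → xs ↭ allFin n
Unique-↭-allFin {n} {xs} u eq with ⊆⇒complement u (λ {i} _ → ∈-allFin i)
... | []     , p = ↭-trans (↭-reflexive (≡.sym (List.++-identityʳ xs))) p
... | y ∷ ys , p = contradiction
  (≡.trans (≡.sym (List.length-++ xs)) (≡.trans (↭-length p) (≡.trans (List.length-tabulate {n = n} id) (≡.sym eq))))
  (ℕ.m+1+n≢m (length xs))

-- Trails, cycles, leaf additions and paths

module GraphFacts {n m} (G : OrientedGraph n m) where
  open OrientedGraph G
  open Graphs G hiding (V; E)
  open DecMembership {A = Fin n} _≟_ using (_∈?_)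

  V E : Set
  V = Fin n
  E = Fin m

  Joins-sym : ∀ {e i j} → Joins e i j → Joins e j i
  Joins-sym = Sum.swap

  Joins-unique : ∀ {e f i j} → Joins e i j → Joins f i j → e ≡ f
  Joins-unique (inj₁ (≡.refl , ≡.refl)) (inj₁ (p , q)) = simple _ _ (inj₁ (≡.sym p , ≡.sym q))
  Joins-unique (inj₁ (≡.refl , ≡.refl)) (inj₂ (p , q)) = simple _ _ (inj₂ (≡.sym q , ≡.sym p))
  Joins-unique (inj₂ (≡.refl , ≡.refl)) (inj₁ (p , q)) = simple _ _ (inj₂ (≡.sym q , ≡.sym p))
  Joins-unique (inj₂ (≡.refl , ≡.refl)) (inj₂ (p , q)) = simple _ _ (inj₁ (≡.sym p , ≡.sym q))

  Joins-≢ : ∀ {e i j} → Joins e i j → i ≢ j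
  Joins-≢ (inj₁ (≡.refl , ≡.refl)) eq = loopless _ eq
  Joins-≢ (inj₂ (≡.refl , ≡.refl)) eq = loopless _ (≡.sym eq)

  Joins-functional : ∀ {e i j k} → Joins e i j → Joins e i k → j ≡ k
  Joins-functional (inj₁ (≡.refl , ≡.refl)) (inj₁ (p , q)) = q
  Joins-functional (inj₁ (≡.refl , ≡.refl)) (inj₂ (p , q)) = contradiction (≡.sym q) (loopless _)
  Joins-functional (inj₂ (≡.refl , ≡.refl)) (inj₁ (p , q)) = contradiction p (loopless _)
  Joins-functional (inj₂ (≡.refl , ≡.refl)) (inj₂ (p , q)) = p

  Joins-src-tgt : ∀ e → Joins e (src e) (tgt e)
  Joins-src-tgt e = inj₁ (≡.refl , ≡.refl)

  Inside : List V → E → Set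
  Inside ρ e = src e ∈ ρ × tgt e ∈ ρ

  Inside-Joins : ∀ {ρ e u v} → Joins e u v → u ∈ ρ → v ∈ ρ → Inside ρ e
  Inside-Joins (inj₁ (≡.refl , ≡.refl)) p q = p , q
  Inside-Joins (inj₂ (≡.refl , ≡.refl)) p q = q , p

  Inside-endpoint : ∀ {ρ e u v} → Joins e u v → Inside ρ e → u ∈ ρ
  Inside-endpoint (inj₁ (≡.refl , ≡.refl)) = proj₁
  Inside-endpoint (inj₂ (≡.refl , ≡.refl)) = proj₂

  Inside-⊆ : ∀ {ρ ρ′ e} → (∀ {v} → v ∈ ρ → v ∈ ρ′) → Inside ρ e → Inside ρ′ e
  Inside-⊆ ⊆ (p , q) = ⊆ p , ⊆ q

  -- `Adj H` is definitionally the instance for membership in the edge set of `H`, so the same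
  -- lemmas serve subgraphs and edge lists.
  EdgeAdj : Pred E 0ℓ → Rel V 0ℓ
  EdgeAdj P i j = ∃ λ e → P e × Joins e i j

  EdgeAdj-sym : ∀ {P i j} → EdgeAdj P i j → EdgeAdj P j i
  EdgeAdj-sym (e , p , q) = e , p , Joins-sym q

  EdgeAdj-map : ∀ {P Q} → (∀ {e} → P e → Q e) → ∀ {i j} → EdgeAdj P i j → EdgeAdj Q i j
  EdgeAdj-map f (e , p , q) = e , f p , q

  IsCycleIn : Pred E 0ℓ → List V → Set
  IsCycleIn P vs = 3 ℕ.≤ length vs × Unique vs × Linked (EdgeAdj P) (closeUp vs)

  data Trail : List V → List E → Set where
    [-]  : ∀ {v} → Trail (v ∷ []) []
    _∷_  : ∀ {v u vs e es} → Joins e v u → Trail (u ∷ vs) es → Trail (v ∷ u ∷ vs) (e ∷ es)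

  Linked⇒Trail : ∀ {P v vs} → Linked (EdgeAdj P) (v ∷ vs) → ∃ λ es → Trail (v ∷ vs) es × All P es
  Linked⇒Trail [-]               = [] , [-] , []
  Linked⇒Trail ((e , p , j) ∷ l) with Linked⇒Trail l
  ... | es , t , ps = e ∷ es , j ∷ t , p ∷ ps

  Trail-Inside : ∀ {vs es} → Trail vs es → All (Inside vs) es
  Trail-Inside [-]     = []
  Trail-Inside (j ∷ t) = Inside-Joins j (here ≡.refl) (there (here ≡.refl)) ∷ All.map (Inside-⊆ there) (Trail-Inside t)

  Trail-length : ∀ {vs es} → Trail vs es → length vs ≡ suc (length es)
  Trail-length [-]     = ≡.refl
  Trail-length (j ∷ t) = ≡.cong suc (Trail-length t)

  Trail-Unique : ∀ {vs es} → Trail vs es → Unique vs → Unique es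
  Trail-Unique [-]     u       = []
  Trail-Unique (j ∷ t) uu@(_ ∷ u) =
    ∉⇒All≢ (λ e∈ → Unique-head∉ uu (Inside-endpoint j (All.lookup (Trail-Inside t) e∈))) ∷ Trail-Unique t u

  edgesOf-∈⁻ : ∀ {vs es e} → Trail vs es → e ∈ˢ edgesOf vs → e ∈ es
  edgesOf-∈⁻ [-] e∈ = ⊥-elim (Subset.∉⊥ e∈)
  edgesOf-∈⁻ {e = e} (_∷_ {v} {u} {vs} j t) e∈ with Subset.x∈p∪q⁻ _ (edgesOf (u ∷ vs)) e∈
  ... | inj₁ q = here (Joins-unique (∈-tabulate⁻ (λ e → joins? e v u) q) j)
  ... | inj₂ q = there (edgesOf-∈⁻ t q)

  edgesOf-∈⁺ : ∀ {vs es e} → Trail vs es → e ∈ es → e ∈ˢ edgesOf vs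
  edgesOf-∈⁺ (_∷_ {v} {u} j t) (here ≡.refl) = Subset.x∈p∪q⁺ (inj₁ (∈-tabulate⁺ (λ e → joins? e v u) j))
  edgesOf-∈⁺ (j ∷ t)           (there e∈)  = Subset.x∈p∪q⁺ (inj₂ (edgesOf-∈⁺ t e∈))

  ∈-closeUp : ∀ {v vs} → v ∈ closeUp vs → v ∈ vs
  ∈-closeUp {vs = x ∷ xs} v∈ with ∈-++⁻ (x ∷ xs) v∈
  ... | inj₁ p           = p
  ... | inj₂ (here ≡.refl) = here ≡.refl

  -- After the first edge vu, the trail runs through distinct vertices and has distinct edges. The
  -- edge vu cannot recur: as the second edge it would identify the third vertex with v, and all
  -- later edges avoid u.
  Trail-closed-Unique : ∀ {v vs es} → 3 ℕ.≤ length (v ∷ vs) → Unique (v ∷ vs) → Trail (closeUp (v ∷ vs)) es → Unique es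
  Trail-closed-Unique {v} {u ∷ w ∷ vs} (s≤s (s≤s (s≤s _))) uu@(_ ∷ uu′) (j ∷ j′ ∷ t) =
    ∉⇒All≢ e∉ ∷ Trail-Unique (j′ ∷ t) (Unique-resp-↭ (∷↭∷ʳ v (u ∷ w ∷ vs)) uu)
    where
    e∉ : _ ∉ _ ∷ _
    e∉ (here ≡.refl) = Unique-head∉ uu (there (here (Joins-functional (Joins-sym j) j′)))
    e∉ (there e∈)  with ∈-++⁻ (w ∷ vs) (Inside-endpoint (Joins-sym j) (All.lookup (Trail-Inside t) e∈))
    ... | inj₁ u∈        = Unique-head∉ uu′ u∈
    ... | inj₂ (here eq) = Joins-≢ j (≡.sym eq)

  -- Cycles

  Linked-∷ʳ : ∀ {P : Pred E 0ℓ} vs {x y} → Linked (EdgeAdj P) (vs ∷ʳ x) → EdgeAdj P x y → Linked (EdgeAdj P) (vs ∷ʳ x ∷ʳ y)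
  Linked-∷ʳ []           [-]     r = r ∷ [-]
  Linked-∷ʳ (v ∷ [])     (q ∷ l) r = q ∷ Linked-∷ʳ [] l r
  Linked-∷ʳ (v ∷ u ∷ vs) (q ∷ l) r = q ∷ Linked-∷ʳ (u ∷ vs) l r

  rotate : ∀ {P v vs} → IsCycleIn P (v ∷ vs) → IsCycleIn P (vs ∷ʳ v)
  rotate {P} {v} {u ∷ vs} (3≤ , uu , q ∷ l) =
    ≡.subst (3 ℕ.≤_) (↭-length (∷↭∷ʳ v (u ∷ vs))) 3≤ , Unique-resp-↭ (∷↭∷ʳ v (u ∷ vs)) uu , Linked-∷ʳ (u ∷ vs) l q
  rotate {vs = []} (s≤s () , _)

  -- Rotating the cycle brings the vertex to the front.
  cycle-neighbours : ∀ {P v} vs ws → IsCycleIn P (vs ++ v ∷ ws) →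
    ∃₂ λ x y → x ≢ y × EdgeAdj P v x × EdgeAdj P v y
  cycle-neighbours [] [] (s≤s () , _)
  cycle-neighbours [] (x ∷ []) (s≤s (s≤s ()) , _)
  cycle-neighbours {P} {v} [] (x ∷ x′ ∷ ws) (_ , _ ∷ uu , q ∷ _ ∷ l) with final x′ ws l
    where
    final : ∀ x ws → Linked (EdgeAdj P) (x ∷ ws ∷ʳ v) → ∃ λ y → y ∈ x ∷ ws × EdgeAdj P y v
    final x []       (q ∷ [-]) = x , here ≡.refl , q
    final x (w ∷ ws) (_ ∷ l) with final w ws l
    ... | y , y∈ , r = y , there y∈ , r
  ... | y , y∈ , r = x , y , (λ { ≡.refl → Unique-head∉ uu y∈ }) , q , EdgeAdj-sym r
  cycle-neighbours {P} {v} (u ∷ vs) ws c = cycle-neighbours vs (ws ∷ʳ u)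
    (≡.subst (IsCycleIn P) (List.++-assoc vs (v ∷ ws) [ u ]) (rotate c))

  cycle-edge-∈ : ∀ {P vs} (w : List V) → (∀ {v} → v ∈ w → v ∈ vs) → Linked (EdgeAdj P) w →
    Linked (EdgeAdj (λ e → P e × Inside vs e)) w
  cycle-edge-∈ []          ⊆ []  = []
  cycle-edge-∈ (v ∷ [])    ⊆ [-] = [-]
  cycle-edge-∈ (v ∷ u ∷ w) ⊆ ((e , p , j) ∷ l) =
    (e , (p , Inside-Joins j (⊆ (here ≡.refl)) (⊆ (there (here ≡.refl)))) , j) ∷ cycle-edge-∈ (u ∷ w) (⊆ ∘ there) l

  IsCycleIn-Inside : ∀ {P vs} → IsCycleIn P vs → IsCycleIn (λ e → P e × Inside vs e) vs
  IsCycleIn-Inside {vs = v ∷ vs} (p , q , l) = p , q , cycle-edge-∈ _ ∈-closeUp l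

  IsCycleIn-map : ∀ {P Q vs} → (∀ {e} → P e → Q e) → IsCycleIn P vs → IsCycleIn Q vs
  IsCycleIn-map f (p , q , l) = p , q , Linked.map (EdgeAdj-map f) l

  -- A vertex on a cycle has two distinct neighbours, and a single edge leads to only one.
  leaf∉cycle : ∀ {P v vs e₀} → (∀ {e u} → P e → Joins e v u → e ≡ e₀) → IsCycleIn P vs → v ∉ vs
  leaf∉cycle only c v∈ with ∈-∃++ v∈
  ... | as , bs , ≡.refl with cycle-neighbours as bs c
  ... | x , y , x≢y , (e , p , j) , (f , q , k) with only p j | only q k
  ... | ≡.refl | ≡.refl = x≢y (Joins-functional j k)

  module _ (ρ₀ : List V) where

    -- A sequence of leaf additions, most recent first: each vertex is new
    -- and its edge joins it to an earlier vertex or to the core ρ₀.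
    data Grown : List V → List E → Set where
      []   : Grown [] []
      leaf : ∀ {νs es v u e} → Grown νs es → v ∉ νs ++ ρ₀ → u ∈ νs ++ ρ₀ → Joins e v u → Grown (v ∷ νs) (e ∷ es)

    Grown-length : ∀ {νs es} → Grown νs es → length νs ≡ length es
    Grown-length []             = ≡.refl
    Grown-length (leaf g _ _ _) = ≡.cong suc (Grown-length g)

    Grown-Unique : Unique ρ₀ → ∀ {νs es} → Grown νs es → Unique (νs ++ ρ₀)
    Grown-Unique u []              = u
    Grown-Unique u (leaf g v∉ _ _) = ∉⇒All≢ v∉ ∷ Grown-Unique u g

    Grown-Inside : ∀ {νs es κ₀} → Grown νs es → All (Inside ρ₀) κ₀ → All (Inside (νs ++ ρ₀)) (es ++ κ₀)
    Grown-Inside []              ins = ins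
    Grown-Inside (leaf g _ u∈ j) ins =
      Inside-Joins j (here ≡.refl) (there u∈) ∷ All.map (Inside-⊆ there) (Grown-Inside g ins)

    Grown-edges-Unique : ∀ {νs es κ₀} → Grown νs es → All (Inside ρ₀) κ₀ → Unique κ₀ → Unique (es ++ κ₀)
    Grown-edges-Unique []              ins u = u
    Grown-edges-Unique (leaf g v∉ _ j) ins u =
      ∉⇒All≢ (λ e∈ → v∉ (Inside-endpoint j (All.lookup (Grown-Inside g ins) e∈))) ∷ Grown-edges-Unique g ins u

    Grown-vertices : ∀ {νs es} {Q : Pred V 0ℓ} → Grown νs es → All (λ e → Q (src e) × Q (tgt e)) es → ∀ {v} → v ∈ νs → Q v
    Grown-vertices (leaf g _ _ (inj₁ (≡.refl , ≡.refl))) ((p , q) ∷ _) (here ≡.refl) = p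
    Grown-vertices (leaf g _ _ (inj₂ (≡.refl , ≡.refl))) ((p , q) ∷ _) (here ≡.refl) = q
    Grown-vertices (leaf g _ _ _)                    (_ ∷ ps)      (there v∈)  = Grown-vertices g ps v∈

    -- Leaves are peeled off newest first. Earlier edges lie inside the earlier vertices, so the
    -- newest vertex carries its own edge only and lies on no cycle. `IsCycleIn-Inside` then
    -- excludes that edge too, since an edge of the cycle has both ends on it.
    Grown-cycle : ∀ {νs es κ₀ vs} → Grown νs es → All (Inside ρ₀) κ₀ → IsCycleIn (_∈ es ++ κ₀) vs → IsCycleIn (_∈ κ₀) vs
    Grown-cycle [] ins c = c
    Grown-cycle {v ∷ νs} {e ∷ es} {κ₀} {vs} (leaf {u = u} g v∉ u∈ j) ins c =
      Grown-cycle g ins (IsCycleIn-map drop-leaf (IsCycleIn-Inside c))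
      where
      only : ∀ {f u} → f ∈ e ∷ es ++ κ₀ → Joins f v u → f ≡ e
      only (here eq)  k = eq
      only (there f∈) k = ⊥-elim (v∉ (Inside-endpoint k (All.lookup (Grown-Inside g ins) f∈)))
      drop-leaf : ∀ {f} → f ∈ e ∷ es ++ κ₀ × Inside vs f → f ∈ es ++ κ₀
      drop-leaf (here ≡.refl , f-in) = ⊥-elim (leaf∉cycle only c (Inside-endpoint j f-in))
      drop-leaf (there f∈  , _)    = f∈

    Grown-connected : ∀ {νs es κ₀ r} → Grown νs es → (∀ {v} → v ∈ ρ₀ → Star (EdgeAdj (_∈ κ₀)) r v) →
      ∀ {v} → v ∈ νs ++ ρ₀ → Star (EdgeAdj (_∈ es ++ κ₀)) r v
    Grown-connected []              conn v∈          = conn v∈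
    Grown-connected (leaf g _ u∈ j) conn (here ≡.refl) =
      Star.map (EdgeAdj-map there) (Grown-connected g conn u∈) ◅◅ ((_ , here ≡.refl , Joins-sym j) ◅ ε)
    Grown-connected (leaf g _ _ _)  conn (there v∈)  = Star.map (EdgeAdj-map there) (Grown-connected g conn v∈)

    module _ {P : Pred E 0ℓ} where

      -- Follow the walk: each vertex not yet present becomes a leaf, attached by the edge just
      -- crossed. That old vertices are retained allows further walks to be absorbed.
      absorb : ∀ {νs es u w} → Grown νs es → All P es → u ∈ νs ++ ρ₀ → Star (EdgeAdj P) u w →
        ∃₂ λ νs′ es′ → Grown νs′ es′ × All P es′ × (∀ {v} → v ∈ νs ++ ρ₀ → v ∈ νs′ ++ ρ₀) × w ∈ νs′ ++ ρ₀
      absorb g ps u∈ ε = _ , _ , g , ps , id , u∈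
      absorb {νs} g ps u∈ (_◅_ {j = x} (e , p , j) s) with x ∈? (νs ++ ρ₀)
      ... | yes x∈ = absorb g ps x∈ s
      ... | no  x∉ with absorb (leaf g x∉ u∈ (Joins-sym j)) (p ∷ ps) (here ≡.refl) s
      ...   | νs′ , es′ , g′ , ps′ , ⊆ , w∈ = νs′ , es′ , g′ , ps′ , ⊆ ∘ there , w∈

      grow : ∀ {r} → r ∈ ρ₀ → ∀ ws → (∀ {w} → w ∈ ws → Star (EdgeAdj P) r w) →
        ∃₂ λ νs es → Grown νs es × All P es × (∀ {w} → w ∈ ws → w ∈ νs ++ ρ₀)
      grow r∈ []       reach = [] , [] , [] , [] , λ ()
      grow r∈ (w ∷ ws) reach with grow r∈ ws (reach ∘ there)
      ... | νs , es , g , ps , cov with absorb g ps (∈-++⁺ʳ νs r∈) (reach (here ≡.refl))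
      ... | νs′ , es′ , g′ , ps′ , ⊆ , w∈ = νs′ , es′ , g′ , ps′ , λ { (here ≡.refl) → w∈ ; (there v∈) → ⊆ (cov v∈) }

  -- Paths

  data Path (P : Pred E 0ℓ) : V → V → List V → Set where
    []  : ∀ {v} → Path P v v []
    _∷_ : ∀ {u v w vs} → EdgeAdj P u v → Path P v w vs → Path P u w (v ∷ vs)

  Path-suffix : ∀ {P u w vs x} → Path P u w vs → Unique (u ∷ vs) → x ∈ u ∷ vs →
    ∃ λ vs′ → Path P x w vs′ × Unique (x ∷ vs′)
  Path-suffix p       uu       (here ≡.refl) = _ , p , uu
  Path-suffix (_ ∷ p) (_ ∷ uu) (there x∈)  = Path-suffix p uu x∈

  -- Loop erasure: if the start already lies on the path found so far, only the suffix from there is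
  -- kept.
  Star⇒Path : ∀ {P u w} → Star (EdgeAdj P) u w → ∃ λ vs → Path P u w vs × Unique (u ∷ vs)
  Star⇒Path ε = [] , [] , [] ∷ []
  Star⇒Path (_◅_ {i = u} {j = v} r s) with Star⇒Path s
  ... | vs , p , uu with u ∈? (v ∷ vs)
  ... | yes u∈ = Path-suffix p uu u∈
  ... | no  u∉ = v ∷ vs , r ∷ p , ∉⇒All≢ u∉ ∷ uu

  Path-∷ʳ : ∀ {P u w vs x} → Path P u w vs → EdgeAdj P w x → Linked (EdgeAdj P) (u ∷ vs ∷ʳ x)
  Path-∷ʳ []      r = r ∷ [-]
  Path-∷ʳ (q ∷ p) r = q ∷ Path-∷ʳ p r

  Path-map : ∀ {P Q u w vs} → (∀ {e} → P e → Q e) → Path P u w vs → Path Q u w vs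
  Path-map f []      = []
  Path-map f (q ∷ p) = EdgeAdj-map f q ∷ Path-map f p

  Path-edgesOf : ∀ {P u w vs x e} → Path P u w vs → Joins e w x → e ∈ˢ edgesOf (u ∷ vs ∷ʳ x)
  Path-edgesOf {w = w} {x = x} [] j = Subset.x∈p∪q⁺ (inj₁ (∈-tabulate⁺ (λ e → joins? e w x) j))
  Path-edgesOf (q ∷ p) j = Subset.x∈p∪q⁺ (inj₂ (Path-edgesOf p j))

  -- The fundamental cycle of f. A path without edges would make f a loop, and a path of one edge
  -- would be f itself by simplicity, contrary to `f ∉ κ`; so there are at least three vertices.
  close-cycle : ∀ {κ f u v} → f ∉ κ → Joins f u v → Star (EdgeAdj (_∈ κ)) u v →
    ∃ λ vs → IsCycleIn (_∈ f ∷ κ) vs × f ∈ˢ edgesOf (closeUp vs)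
  close-cycle f∉ j s with Star⇒Path s
  ... | [] , [] , _ = ⊥-elim (Joins-≢ j ≡.refl)
  ... | _ ∷ [] , (e , e∈ , k) ∷ [] , _ = ⊥-elim (f∉ (≡.subst (_∈ _) (Joins-unique k j) e∈))
  ... | _ ∷ _ ∷ _ , p , uu = _ ,
    (s≤s (s≤s (s≤s z≤n)) , uu , Path-∷ʳ (Path-map there p) (_ , here ≡.refl , Joins-sym j)) , Path-edgesOf p (Joins-sym j)

∈-allSubsets : ∀ {n} (X : Subset n) → X ∈ allSubsets n
∈-allSubsets []            = here ≡.refl
∈-allSubsets (inside  ∷ X) = ∈-++⁺ˡ (∈-map⁺ (inside ∷_) (∈-allSubsets X))
∈-allSubsets (outside ∷ X) = ∈-++⁺ʳ (List.map (inside ∷_) (allSubsets _)) (∈-map⁺ (outside ∷_) (∈-allSubsets X))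

allSubsets-Unique : ∀ n → Unique (allSubsets n)
allSubsets-Unique zero    = [] ∷ []
allSubsets-Unique (suc n) = Unique.++⁺
  (Unique.map⁺ Vec.∷-injectiveʳ (allSubsets-Unique n)) (Unique.map⁺ Vec.∷-injectiveʳ (allSubsets-Unique n)) disjoint
  where
  disjoint : ∀ {X} → ¬ (X ∈ List.map (inside ∷_) (allSubsets n) × X ∈ List.map (outside ∷_) (allSubsets n))
  disjoint (p , q) with ∈-map⁻ (inside ∷_) p | ∈-map⁻ (outside ∷_) q
  ... | _ , _ , ≡.refl | _ , _ , ()

-- Growing connected subgraphs, unicyclicity and components

module SpanningFacts {n m} (G : OrientedGraph n m) where
  open OrientedGraph G
  open Graphs G hiding (V; E)
  open Graphs.Subgraph using () renaming (V to vertexSet; E to edgeSet)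
  open GraphFacts G

  record CycleCore (P : Pred E 0ℓ) (vs : List V) : Set where
    field
      root   : V
      κ      : List E
      root∈  : root ∈ vs
      trail  : Trail (closeUp vs) κ
      holds  : All P κ
      unique : Unique κ
      within : All (Inside vs) κ
      size   : length κ ≡ length vs
      reach  : ∀ {v} → v ∈ vs → Star (EdgeAdj (_∈ κ)) root v

  Trail-reach : ∀ {v vs es} → Trail (v ∷ vs) es → ∀ {u} → u ∈ v ∷ vs → Star (EdgeAdj (_∈ es)) v u
  Trail-reach t       (here ≡.refl) = ε
  Trail-reach (j ∷ t) (there u∈)  = (_ , here ≡.refl , j) ◅ Star.map (EdgeAdj-map there) (Trail-reach t u∈)

  cycleCore : ∀ {P vs} → IsCycleIn P vs → CycleCore P vs
  cycleCore {vs = v ∷ vs} (3≤ , uu , l) with Linked⇒Trail l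
  ... | κ , t , ps = record
    { root   = v
    ; κ      = κ
    ; root∈  = here ≡.refl
    ; trail  = t
    ; holds  = ps
    ; unique = Trail-closed-Unique 3≤ uu t
    ; within = All.map (Inside-⊆ ∈-closeUp) (Trail-Inside t)
    ; size   = ℕ.suc-injective (≡.trans (≡.sym (Trail-length t)) (≡.cong suc (≡.sym (↭-length (∷↭∷ʳ v vs)))))
    ; reach  = λ u∈ → Trail-reach t (∈-++⁺ˡ u∈)
    }

  Linked-next : ∀ {P : Pred E 0ℓ} ws {v x} → v ∈ ws → Linked (EdgeAdj P) (ws ∷ʳ x) → ∃ (EdgeAdj P v)
  Linked-next (w ∷ [])     (here ≡.refl) (r ∷ _) = _ , r
  Linked-next (w ∷ _ ∷ ws) (here ≡.refl) (r ∷ _) = _ , r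
  Linked-next (w ∷ _ ∷ ws) (there v∈)  (_ ∷ l) = Linked-next (_ ∷ ws) v∈ l

  cycle-vertices : ∀ {P vs v} → IsCycleIn P vs → v ∈ vs → ∃ (EdgeAdj P v)
  cycle-vertices {vs = w ∷ ws} (_ , _ , l) v∈ = Linked-next (w ∷ ws) v∈ l

  -- The record `Subgraph` does not tie its edges to its vertices. Induced and spanning subgraphs
  -- have this property.
  Closed : Subgraph → Set
  Closed U = ∀ {e} → e ∈ˢ edgeSet U → src e ∈ˢ vertexSet U × tgt e ∈ˢ vertexSet U

  Closed-Joins : ∀ {U e u v} → Closed U → e ∈ˢ edgeSet U → Joins e u v → u ∈ˢ vertexSet U × v ∈ˢ vertexSet U
  Closed-Joins cl e∈ (inj₁ (≡.refl , ≡.refl)) = cl e∈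
  Closed-Joins cl e∈ (inj₂ (≡.refl , ≡.refl)) = proj₂ (cl e∈) , proj₁ (cl e∈)

  -- Everything of U is obtained from the core (ρ₀ , κ₀) by leaf additions,
  -- except for the surplus edges.
  record Spanning (U : Subgraph) (ρ₀ : List V) (κ₀ : List E) : Set where
    field
      νs         : List V
      es surplus : List E
      grown      : Grown ρ₀ νs es
      vertices↭  : νs ++ ρ₀ ↭ elements (vertexSet U)
      edges↭     : (es ++ κ₀) ++ surplus ↭ elements (edgeSet U)

    es-∈ : ∀ {e} → e ∈ es ++ κ₀ → e ∈ˢ edgeSet U
    es-∈ e∈ = ∈-elements⁻ (∈-resp-↭ edges↭ (∈-++⁺ˡ e∈))

    es-Unique : Unique ((es ++ κ₀) ++ surplus)
    es-Unique = Unique-resp-↭ (↭-sym edges↭) (elements-Unique (edgeSet U))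

    surplus-∉ : ∀ {e} → e ∈ surplus → e ∉ es ++ κ₀
    surplus-∉ e∈ e∈′ = Unique-++-disjoint (es ++ κ₀) es-Unique e∈′ e∈

    -- A leaf adds one vertex and one edge, so over an equinumerous core, such as a cycle, the
    -- surplus has size |E| - |V|.
    surplus-size : length ρ₀ ≡ length κ₀ → length (elements (vertexSet U)) ℕ.+ length surplus ≡ length (elements (edgeSet U))
    surplus-size eq = begin
      length (elements (vertexSet U)) ℕ.+ length surplus  ≡⟨ ≡.cong (ℕ._+ length surplus) (↭-length vertices↭) ⟨
      length (νs ++ ρ₀) ℕ.+ length surplus                ≡⟨ ≡.cong (ℕ._+ length surplus) (List.length-++ νs) ⟩
      length νs ℕ.+ length ρ₀ ℕ.+ length surplus          ≡⟨ ≡.cong (ℕ._+ length surplus) (≡.cong₂ ℕ._+_ (Grown-length ρ₀ grown) eq) ⟩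
      length es ℕ.+ length κ₀ ℕ.+ length surplus          ≡⟨ ≡.cong (ℕ._+ length surplus) (List.length-++ es) ⟨
      length (es ++ κ₀) ℕ.+ length surplus                ≡⟨ List.length-++ (es ++ κ₀) ⟨
      length ((es ++ κ₀) ++ surplus)                      ≡⟨ ↭-length edges↭ ⟩
      length (elements (edgeSet U))                       ∎
      where open ≡.≡-Reasoning

    -- The grown part already connects the ends of z. That the cycle passes through z is recorded
    -- because this distinguishes it from the core cycle.
    surplus-cycle : ∀ {r z} → All (Inside ρ₀) κ₀ → (∀ {v} → v ∈ ρ₀ → Star (EdgeAdj (_∈ κ₀)) r v) → Closed U →
      z ∈ surplus → ∃ λ vs → IsCycle U vs × z ∈ˢ edgesOf (closeUp vs)
    surplus-cycle {r} {z} ins conn cl z∈ with close-cycle (surplus-∉ z∈) (Joins-src-tgt z)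
      (Star.reverse EdgeAdj-sym (connect (proj₁ (cl z∈E))) ◅◅ connect (proj₂ (cl z∈E)))
      where
      z∈E : z ∈ˢ edgeSet U
      z∈E = ∈-elements⁻ (∈-resp-↭ edges↭ (∈-++⁺ʳ (es ++ κ₀) z∈))
      connect : ∀ {v} → v ∈ˢ vertexSet U → Star (EdgeAdj (_∈ es ++ κ₀)) r v
      connect v∈ = Grown-connected ρ₀ grown conn (∈-resp-↭ (↭-sym vertices↭) (∈-elements⁺ v∈))
    ... | vs , c , z∈vs = vs , IsCycleIn-map (λ { (here ≡.refl) → ∈-elements⁻ (∈-resp-↭ edges↭ (∈-++⁺ʳ (es ++ κ₀) z∈)) ; (there e∈) → es-∈ e∈ }) c , z∈vs

    no-surplus-cycle : surplus ≡ [] → All (Inside ρ₀) κ₀ → ∀ {vs} → IsCycle U vs → IsCycleIn (_∈ κ₀) vs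
    no-surplus-cycle none ins c = Grown-cycle ρ₀ grown ins (IsCycleIn-map covered c)
      where
      covered : ∀ {e} → e ∈ˢ edgeSet U → e ∈ es ++ κ₀
      covered e∈ with ∈-++⁻ (es ++ κ₀) (∈-resp-↭ (↭-sym edges↭) (∈-elements⁺ e∈))
      ... | inj₁ p = p
      ... | inj₂ q with () ← ≡.subst (_ ∈_) none q

  spanning-from : ∀ {U ρ₀ κ₀ r} → Connected U → Closed U → r ∈ ρ₀ → Unique ρ₀ → (∀ {v} → v ∈ ρ₀ → v ∈ˢ vertexSet U) →
    All (Inside ρ₀) κ₀ → Unique κ₀ → All (_∈ˢ edgeSet U) κ₀ → Spanning U ρ₀ κ₀
  spanning-from {U} {ρ₀} {κ₀} {r} (_ , conn) cl r∈ uρ ρ⊆ ins uκ κ⊆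
    with grow ρ₀ r∈ (elements (vertexSet U)) (λ w∈ → conn r (ρ⊆ r∈) _ (∈-elements⁻ w∈))
  ... | νs , es , g , ps , cover with ⊆⇒complement {ys = elements (edgeSet U)} (Grown-edges-Unique ρ₀ g ins uκ)
          (λ e∈ → ∈-elements⁺ ([ All.lookup ps , All.lookup κ⊆ ]′ (∈-++⁻ es e∈)))
  ... | zs , p = record
    { νs = νs ; es = es ; surplus = zs ; grown = g
    ; vertices↭ = ⊆⊇⇒↭ (Grown-Unique ρ₀ uρ g) (elements-Unique _)
        (λ v∈ → ∈-elements⁺ ([ Grown-vertices ρ₀ g (All.map cl ps) , ρ⊆ ]′ (∈-++⁻ νs v∈))) cover
    ; edges↭ = p }

  spanning-root : ∀ {U r} → Connected U → Closed U → r ∈ˢ vertexSet U → Spanning U (r ∷ []) []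
  spanning-root conn cl r∈ = spanning-from conn cl (here ≡.refl) ([] ∷ []) (λ { (here ≡.refl) → r∈ }) [] [] []

  spanning-cycle : ∀ {U vs} → Connected U → Closed U → (c : IsCycle U vs) → Spanning U vs (CycleCore.κ (cycleCore c))
  spanning-cycle {U} {vs} conn cl c =
    spanning-from conn cl root∈ (proj₁ (proj₂ c)) vs⊆ within unique holds
    where
    open CycleCore (cycleCore c)
    vs⊆ : ∀ {v} → v ∈ vs → v ∈ˢ vertexSet U
    vs⊆ v∈ with cycle-vertices c v∈
    ... | u , e , e∈ , j = proj₁ (Closed-Joins cl e∈ j)

  cycleSpanning : ∀ {U} → Connected U → Closed U → (C : Cycle U) → Spanning U (Cycle.vertices C) (CycleCore.κ (cycleCore (Cycle.isCycle C)))
  cycleSpanning conn cl C = spanning-cycle conn cl (Cycle.isCycle C)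

  balanced : Subgraph → Set
  balanced U = length (elements (vertexSet U)) ≡ length (elements (edgeSet U))

  balanced⇒no-surplus : ∀ {U} (conn : Connected U) (cl : Closed U) (C : Cycle U) → balanced U →
    Spanning.surplus (cycleSpanning conn cl C) ≡ []
  balanced⇒no-surplus {U} conn cl C eq = no-length (ℕ.+-cancelˡ-≡ (length (elements (vertexSet U))) _ 0
    (≡.trans (Spanning.surplus-size (cycleSpanning conn cl C) (≡.sym (CycleCore.size (cycleCore (Cycle.isCycle C)))))
      (≡.trans (≡.sym eq) (≡.sym (ℕ.+-identityʳ _)))))
    where
    no-length : ∀ {zs : List E} → length zs ≡ 0 → zs ≡ []
    no-length {[]} _ = ≡.refl

  cycleEdges-∈⁻ : ∀ {U} (C : Cycle U) {e} → e ∈ˢ cycleEdges C → e ∈ CycleCore.κ (cycleCore (Cycle.isCycle C))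
  cycleEdges-∈⁻ C = edgesOf-∈⁻ (CycleCore.trail (cycleCore (Cycle.isCycle C)))

  cycleEdges-∈⁺ : ∀ {U} (C : Cycle U) {e} → e ∈ CycleCore.κ (cycleCore (Cycle.isCycle C)) → e ∈ˢ cycleEdges C
  cycleEdges-∈⁺ C = edgesOf-∈⁺ (CycleCore.trail (cycleCore (Cycle.isCycle C)))

  Linked-edgesOf : ∀ {P ws e} → Linked (EdgeAdj P) ws → e ∈ˢ edgesOf ws → P e
  Linked-edgesOf {ws = []}    [] e∈ = ⊥-elim (Subset.∉⊥ e∈)
  Linked-edgesOf {ws = _ ∷ _} l  e∈ with Linked⇒Trail l
  ... | κ , t , ps = All.lookup ps (edgesOf-∈⁻ t e∈)

  -- When edges and vertices are equinumerous, growing from C uses up every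
  -- edge, and leaf additions close no cycle, so D lies inside C.
  balanced⇒cycle-⊆ : ∀ {U} → Connected U → Closed U → balanced U → (C D : Cycle U) → cycleEdges D ⊆ˢ cycleEdges C
  balanced⇒cycle-⊆ conn cl eq C D e∈ = cycleEdges-∈⁺ C (Linked-edgesOf
    (proj₂ (proj₂ (Spanning.no-surplus-cycle (cycleSpanning conn cl C) (balanced⇒no-surplus conn cl C eq)
      (CycleCore.within (cycleCore (Cycle.isCycle C))) (Cycle.isCycle D)))) e∈)

  balanced⇒unicyclic : ∀ {U} → Connected U → Closed U → balanced U → Cycle U → Unicyclic U
  balanced⇒unicyclic conn cl eq C = conn , C , λ D →
    Subset.⊆-antisym (balanced⇒cycle-⊆ conn cl eq C D) (balanced⇒cycle-⊆ conn cl eq D C)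

  -- A surplus edge would lie on a cycle. By uniqueness that cycle has the edges of `C`, which
  -- belong to the core and so are not surplus.
  unicyclic⇒no-surplus : ∀ {U} (cl : Closed U) ((conn , C , _) : Unicyclic U) → Spanning.surplus (cycleSpanning conn cl C) ≡ []
  unicyclic⇒no-surplus cl (conn , C , only) with Spanning.surplus (cycleSpanning conn cl C) in eq
  ... | []     = ≡.refl
  ... | z ∷ zs with Spanning.surplus-cycle (cycleSpanning conn cl C) within reach cl (≡.subst (z ∈_) (≡.sym eq) (here ≡.refl))
    where open CycleCore (cycleCore (Cycle.isCycle C))
  ... | vs , c , z∈vs = ⊥-elim (Spanning.surplus-∉ (cycleSpanning conn cl C) (≡.subst (z ∈_) (≡.sym eq) (here ≡.refl))
    (∈-++⁺ʳ (Spanning.es (cycleSpanning conn cl C)) (cycleEdges-∈⁻ C (≡.subst (z ∈ˢ_) (only (cycle vs c)) z∈vs))))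

  -- Growth from a single vertex yields one edge fewer than vertices, and any further edge would
  -- close a cycle.
  acyclic⇒unbalanced : ∀ {U} → Connected U → Closed U → ¬ Cycle U → ¬ balanced U
  acyclic⇒unbalanced {U} conn@((r , r∈) , _) cl acyclic eq = no-edge surplus ≡.refl
    where
    open Spanning (spanning-root conn cl r∈)
    no-edge : ∀ zs → zs ≡ surplus → ⊥
    no-edge (z ∷ zs) eq′ with surplus-cycle {z = z} [] (λ { (here ≡.refl) → ε }) cl (≡.subst (z ∈_) eq′ (here ≡.refl))
    ... | vs , c , _ = acyclic (cycle vs c)
    no-edge [] eq′ = ℕ.m+1+n≢m (length νs) {0} (begin
      length νs ℕ.+ 1                    ≡⟨ List.length-++ νs ⟨
      length (νs ++ r ∷ [])              ≡⟨ ↭-length vertices↭ ⟩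
      length (elements (vertexSet U))    ≡⟨ eq ⟩
      length (elements (edgeSet U))      ≡⟨ ↭-length edges↭ ⟨
      length ((es ++ []) ++ surplus)     ≡⟨ ≡.cong (λ zs → length ((es ++ []) ++ zs)) eq′ ⟨
      length ((es ++ []) ++ [])          ≡⟨ ≡.cong length (≡.trans (List.++-identityʳ (es ++ [])) (List.++-identityʳ es)) ⟩
      length es                          ≡⟨ Grown-length _ grown ⟨
      length νs                          ∎)
      where open ≡.≡-Reasoning

  -- Components

  ∈-induced⁻ : ∀ {H X e} → e ∈ˢ edgeSet (induced H X) → e ∈ˢ edgeSet H × src e ∈ˢ X × tgt e ∈ˢ X
  ∈-induced⁻ {H} {X} e∈ with Subset.x∈p∩q⁻ (edgeSet H) _ e∈
  ... | p , q = p , ∈-tabulate⁻ (λ e → src e Subset.∈? X ×-dec tgt e Subset.∈? X) q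

  ∈-induced⁺ : ∀ {H X e} → e ∈ˢ edgeSet H → src e ∈ˢ X → tgt e ∈ˢ X → e ∈ˢ edgeSet (induced H X)
  ∈-induced⁺ {H} {X} p q r = Subset.x∈p∩q⁺ (p , ∈-tabulate⁺ (λ e → src e Subset.∈? X ×-dec tgt e Subset.∈? X) (q , r))

  induced-Closed : ∀ H X → Closed (induced H X)
  induced-Closed H X e∈ = proj₂ (∈-induced⁻ {H} {X} e∈)

  component-absorbs : ∀ {H X u v} → IsComponent H X → Star (Adj H) u v → u ∈ˢ X → v ∈ˢ X
  component-absorbs comp ε u∈ = u∈
  component-absorbs comp@(_ , _ , exits) ((e , e∈ , inj₁ (≡.refl , ≡.refl)) ◅ s) u∈ = component-absorbs comp s (proj₁ (exits e e∈) u∈)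
  component-absorbs comp@(_ , _ , exits) ((e , e∈ , inj₂ (≡.refl , ≡.refl)) ◅ s) u∈ = component-absorbs comp s (proj₂ (exits e e∈) u∈)

  Adj-induced⇒Adj : ∀ {H X i j} → Adj (induced H X) i j → Adj H i j
  Adj-induced⇒Adj {H} {X} = EdgeAdj-map (λ e∈ → proj₁ (∈-induced⁻ {H} {X} e∈))

  component-unique : ∀ {H X Y v} → IsComponent H X → IsComponent H Y → v ∈ˢ X → v ∈ˢ Y → X ≡ Y
  component-unique {H} {X} {Y} cX cY vX vY = Subset.⊆-antisym (half cX cY vX vY) (half cY cX vY vX)
    where
    half : ∀ {X Y v} → IsComponent H X → IsComponent H Y → v ∈ˢ X → v ∈ˢ Y → X ⊆ˢ Y
    half {X} (_ , (_ , conn) , _) cY vX vY i∈ =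
      component-absorbs cY (Star.map (Adj-induced⇒Adj {H} {X}) (conn _ vX _ i∈)) vY

  module _ (S : Subset m) where
    private H = spanning S
    open Reachability (adj? H) using (star?)

    componentOf : V → Subset n
    componentOf v = Vec.tabulate (λ i → does (star? v i))

    ∈-componentOf⁺ : ∀ {v i} → Star (Adj H) v i → i ∈ˢ componentOf v
    ∈-componentOf⁺ {v} = ∈-tabulate⁺ (star? v)

    ∈-componentOf⁻ : ∀ {v i} → i ∈ˢ componentOf v → Star (Adj H) v i
    ∈-componentOf⁻ {v} = ∈-tabulate⁻ (star? v)

    componentOf-isComponent : ∀ v → IsComponent H (componentOf v)
    componentOf-isComponent v = (λ _ → Subset.∈⊤) , ((v , ∈-componentOf⁺ ε) , conn) , exits
      where
      Xᵥ = componentOf v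
      exits : ∀ e → e ∈ˢ S → (src e ∈ˢ Xᵥ → tgt e ∈ˢ Xᵥ) × (tgt e ∈ˢ Xᵥ → src e ∈ˢ Xᵥ)
      exits e e∈ =
        (λ p → ∈-componentOf⁺ (∈-componentOf⁻ p ◅◅ (e , e∈ , Joins-src-tgt e) ◅ ε)) ,
        (λ p → ∈-componentOf⁺ (∈-componentOf⁻ p ◅◅ (e , e∈ , Joins-sym (Joins-src-tgt e)) ◅ ε))
      -- A walk in `H` becomes a walk in the induced subgraph once it is known at each step that it
      -- has not left `Xᵥ`.
      stay : ∀ {i j} → i ∈ˢ Xᵥ → Star (Adj H) i j → Star (Adj (induced H Xᵥ)) i j
      stay i∈ ε = ε
      stay i∈ ((e , e∈ , j@(inj₁ (≡.refl , ≡.refl))) ◅ s) =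
        (e , ∈-induced⁺ {H} {Xᵥ} e∈ i∈ (proj₁ (exits e e∈) i∈) , j) ◅ stay (proj₁ (exits e e∈) i∈) s
      stay i∈ ((e , e∈ , j@(inj₂ (≡.refl , ≡.refl))) ◅ s) =
        (e , ∈-induced⁺ {H} {Xᵥ} e∈ (proj₂ (exits e e∈) i∈) i∈ , j) ◅ stay (proj₂ (exits e e∈) i∈) s
      conn : ∀ i → i ∈ˢ Xᵥ → ∀ j → j ∈ˢ Xᵥ → Star (Adj (induced H Xᵥ)) i j
      conn i i∈ j j∈ = stay i∈ (Star.reverse EdgeAdj-sym (∈-componentOf⁻ i∈) ◅◅ ∈-componentOf⁻ j∈)

    componentSets : List (Subset n)
    componentSets = filter (isComponent? H) (allSubsets n)

    inducedEdges : Subset n → List E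
    inducedEdges X = elements (edgeSet (induced H X))

    private
      apart : ∀ {X Xs} → IsComponent H X → All (IsComponent H) Xs → All (X ≢_) Xs →
        ∀ {v Y} → v ∈ˢ X → Y ∈ Xs → ¬ (v ∈ˢ Y)
      apart cX cXs X≢ vX Y∈ vY = All.lookup X≢ Y∈ (component-unique cX (All.lookup cXs Y∈) vX vY)

    vertices-Unique : ∀ {Xs} → All (IsComponent H) Xs → Unique Xs → Unique (concatMap elements Xs)
    vertices-Unique []         []       = []
    vertices-Unique {X ∷ Xs} (c ∷ cs) (X≢ ∷ u) = Unique.++⁺ (elements-Unique X) (vertices-Unique cs u) disjoint
      where
      disjoint : ∀ {v} → ¬ (v ∈ elements X × v ∈ concatMap elements Xs)
      disjoint (p , q) with ∈-concatMap⁻ elements Xs q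
      ... | Y , Y∈ , r = apart c cs X≢ (∈-elements⁻ p) Y∈ (∈-elements⁻ r)

    edges-Unique : ∀ {Xs} → All (IsComponent H) Xs → Unique Xs → Unique (concatMap inducedEdges Xs)
    edges-Unique []         []       = []
    edges-Unique {X ∷ Xs} (c ∷ cs) (X≢ ∷ u) = Unique.++⁺ (elements-Unique _) (edges-Unique cs u) disjoint
      where
      disjoint : ∀ {e} → ¬ (e ∈ inducedEdges X × e ∈ concatMap inducedEdges Xs)
      disjoint (p , q) with ∈-concatMap⁻ inducedEdges Xs q
      ... | Y , Y∈ , r = apart c cs X≢ (proj₁ (induced-Closed H X (∈-elements⁻ p))) Y∈ (proj₁ (induced-Closed H Y (∈-elements⁻ r)))

    componentSets-components : All (IsComponent H) componentSets
    componentSets-components = All.all-filter (isComponent? H) (allSubsets n)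

    componentSets-Unique : Unique componentSets
    componentSets-Unique = Unique.filter⁺ (isComponent? H) (allSubsets-Unique n)

    componentOf-∈ : ∀ v → componentOf v ∈ componentSets
    componentOf-∈ v = ∈-filter⁺ (isComponent? H) (∈-allSubsets _) (componentOf-isComponent v)

    vertices-partition : concatMap elements componentSets ↭ allFin n
    vertices-partition = ⊆⊇⇒↭ (vertices-Unique componentSets-components componentSets-Unique) (Unique.allFin⁺ n)
      (λ _ → ∈-allFin _)
      (λ {v} _ → ∈-concatMap⁺ elements (componentOf-∈ v) (∈-elements⁺ (∈-componentOf⁺ ε)))

    edges-partition : concatMap inducedEdges componentSets ↭ elements S
    edges-partition = ⊆⊇⇒↭ (edges-Unique componentSets-components componentSets-Unique) (elements-Unique S) to from
      where
      to : ∀ {e} → e ∈ concatMap inducedEdges componentSets → e ∈ elements S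
      to e∈ with ∈-concatMap⁻ inducedEdges componentSets e∈
      ... | X , _ , p = ∈-elements⁺ (proj₁ (∈-induced⁻ {H} {X} (∈-elements⁻ p)))
      from : ∀ {e} → e ∈ elements S → e ∈ concatMap inducedEdges componentSets
      from {e} e∈ = ∈-concatMap⁺ inducedEdges (componentOf-∈ (src e)) (∈-elements⁺
        (∈-induced⁺ {H} {componentOf (src e)} (∈-elements⁻ e∈) (∈-componentOf⁺ ε)
          (∈-componentOf⁺ ((e , ∈-elements⁻ e∈ , Joins-src-tgt e) ◅ ε))))

-- Finite products and sums, and sums over edge sets

module Products {c ℓ₁ ℓ₂} (ℝ : RealField c ℓ₁ ℓ₂) where
  open RealField ℝ hiding (zero)
  open ComplexNumbers ℝ
  open RealFacts ℝ
  open IntegerSolver commutativeRing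

  module _ {A : Set} where

    ∏-↭ : ∀ {xs ys} (f : A → Carrier) → xs ↭ ys → ∏ xs f ≈ ∏ ys f
    ∏-↭ f ↭.refl        = refl
    ∏-↭ f (prep x p)    = *-congˡ (∏-↭ f p)
    ∏-↭ f (swap x y p)  = trans (*-congˡ (*-congˡ (∏-↭ f p)))
      (solve 3 (λ a b c → a :* (b :* c) := b :* (a :* c)) refl (f x) (f y) _)
    ∏-↭ f (↭.trans p q) = trans (∏-↭ f p) (∏-↭ f q)

    ∏-nonNeg : ∀ xs {f : A → Carrier} → (∀ x → 0# ≤ f x) → 0# ≤ ∏ xs f
    ∏-nonNeg []       nn = 0≤1
    ∏-nonNeg (x ∷ xs) nn = *-nonNeg (nn x) (∏-nonNeg xs nn)

    ∏-≉0 : ∀ xs {f : A → Carrier} → (∀ x → f x ≉ 0#) → ∏ xs f ≉ 0#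
    ∏-≉0 []       nz = λ e → 0≉1 (sym e)
    ∏-≉0 (x ∷ xs) nz = nonZero-* (nz x) (∏-≉0 xs nz)

module Sums {c ℓ₁ ℓ₂} (ℝ : RealField c ℓ₁ ℓ₂) where
  open RealField ℝ hiding (zero)
  open ComplexNumbers ℝ
  open IntegerSolver commutativeRing
  open RawMonoidOps +-rawMonoid using () renaming (_×_ to _·_)

  ∑-cong : ∀ {a} {A : Set a} xs {f g : A → Carrier} → (∀ x → f x ≈ g x) → ∑ xs f ≈ ∑ xs g
  ∑-cong []       eq = refl
  ∑-cong (x ∷ xs) eq = +-cong (eq x) (∑-cong xs eq)

  ∑-++ : ∀ {a} {A : Set a} xs ys (f : A → Carrier) → ∑ (xs ++ ys) f ≈ ∑ xs f + ∑ ys f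
  ∑-++ []       ys f = sym (+-identityˡ _)
  ∑-++ (x ∷ xs) ys f = trans (+-congˡ (∑-++ xs ys f)) (sym (+-assoc _ _ _))

  ∑-map : ∀ {a b} {A : Set a} {B : Set b} (h : A → B) xs (f : B → Carrier) → ∑ (map h xs) f ≈ ∑ xs (f ∘ h)
  ∑-map h []       f = refl
  ∑-map h (x ∷ xs) f = +-congˡ (∑-map h xs f)

  ∑-zero : ∀ {a} {A : Set a} xs {f : A → Carrier} → (∀ x → f x ≈ 0#) → ∑ xs f ≈ 0#
  ∑-zero []       z = refl
  ∑-zero (x ∷ xs) z = trans (+-cong (z x) (∑-zero xs z)) (+-identityˡ 0#)

  ∑-const : ∀ {a} {A : Set a} {f : A → Carrier} {y xs} → All (λ x → f x ≈ y) xs → ∑ xs f ≈ length xs · y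
  ∑-const []       = refl
  ∑-const (e ∷ es) = +-cong e (∑-const es)

  ∑-filter-map : ∀ {a b p} {A : Set a} {B : Set b} (h : B → A) {P : Pred A p} (P? : Decidable₁ P)
    {f : B → Carrier} {g : A → Carrier} →
    (∀ x → P (h x) → f x ≈ g (h x)) → (∀ x → ¬ P (h x) → f x ≈ 0#) → ∀ xs → ∑ xs f ≈ ∑ (filter P? (map h xs)) g
  ∑-filter-map h P? eq z [] = refl
  ∑-filter-map h P? eq z (x ∷ xs) with P? (h x)
  ... | yes p = +-cong (eq x p) (∑-filter-map h P? eq z xs)
  ... | no ¬p = trans (+-cong (z x ¬p) (∑-filter-map h P? eq z xs)) (+-identityˡ _)

  -- The summand depends on the proof of `P`, since `unicyclicTerm` reads the cycles off that proof.
  -- Hence the hypothesis covers every proof p, whichever one the decision returns.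
  ∑-mapMaybe-map : ∀ {a b p} {A : Set a} {B : Set b} (h : B → A) {P : Pred A p} (P? : Decidable₁ P)
    {f : B → Carrier} {g : Σ A P → Carrier} →
    (∀ x p → f x ≈ g (h x , p)) → (∀ x → ¬ P (h x) → f x ≈ 0#) → ∀ xs →
    ∑ xs f ≈ ∑ (mapMaybe (λ x → Maybe.map (x ,_) (dec⇒maybe (P? x))) (map h xs)) g
  ∑-mapMaybe-map h P? eq z [] = refl
  ∑-mapMaybe-map h P? eq z (x ∷ xs) with P? (h x)
  ... | yes p = +-cong (eq x p) (∑-mapMaybe-map h P? eq z xs)
  ... | no ¬p = trans (+-cong (z x ¬p) (∑-mapMaybe-map h P? eq z xs)) (+-identityˡ _)

  elements-∷ : ∀ {n} b (S : Subset n) → filter (Subset._∈? (b ∷ S)) (List.tabulate suc) ≡ map suc (elements S)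
  elements-∷ {n} b S = ≡.trans (≡.cong (filter (Subset._∈? (b ∷ S))) (≡.sym (List.map-tabulate id suc))) (go (allFin n))
    where
    go : ∀ xs → filter (Subset._∈? (b ∷ S)) (map suc xs) ≡ map suc (filter (Subset._∈? S) xs)
    go []       = ≡.refl
    go (x ∷ xs) with x Subset.∈? S
    ... | yes _ = ≡.cong (suc x ∷_) (go xs)
    ... | no  _ = go xs

  -- Increasing sequences of length r are the element lists of r-subsets. Vanishing at other
  -- lengths, which `d` has by construction, lets the sum range over all subsets.
  ∑-choose : ∀ n r (f : List (Fin n) → Carrier) → (∀ xs → length xs ≢ r → f xs ≈ 0#) →
    ∑ (choose n r) (f ∘ Vec.toList) ≈ ∑ (allSubsets n) (f ∘ elements)
  ∑-choose zero    zero    f z = refl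
  ∑-choose zero    (suc r) f z = sym (trans (+-identityʳ _) (z [] λ ()))
  ∑-choose (suc n) zero    f z = begin
    f [] + 0#                                      ≈⟨ ∑-choose n zero (f ∘ map suc) (λ { [] ≢0 → contradiction ≡.refl ≢0 ; (x ∷ xs) ≢0 → z _ λ () }) ⟩
    ∑ (allSubsets n) (f ∘ map suc ∘ elements)       ≈⟨ +-identityˡ _ ⟨
    0# + ∑ (allSubsets n) (f ∘ map suc ∘ elements)  ≈⟨ +-cong (sym (∑-zero (allSubsets n) λ S → z _ λ ())) (∑-cong (allSubsets n) λ S → reflexive (≡.cong f (≡.sym (elements-∷ outside S)))) ⟩
    ∑ (allSubsets n) (f ∘ elements ∘ (inside ∷_)) + ∑ (allSubsets n) (f ∘ elements ∘ (outside ∷_))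
                                                   ≈⟨ +-cong (∑-map (inside ∷_) (allSubsets n) (f ∘ elements)) (∑-map (outside ∷_) (allSubsets n) (f ∘ elements)) ⟨
    ∑ (map (inside ∷_) (allSubsets n)) (f ∘ elements) + ∑ (map (outside ∷_) (allSubsets n)) (f ∘ elements)
                                                   ≈⟨ ∑-++ (map (inside ∷_) (allSubsets n)) _ (f ∘ elements) ⟨
    ∑ (allSubsets (suc n)) (f ∘ elements)          ∎
    where open import Relation.Binary.Reasoning.Setoid setoid
  ∑-choose (suc n) (suc r) f z = begin
    ∑ (map (λ v → zero ∷ Vec.map suc v) (choose n r) ++ map (Vec.map suc) (choose n (suc r))) (f ∘ Vec.toList)
      ≈⟨ ∑-++ (map (λ v → zero ∷ Vec.map suc v) (choose n r)) _ (f ∘ Vec.toList) ⟩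
    ∑ (map (λ v → zero ∷ Vec.map suc v) (choose n r)) (f ∘ Vec.toList) + ∑ (map (Vec.map suc) (choose n (suc r))) (f ∘ Vec.toList)
      ≈⟨ +-cong (∑-map (λ v → zero ∷ Vec.map suc v) (choose n r) (f ∘ Vec.toList)) (∑-map (Vec.map suc) (choose n (suc r)) (f ∘ Vec.toList)) ⟩
    ∑ (choose n r) (λ v → f (zero ∷ Vec.toList (Vec.map suc v))) + ∑ (choose n (suc r)) (λ v → f (Vec.toList (Vec.map suc v)))
      ≈⟨ +-cong (∑-cong (choose n r) λ v → reflexive (≡.cong (f ∘ (zero ∷_)) (Vec.toList-map suc v)))
                (∑-cong (choose n (suc r)) λ v → reflexive (≡.cong f (Vec.toList-map suc v))) ⟩
    ∑ (choose n r) (λ v → f (zero ∷ map suc (Vec.toList v))) + ∑ (choose n (suc r)) (λ v → f (map suc (Vec.toList v)))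
      ≈⟨ +-cong (∑-choose n r (f ∘ (zero ∷_) ∘ map suc) (λ xs ≢r → z _ (≢r ∘ ≡.trans (≡.sym (List.length-map suc xs)) ∘ ℕ.suc-injective)))
                (∑-choose n (suc r) (f ∘ map suc) (λ xs ≢r → z _ (≢r ∘ ≡.trans (≡.sym (List.length-map suc xs))))) ⟩
    ∑ (allSubsets n) (f ∘ (zero ∷_) ∘ map suc ∘ elements) + ∑ (allSubsets n) (f ∘ map suc ∘ elements)
      ≈⟨ +-cong (∑-cong (allSubsets n) λ S → reflexive (≡.cong (f ∘ (zero ∷_)) (≡.sym (elements-∷ inside S))))
                (∑-cong (allSubsets n) λ S → reflexive (≡.cong f (≡.sym (elements-∷ outside S)))) ⟩
    ∑ (allSubsets n) (f ∘ elements ∘ (inside ∷_)) + ∑ (allSubsets n) (f ∘ elements ∘ (outside ∷_))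
      ≈⟨ +-cong (∑-map (inside ∷_) (allSubsets n) (f ∘ elements)) (∑-map (outside ∷_) (allSubsets n) (f ∘ elements)) ⟨
    ∑ (map (inside ∷_) (allSubsets n)) (f ∘ elements) + ∑ (map (outside ∷_) (allSubsets n)) (f ∘ elements)
      ≈⟨ ∑-++ (map (inside ∷_) (allSubsets n)) _ (f ∘ elements) ⟨
    ∑ (allSubsets (suc n)) (f ∘ elements)  ∎
    where open import Relation.Binary.Reasoning.Setoid setoid

-- Entries of N, and determinants of leaves and cycles

module IncidenceDet {c ℓ₁ ℓ₂} (ℝ : RealField c ℓ₁ ℓ₂) {n m} (G : OrientedGraph n m)
  (w : Fin m → ComplexNumbers.ℂ ℝ)
  (w≉0 : ∀ e → ¬ ComplexNumbers._≈ᶜ_ ℝ (w e) (ComplexNumbers.0ᶜ ℝ))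
  (w∉ℝ⁻ : ∀ e → ¬ ComplexNumbers.ℝ⁻ ℝ (w e)) where
  open RealField ℝ hiding (zero)
  open ComplexNumbers ℝ
  open RealFacts ℝ
  open ComplexFacts ℝ
  open Products ℝ
  open OrientedGraph G
  open Graphs G hiding (V; E)
  open GraphFacts G
  open SpanningFacts G
  open WeightedGraphs ℝ G w using (N; a; walkWeight; wt; W; α)
  open Laplace ℂ-commutativeRing using (laplace)
  open Laplace.ListDet ℂ-commutativeRing N public
  private
    module R = IntegerSolver commutativeRing
    module C = IntegerSolver ℂ-commutativeRing

  ∣w∣ : E → Carrier
  ∣w∣ e = ∣ w e ∣

  N-src : ∀ e → N (src e) e ≡ √ᶜ (w e)
  N-src e with src e ≟ src e
  ... | yes _ = ≡.refl
  ... | no ¬p = contradiction ≡.refl ¬p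

  N-tgt : ∀ e → N (tgt e) e ≈ᶜ conj (√ᶜ (w e))
  N-tgt e with tgt e ≟ src e | tgt e ≟ tgt e
  ... | yes p | _     = contradiction (≡.sym p) (loopless e)
  ... | no _  | yes _ = √ᶜ-conj (w e) (w∉ℝ⁻ e)
  ... | no _  | no ¬p = contradiction ≡.refl ¬p

  N-vanish : ∀ {v e} → v ≢ src e → v ≢ tgt e → N v e ≈ᶜ 0ᶜ
  N-vanish {v} {e} p q with v ≟ src e | v ≟ tgt e
  ... | yes r | _     = contradiction r p
  ... | no _  | yes r = contradiction r q
  ... | no _  | no _  = reflᶜ

  N-outside : ∀ {ρ v e} → v ∉ ρ → Inside ρ e → N v e ≈ᶜ 0ᶜ
  N-outside {v = v} {e} v∉ (p , q) = N-vanish {v} {e} (λ { ≡.refl → v∉ p }) (λ { ≡.refl → v∉ q })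

  N-away : ∀ {e u v x} → Joins e u v → x ≢ u → x ≢ v → N x e ≈ᶜ 0ᶜ
  N-away (inj₁ (≡.refl , ≡.refl)) p q = N-vanish p q
  N-away (inj₂ (≡.refl , ≡.refl)) p q = N-vanish q p

  ∣N∣² : ∀ {e u v} → Joins e u v → ∣ N u e ∣² ≈ ∣w∣ e
  ∣N∣² {e} (inj₁ (≡.refl , _)) = trans (reflexive (≡.cong ∣_∣² (N-src e))) (PrincipalRoot.∣√ᶜ∣² (w e))
  ∣N∣² {e} (inj₂ (_ , ≡.refl)) = trans (∣∣²-cong {N (tgt e) e} {conj (√ᶜ (w e))} (N-tgt e)) (trans (∣∣²-conj (√ᶜ (w e))) (PrincipalRoot.∣√ᶜ∣² (w e)))

  N≉0 : ∀ {e u v} → Joins e u v → ¬ (N u e ≈ᶜ 0ᶜ)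
  N≉0 {e} j eq = ∣∣≉0 (w≉0 e) (trans (sym (∣N∣² j)) (≈0⇒∣∣²≈0 eq))

  -- Along e the product is √w · √w = w, and against it conj(√w) · conj(√w) = conj(w). By simplicity
  -- the edge that the search in `a` finds is e itself.
  N*conjN : ∀ {e u v} → Joins e u v → a u v ≈ᶜ N u e *ᶜ conj (N v e)
  N*conjN {e} {u} {v} j@(inj₁ (≡.refl , ≡.refl)) = transᶜ a≈ (symᶜ (transᶜ
    (*ᶜ-cong (reflexiveᶜ (N-src e)) (transᶜ (conj-cong {N (tgt e) e} {conj (√ᶜ (w e))} (N-tgt e)) (conj-conj (√ᶜ (w e))))) (PrincipalRoot.√ᶜ-square (w e))))
    where
    a≈ : a u v ≈ᶜ w e
    a≈ with any? (λ e → hasDirection? e u v) | any? (λ e → hasDirection? e v u)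
    ... | yes (f , h) | _ with Joins-unique {f} (inj₁ h) j
    ...   | ≡.refl = reflᶜ
    a≈ | no ¬h | _ = contradiction (e , ≡.refl , ≡.refl) ¬h
  N*conjN {e} {u} {v} j@(inj₂ (≡.refl , ≡.refl)) = transᶜ a≈ (symᶜ (transᶜ
    (*ᶜ-cong (N-tgt e) (conj-cong (reflexiveᶜ (N-src e)))) (transᶜ (symᶜ (conj-* (√ᶜ (w e)) (√ᶜ (w e)))) (conj-cong (PrincipalRoot.√ᶜ-square (w e))))))
    where
    a≈ : a u v ≈ᶜ conj (w e)
    a≈ with any? (λ e → hasDirection? e u v) | any? (λ e → hasDirection? e v u)
    ... | yes (f , h) | _ with Joins-unique {f} (inj₁ h) j
    ...   | ≡.refl = contradiction (proj₁ h) (loopless e)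
    a≈ | no _ | yes (f , h) with Joins-unique {f} (inj₂ h) j
    ...   | ≡.refl = reflᶜ
    a≈ | no _ | no ¬h = contradiction (e , ≡.refl , ≡.refl) ¬h

  ∣d∣²-↭ : ∀ {ρ ρ′ κ κ′} → ρ ↭ ρ′ → κ ↭ κ′ → ∣ d ρ κ ∣² ≈ ∣ d ρ′ κ′ ∣²
  ∣d∣²-↭ p q with d-↭ p q
  ... | inj₁ e = ∣∣²-cong e
  ... | inj₂ e = trans (∣∣²-cong e) (∣∣²-neg _)

  -- The remaining rows ρ are independent of the core ρ₀: for a cycle they coincide, whereas for a
  -- minor omitting row k the core is k and ρ is empty.
  ∣d∣²-Grown : ∀ {ρ₀ κ₀ νs es} → Grown ρ₀ νs es → All (Inside ρ₀) κ₀ → ∀ ρ →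
    ∣ d (νs ++ ρ) (es ++ κ₀) ∣² ≈ ∏ es ∣w∣ * ∣ d ρ κ₀ ∣²
  ∣d∣²-Grown [] ins ρ = sym (*-identityˡ _)
  ∣d∣²-Grown {ρ₀} {κ₀} {v ∷ νs} {e ∷ es} (leaf g v∉ _ j) ins ρ = begin
    ∣ d (v ∷ νs ++ ρ) (e ∷ es ++ κ₀) ∣²       ≈⟨ ∣∣²-cong (d-leaf-row {v} {νs ++ ρ} (All.map (N-outside v∉) (Grown-Inside ρ₀ g ins))) ⟩
    ∣ N v e *ᶜ d (νs ++ ρ) (es ++ κ₀) ∣²      ≈⟨ ∣∣²-* _ _ ⟩
    ∣ N v e ∣² * ∣ d (νs ++ ρ) (es ++ κ₀) ∣²  ≈⟨ *-cong (∣N∣² j) (∣d∣²-Grown g ins ρ) ⟩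
    ∣w∣ e * (∏ es ∣w∣ * ∣ d ρ κ₀ ∣²)          ≈⟨ *-assoc _ _ _ ⟨
    ∏ (e ∷ es) ∣w∣ * ∣ d ρ κ₀ ∣²              ∎
    where open import Relation.Binary.Reasoning.Setoid setoid

  ∣W∣ : ∀ S → ∣ W S ∣ ≈ ∏ (elements S) ∣w∣
  ∣W∣ S = go (elements S)
    where
    go : ∀ es → ∣ List.foldr (λ e z → w e *ᶜ z) 1ᶜ es ∣ ≈ ∏ es ∣w∣
    go []       = ∣1∣≈1
    go (e ∷ es) = trans (∣∣-* (w e) _) (*-congˡ (go es))

  -- The products A and B: each edge is taken at the vertex where the trail leaves, respectively
  -- where it arrives.
  starts ends : ∀ {vs es} → Trail vs es → ℂ
  starts [-]                  = 1ᶜ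
  starts (_∷_ {v} {e = e} _ t) = N v e *ᶜ starts t
  ends [-]                          = 1ᶜ
  ends (_∷_ {u = u} {e = e} _ t)    = N u e *ᶜ ends t

  ∣starts∣² : ∀ {vs es} (t : Trail vs es) → ∣ starts t ∣² ≈ ∏ es ∣w∣
  ∣starts∣² [-]     = ∣1∣²≈1
  ∣starts∣² (j ∷ t) = trans (∣∣²-* _ _) (*-cong (∣N∣² j) (∣starts∣² t))

  ∣ends∣² : ∀ {vs es} (t : Trail vs es) → ∣ ends t ∣² ≈ ∏ es ∣w∣
  ∣ends∣² [-]     = ∣1∣²≈1
  ∣ends∣² (j ∷ t) = trans (∣∣²-* _ _) (*-cong (∣N∣² (Joins-sym j)) (∣ends∣² t))

  walkWeight-Trail : ∀ {vs es} (t : Trail vs es) → walkWeight vs ≈ᶜ starts t *ᶜ conj (ends t)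
  walkWeight-Trail [-] = R.solve 0 (R.:1 R.:= R.:1 R.:* R.:1 R.:- R.:0 R.:* (R.:- R.:0)) refl ,
    R.solve 0 (R.:0 R.:= R.:1 R.:* (R.:- R.:0) R.:+ R.:0 R.:* R.:1) refl
  walkWeight-Trail (_∷_ {v} {u} {vs} {e} j t) = begin
    a v u *ᶜ walkWeight (u ∷ vs)                                       ≈⟨ *ᶜ-cong (N*conjN j) (walkWeight-Trail t) ⟩
    (N v e *ᶜ conj (N u e)) *ᶜ (starts t *ᶜ conj (ends t))             ≈⟨ C.solve 4 (λ p q r s → (p C.:* q) C.:* (r C.:* s) C.:= (p C.:* r) C.:* (q C.:* s)) reflᶜ (N v e) (conj (N u e)) (starts t) (conj (ends t)) ⟩
    (N v e *ᶜ starts t) *ᶜ (conj (N u e) *ᶜ conj (ends t))             ≈⟨ *ᶜ-cong reflᶜ (conj-* (N u e) (ends t)) ⟨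
    starts (j ∷ t) *ᶜ conj (ends (j ∷ t))                              ∎
    where open import Relation.Binary.Reasoning.Setoid ℂ-setoid

  -- Without the last vertex of a path the matrix is triangular, as each row vanishes on all edges
  -- after the one leaving its vertex. This is the minor of a cycle left after deleting a vertex v
  -- and the edge leaving it.
  d-starts : ∀ ρ {z κ} (t : Trail (ρ ∷ʳ z) κ) → Unique (ρ ∷ʳ z) → d ρ κ ≈ᶜ starts t
  d-starts []          [-]     uu = reflᶜ
  d-starts (v ∷ [])    (j ∷ t) uu@(_ ∷ uu′) = transᶜ
    (d-leaf-row {v} {[]} (All.map (N-outside (Unique-head∉ uu)) (Trail-Inside t))) (*ᶜ-cong reflᶜ (d-starts [] t uu′))
  d-starts (v ∷ u ∷ ρ) (j ∷ t) uu@(_ ∷ uu′) = transᶜ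
    (d-leaf-row {v} {u ∷ ρ} (All.map (N-outside (Unique-head∉ uu)) (Trail-Inside t))) (*ᶜ-cong reflᶜ (d-starts (u ∷ ρ) t uu′))

  -- Dual to `d-starts`: without the first vertex, the column of each edge vanishes on all vertices
  -- after the one it enters. For a cycle, this is the minor left after deleting v and the edge
  -- entering it.
  d-ends : ∀ {u ρ κ} (t : Trail (u ∷ ρ) κ) → Unique (u ∷ ρ) → d ρ κ ≈ᶜ ends t
  d-ends [-] uu = reflᶜ
  d-ends {u} {v ∷ ρ} (_∷_ {e = e} {κ} j t) uu@(_ ∷ uu′) = transᶜ
    (d-leaf-column {v} {ρ} {e} {κ} (All.tabulate (λ {x} x∈ → N-away {x = x} j (λ { ≡.refl → Unique-head∉ uu (there x∈) }) (λ { ≡.refl → Unique-head∉ uu′ x∈ }))))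
    (*ᶜ-cong reflᶜ (d-ends t uu′))

  sgn : ℕ → ℂ
  sgn zero    = 1ᶜ
  sgn (suc k) = -ᶜ sgn k

  laplace-last : ∀ {f : E → ℂ} F xs {y} → All (λ x → f x ≈ᶜ 0ᶜ) xs →
    laplace f F (xs ∷ʳ y) ≈ᶜ sgn (length xs) *ᶜ (f y *ᶜ F xs)
  laplace-last {f} F [] {y} [] = C.solve 1 (λ p → p C.:- C.:0 C.:= C.:1 C.:* p) reflᶜ (f y *ᶜ F [])
  laplace-last {f} F (x ∷ xs) {y} (z ∷ zs) = begin
    (f x *ᶜ F (xs ∷ʳ y)) +ᶜ (-ᶜ laplace f (F ∘ (x ∷_)) (xs ∷ʳ y))
      ≈⟨ +ᶜ-cong (*ᶜ-cong z reflᶜ) (-ᶜ-cong (laplace-last (F ∘ (x ∷_)) xs zs)) ⟩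
    (0ᶜ *ᶜ F (xs ∷ʳ y)) +ᶜ (-ᶜ (sgn (length xs) *ᶜ (f y *ᶜ F (x ∷ xs))))
      ≈⟨ C.solve 3 (λ p s q → C.:0 C.:* p C.:+ (C.:- (s C.:* q)) C.:= (C.:- s) C.:* q) reflᶜ (F (xs ∷ʳ y)) (sgn (length xs)) (f y *ᶜ F (x ∷ xs)) ⟩
    sgn (length (x ∷ xs)) *ᶜ (f y *ᶜ F (x ∷ xs))  ∎
    where open import Relation.Binary.Reasoning.Setoid ℂ-setoid

  Trail-last : ∀ u ρ {v κ} (t : Trail (u ∷ ρ ∷ʳ v) κ) →
    ∃₂ λ κ′ e → Σ (Trail (u ∷ ρ) κ′) λ t′ → κ ≡ κ′ ∷ʳ e × ends t ≈ᶜ ends t′ *ᶜ N v e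
  Trail-last u []       (_∷_ {e = e} j [-]) = [] , e , [-] , ≡.refl , *ᶜ-comm _ _
  Trail-last u (x ∷ ρ) {v} (_∷_ {e = f} j t) with Trail-last x ρ t
  ... | κ′ , e , t′ , ≡.refl , eq = f ∷ κ′ , e , j ∷ t′ , ≡.refl ,
    transᶜ (*ᶜ-cong reflᶜ eq) (symᶜ (*ᶜ-assoc (N x f) (ends t′) (N v e)))

  -- Only two bijections between vertices and edges of the cycle contribute:
  -- each vertex with the edge leaving it, or with the edge entering it.
  d-cycle : ∀ {vs κ} → 3 ℕ.≤ length vs → Unique vs → (t : Trail (closeUp vs) κ) →
    d vs κ ≈ᶜ starts t +ᶜ (-ᶜ (sgn (length vs) *ᶜ ends t))
  d-cycle {v ∷ []} (s≤s ())
  d-cycle {v ∷ u ∷ ρ} 3≤ uu@(_ ∷ uu′) (_∷_ {e = e₀} j t) with Trail-last u ρ t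
  ... | κ′ , e , t′ , ≡.refl , eq = begin
    (N v e₀ *ᶜ d (u ∷ ρ) (κ′ ∷ʳ e)) +ᶜ (-ᶜ laplace (N v) (d (u ∷ ρ) ∘ (e₀ ∷_)) (κ′ ∷ʳ e))
      ≈⟨ +ᶜ-cong (*ᶜ-cong reflᶜ (d-starts (u ∷ ρ) t (Unique-resp-↭ (∷↭∷ʳ v (u ∷ ρ)) uu)))
           (-ᶜ-cong (laplace-last (d (u ∷ ρ) ∘ (e₀ ∷_)) κ′ (All.map (N-outside (Unique-head∉ uu)) (Trail-Inside t′)))) ⟩
    starts (j ∷ t) +ᶜ (-ᶜ (sgn (length κ′) *ᶜ (N v e *ᶜ d (u ∷ ρ) (e₀ ∷ κ′))))
      ≈⟨ +ᶜ-cong reflᶜ (-ᶜ-cong (*ᶜ-cong reflᶜ (*ᶜ-cong reflᶜ (d-ends (j ∷ t′) uu)))) ⟩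
    starts (j ∷ t) +ᶜ (-ᶜ (sgn (length κ′) *ᶜ (N v e *ᶜ (N u e₀ *ᶜ ends t′))))
      ≈⟨ +ᶜ-cong reflᶜ (-ᶜ-cong (C.solve 4 (λ s p q r → s C.:* (p C.:* (q C.:* r)) C.:= (C.:- (C.:- s)) C.:* (q C.:* (r C.:* p))) reflᶜ (sgn (length κ′)) (N v e) (N u e₀) (ends t′))) ⟩
    starts (j ∷ t) +ᶜ (-ᶜ (sgn (suc (suc (length κ′))) *ᶜ (N u e₀ *ᶜ (ends t′ *ᶜ N v e))))
      ≈⟨ +ᶜ-cong reflᶜ (-ᶜ-cong (*ᶜ-cong (reflexiveᶜ (≡.cong (sgn ∘ suc) (≡.sym (Trail-length t′)))) (*ᶜ-cong reflᶜ (symᶜ eq)))) ⟩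
    starts (j ∷ t) +ᶜ (-ᶜ (sgn (length (v ∷ u ∷ ρ)) *ᶜ ends (j ∷ t)))  ∎
    where open import Relation.Binary.Reasoning.Setoid ℂ-setoid

  sgn-even : ∀ k → 2 ∣ k → sgn k ≈ᶜ 1ᶜ
  sgn-even zero          _ = reflᶜ
  sgn-even (suc zero)    p = contradiction (∣⇒≤ p) λ { (s≤s ()) }
  sgn-even (suc (suc k)) p = transᶜ (C.solve 1 (λ s → C.:- (C.:- s) C.:= s) reflᶜ (sgn k)) (sgn-even k (∣m+n∣m⇒∣n p ∣-refl))

  sgn-odd : ∀ k → ¬ 2 ∣ k → sgn k ≈ᶜ -ᶜ 1ᶜ
  sgn-odd zero          ¬p = contradiction (2 ∣0) ¬p
  sgn-odd (suc zero)    ¬p = reflᶜ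
  sgn-odd (suc (suc k)) ¬p = transᶜ (C.solve 1 (λ s → C.:- (C.:- s) C.:= s) reflᶜ (sgn k)) (sgn-odd k (¬p ∘ ∣m∣n⇒∣m+n ∣-refl))

  sgn² : ∀ k → sgn k *ᶜ sgn k ≈ᶜ 1ᶜ
  sgn² zero    = *ᶜ-identityˡ 1ᶜ
  sgn² (suc k) = transᶜ (C.solve 1 (λ s → (C.:- s) C.:* (C.:- s) C.:= s C.:* s) reflᶜ (sgn k)) (sgn² k)

  module _ {H} (C : Cycle H) where
    open CycleCore (cycleCore (Cycle.isCycle C)) using (κ; trail)
    private
      vs = Cycle.vertices C
      A  = starts trail
      B  = ends trail
      p  = ∏ κ ∣w∣

    wt≈ : wt C ≈ᶜ A *ᶜ conj B
    wt≈ = walkWeight-Trail trail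

    ∣wt∣ : ∣ wt C ∣ ≈ p
    ∣wt∣ = ∣∣-unique (∏-nonNeg κ (∣∣-nonNeg ∘ w)) (sym (begin
      ∣ wt C ∣²                 ≈⟨ ∣∣²-cong wt≈ ⟩
      ∣ A *ᶜ conj B ∣²          ≈⟨ ∣∣²-* A (conj B) ⟩
      ∣ A ∣² * ∣ conj B ∣²      ≈⟨ *-congˡ (∣∣²-conj B) ⟩
      ∣ A ∣² * ∣ B ∣²           ≈⟨ *-cong (∣starts∣² trail) (∣ends∣² trail) ⟩
      p * p                     ∎))
      where open import Relation.Binary.Reasoning.Setoid setoid

    -- The determinant is A - B for even and A + B for odd length, so the cross term - 2 Re(A · conj
    -- B) or + 2 Re(A · conj B) agrees with the case distinction in α.
    ∣d∣²-cycle : ∣ d vs κ ∣² ≈ 2# * α C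
    ∣d∣²-cycle = trans (∣∣²-cong (d-cycle (proj₁ (Cycle.isCycle C)) (proj₁ (proj₂ (Cycle.isCycle C))) trail)) (by-parity (2 ∣? length vs))
      where
      open import Relation.Binary.Reasoning.Setoid setoid
      expand : ∀ B′ → ∣ B′ ∣² ≈ ∣ B ∣² → ∣ A +ᶜ B′ ∣² ≈ 2# * p + 2# * Re (A *ᶜ conj B′)
      expand B′ eq = trans (∣∣²-+ A B′) (+-congʳ (trans (+-cong (∣starts∣² trail) (trans eq (∣ends∣² trail)))
        (R.solve 1 (λ p → p R.:+ p R.:= (R.:1 R.:+ R.:1) R.:* p) refl p)))
      even-case : ∣ A +ᶜ (-ᶜ B) ∣² ≈ 2# * (∣ wt C ∣ - Re (wt C))
      even-case = begin
        ∣ A +ᶜ (-ᶜ B) ∣²                            ≈⟨ expand (-ᶜ B) (∣∣²-neg B) ⟩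
        2# * p + 2# * Re (A *ᶜ conj (-ᶜ B))         ≈⟨ +-cong (*-congˡ (sym ∣wt∣)) (*-congˡ (R.solve 4 (λ x y z t → x R.:* (R.:- z) R.:- y R.:* (R.:- (R.:- t)) R.:= R.:- (x R.:* z R.:- y R.:* (R.:- t))) refl (Re A) (Im A) (Re B) (Im B))) ⟩
        2# * ∣ wt C ∣ + 2# * (- Re (A *ᶜ conj B))   ≈⟨ +-congˡ (*-congˡ (-‿cong (proj₁ wt≈))) ⟨
        2# * ∣ wt C ∣ + 2# * (- Re (wt C))          ≈⟨ distribˡ _ _ _ ⟨
        2# * (∣ wt C ∣ - Re (wt C))                 ∎
      odd-case : ∣ A +ᶜ B ∣² ≈ 2# * (∣ wt C ∣ + Re (wt C))
      odd-case = begin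
        ∣ A +ᶜ B ∣²                                 ≈⟨ expand B refl ⟩
        2# * p + 2# * Re (A *ᶜ conj B)              ≈⟨ +-cong (*-congˡ ∣wt∣) (*-congˡ (proj₁ wt≈)) ⟨
        2# * ∣ wt C ∣ + 2# * Re (wt C)              ≈⟨ distribˡ _ _ _ ⟨
        2# * (∣ wt C ∣ + Re (wt C))                 ∎
      by-parity : (even : Dec (2 ∣ length vs)) → ∣ A +ᶜ (-ᶜ (sgn (length vs) *ᶜ B)) ∣² ≈
        2# * (if does even then ∣ wt C ∣ - Re (wt C) else ∣ wt C ∣ + Re (wt C))
      by-parity (yes even) = trans (∣∣²-cong (+ᶜ-cong reflᶜ (-ᶜ-cong (transᶜ (*ᶜ-cong (sgn-even _ even) reflᶜ) (*ᶜ-identityˡ B))))) even-case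
      by-parity (no odd)   = trans (∣∣²-cong (+ᶜ-cong reflᶜ (transᶜ (-ᶜ-cong (*ᶜ-cong (sgn-odd _ odd) reflᶜ))
        (C.solve 1 (λ b → C.:- ((C.:- C.:1) C.:* b) C.:= b) reflᶜ B)))) odd-case

-- Maximal minors as products over components

module ComponentDet {c ℓ₁ ℓ₂} (ℝ : RealField c ℓ₁ ℓ₂) {n m} (G : OrientedGraph n m)
  (w : Fin m → ComplexNumbers.ℂ ℝ)
  (w≉0 : ∀ e → ¬ ComplexNumbers._≈ᶜ_ ℝ (w e) (ComplexNumbers.0ᶜ ℝ))
  (w∉ℝ⁻ : ∀ e → ¬ ComplexNumbers.ℝ⁻ ℝ (w e)) where
  open RealField ℝ hiding (zero)
  open ComplexNumbers ℝ
  open RealFacts ℝ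
  open ComplexFacts ℝ
  open Products ℝ
  open Sums ℝ
  open OrientedGraph G
  open Graphs G hiding (V; E)
  open Graphs.Subgraph using () renaming (V to vertexSet; E to edgeSet)
  open GraphFacts G
  open SpanningFacts G
  open WeightedGraphs ℝ G w using (W; α; componentFactor; unicyclicTerm)
  open IncidenceDet ℝ G w w≉0 w∉ℝ⁻
  open IntegerSolver commutativeRing
  open import Relation.Binary.Reasoning.Setoid setoid

  ∣d∣²-unicyclic : ∀ {U} → Closed U → (u : Unicyclic U) →
    ∣ d (elements (vertexSet U)) (elements (edgeSet U)) ∣² ≈ componentFactor u
  ∣d∣²-unicyclic {U} cl u@(conn , C , _) = begin
    ∣ d (elements (vertexSet U)) (elements (edgeSet U)) ∣²   ≈⟨ ∣d∣²-↭ vertices↭ edges↭′ ⟨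
    ∣ d (νs ++ Cycle.vertices C) (es ++ κ) ∣²                ≈⟨ ∣d∣²-Grown grown within (Cycle.vertices C) ⟩
    ∏ es ∣w∣ * ∣ d (Cycle.vertices C) κ ∣²                   ≈⟨ *-cong (∏-↭ ∣w∣ es↭) (∣d∣²-cycle C) ⟩
    ∏ (elements (edgeSet U ─ cycleEdges C)) ∣w∣ * (2# * α C) ≈⟨ *-congʳ (∣W∣ _) ⟨
    ∣ W (edgeSet U ─ cycleEdges C) ∣ * (2# * α C)            ≈⟨ solve 3 (λ x y z → x :* (y :* z) := (y :* x) :* z) refl _ 2# (α C) ⟩
    componentFactor u                                        ∎
    where
    open CycleCore (cycleCore (Cycle.isCycle C)) using (κ; within)
    open Spanning (cycleSpanning conn cl C)
    edges↭′ : es ++ κ ↭ elements (edgeSet U)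
    edges↭′ = ≡.subst (_↭ _) (≡.trans (≡.cong ((es ++ κ) ++_) (unicyclic⇒no-surplus cl u)) (List.++-identityʳ _)) edges↭
    es-Unique′ : Unique (es ++ κ)
    es-Unique′ = Unique-resp-↭ (↭-sym edges↭′) (elements-Unique _)
    -- Without surplus, every edge off the cycle is a leaf edge, so the leaf weights multiply to the
    -- weight of `U` with its cycle edges removed.
    es↭ : es ↭ elements (edgeSet U ─ cycleEdges C)
    es↭ = ⊆⊇⇒↭ (Unique-++ˡ es es-Unique′) (elements-Unique _)
      (λ e∈ → ∈-elements⁺ (Subset.x∈p∧x∉q⇒x∈p─q (es-∈ (∈-++⁺ˡ e∈))
        (λ e∈C → Unique-++-disjoint es es-Unique′ e∈ (cycleEdges-∈⁻ C e∈C))))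
      (λ e∈ → [ id , (λ e∈κ → ⊥-elim (x∈p─q⇒x∉q (edgeSet U) _ (∈-elements⁻ e∈) (cycleEdges-∈⁺ C e∈κ))) ]′
        (∈-++⁻ es (∈-resp-↭ (↭-sym edges↭′) (∈-elements⁺ (Subset.p─q⊆p (edgeSet U) _ (∈-elements⁻ e∈))))))

  -- Were the minor square, the connected graph `U` would have as many edges as vertices; it would
  -- then contain a cycle and be unicyclic. So the lengths differ and `d` is 0.
  d-not-unicyclic : ∀ {U} → Connected U → Closed U → ¬ Unicyclic U →
    d (elements (vertexSet U)) (elements (edgeSet U)) ≈ᶜ 0ᶜ
  d-not-unicyclic {U} conn cl ¬u = d-length (elements (vertexSet U)) (elements (edgeSet U)) λ eq →
    acyclic⇒unbalanced conn cl (λ C → ¬u (balanced⇒unicyclic conn cl eq C)) eq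

  module _ (S : Subset m) where
    private H = spanning S

    ∣d∣²-disjoint-components : ∀ {Xs} → All (IsComponent H) Xs → Unique Xs →
      ∣ d (concatMap elements Xs) (concatMap (inducedEdges S) Xs) ∣² ≈ ∏ Xs (λ X → ∣ d (elements X) (inducedEdges S X) ∣²)
    ∣d∣²-disjoint-components []                   []          = ∣1∣²≈1
    ∣d∣²-disjoint-components {X ∷ Xs} cs@(_ ∷ cs′) u@(_ ∷ u′) = begin
      ∣ d (elements X ++ ρ) (inducedEdges S X ++ κ) ∣²          ≈⟨ ∣∣²-cong (d-block
          (All.tabulate λ v∈ → All.tabulate λ e∈ → N-outside (Unique-++-disjoint (elements X) (vertices-Unique S cs u) v∈) (rest-Inside e∈))
          (All.tabulate λ {e} e∈ → All.tabulate λ v∈ → N-outside {elements X} {e = e} (λ v∈X → Unique-++-disjoint (elements X) (vertices-Unique S cs u) v∈X v∈)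
            (component-Inside X e∈))) ⟩
      ∣ d (elements X) (inducedEdges S X) *ᶜ d ρ κ ∣²           ≈⟨ ∣∣²-* _ _ ⟩
      ∣ d (elements X) (inducedEdges S X) ∣² * ∣ d ρ κ ∣²       ≈⟨ *-congˡ (∣d∣²-disjoint-components cs′ u′) ⟩
      ∏ (X ∷ Xs) (λ X → ∣ d (elements X) (inducedEdges S X) ∣²) ∎
      where
      ρ = concatMap elements Xs
      κ = concatMap (inducedEdges S) Xs
      component-Inside : ∀ X {e} → e ∈ inducedEdges S X → Inside (elements X) e
      component-Inside X e∈ = ∈-elements⁺ (proj₁ (induced-Closed H X (∈-elements⁻ e∈))) , ∈-elements⁺ (proj₂ (induced-Closed H X (∈-elements⁻ e∈)))
      rest-Inside : ∀ {e} → e ∈ κ → Inside ρ e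
      rest-Inside e∈ with ∈-concatMap⁻ (inducedEdges S) Xs e∈
      ... | Y , Y∈ , e∈Y = Inside-⊆ (∈-concatMap⁺ elements Y∈) (component-Inside Y e∈Y)

    ∣d∣²-components : ∣ d (allFin n) (elements S) ∣² ≈ ∏ (componentSets S) (λ X → ∣ d (elements X) (inducedEdges S X) ∣²)
    ∣d∣²-components = trans (sym (∣d∣²-↭ (vertices-partition S) (edges-partition S)))
      (∣d∣²-disjoint-components (componentSets-components S) (componentSets-Unique S))

    private
      all-unicyclic : ∀ {Xs} → All (IsComponent H) Xs → (us : All Unicyclic (map (induced H) Xs)) →
        ∏ Xs (λ X → ∣ d (elements X) (inducedEdges S X) ∣²) ≈ List.foldr _*_ 1# (reduce componentFactor us)
      all-unicyclic []                []       = refl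
      all-unicyclic {X ∷ _} (_ ∷ cs) (u ∷ us) = *-cong (∣d∣²-unicyclic (induced-Closed H X) u) (all-unicyclic cs us)

      some-not-unicyclic : ∀ {Xs} → All (IsComponent H) Xs → ¬ All Unicyclic (map (induced H) Xs) →
        ∏ Xs (λ X → ∣ d (elements X) (inducedEdges S X) ∣²) ≈ 0#
      some-not-unicyclic [] ¬us = contradiction [] ¬us
      some-not-unicyclic {X ∷ Xs} ((_ , conn , _) ∷ cs) ¬us with unicyclic? (induced H X)
      ... | yes u = trans (*-congˡ (some-not-unicyclic cs (λ us → ¬us (u ∷ us)))) (zeroʳ _)
      ... | no ¬u = trans (*-congʳ (≈0⇒∣∣²≈0 (d-not-unicyclic conn (induced-Closed H X) ¬u))) (zeroˡ _)

    ∣d∣²-unicyclicTerm : (us : AllUnicyclic H) → ∣ d (allFin n) (elements S) ∣² ≈ unicyclicTerm (H , us)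
    ∣d∣²-unicyclicTerm us = trans ∣d∣²-components (all-unicyclic (componentSets-components S) us)

    ∣d∣²-no-unicyclicTerm : ¬ AllUnicyclic H → ∣ d (allFin n) (elements S) ∣² ≈ 0#
    ∣d∣²-no-unicyclicTerm ¬us = trans ∣d∣²-components (some-not-unicyclic (componentSets-components S) ¬us)

  ∑-unicyclicTerm : ∑ (allSubsets m) (λ S → ∣ d (allFin n) (elements S) ∣²) ≈ ∑ unicyclicSpanningSubgraphs unicyclicTerm
  ∑-unicyclicTerm = ∑-mapMaybe-map spanning (λ H → All.all? unicyclic? (components H))
    ∣d∣²-unicyclicTerm ∣d∣²-no-unicyclicTerm (allSubsets m)

-- Choosing all rows or all rows but one

tabulate-lookup : ∀ {a} {A : Set a} {r} (xs : Vec A r) → List.tabulate (Vec.lookup xs) ≡ Vec.toList xs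
tabulate-lookup []       = ≡.refl
tabulate-lookup (x ∷ xs) = ≡.cong (x ∷_) (tabulate-lookup xs)

toList-map-suc : ∀ {n r} (v : Vec (Fin n) r) {xs} → Vec.toList v ↭ xs → Vec.toList (Vec.map Fin.suc v) ↭ map Fin.suc xs
toList-map-suc v p = ↭-trans (↭-reflexive (Vec.toList-map suc v)) (↭-map⁺ suc p)

allFin-suc : ∀ n → allFin (suc n) ≡ zero ∷ map suc (allFin n)
allFin-suc n = ≡.cong (zero ∷_) (≡.sym (List.map-tabulate id suc))

choose-excess : ∀ {n r} → n ℕ.< r → choose n r ≡ []
choose-excess {zero}  {suc r} _         = ≡.refl
choose-excess {suc n} {suc r} (s≤s n<r) =
  ≡.cong₂ (λ xs ys → map (λ v → zero ∷ Vec.map suc v) xs ++ map (Vec.map suc) ys)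
    (choose-excess n<r) (choose-excess (ℕ.m<n⇒m<1+n n<r))

choose-all-↭ : ∀ n → All (λ ρ → Vec.toList ρ ↭ allFin n) (choose n n)
choose-all-↭ zero    = ↭-refl ∷ []
choose-all-↭ (suc n) = All.++⁺
  (All.map⁺ (All.map (λ {ρ} p → ↭-trans (prep zero (toList-map-suc ρ p)) (↭-reflexive (≡.sym (allFin-suc n)))) (choose-all-↭ n)))
  (≡.subst (λ xs → All (λ ρ → Vec.toList ρ ↭ allFin (suc n)) (map (Vec.map suc) xs)) (≡.sym (choose-excess (ℕ.n<1+n n))) [])

length-choose-all : ∀ n → length (choose n n) ≡ 1
length-choose-all zero    = ≡.refl
length-choose-all (suc n) rewrite choose-excess (ℕ.n<1+n n) =
  ≡.trans (≡.cong length (List.++-identityʳ (map (λ v → zero ∷ Vec.map suc v) (choose n n))))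
    (≡.trans (List.length-map _ (choose n n)) (length-choose-all n))

-- The omitted index k is kept as a witness, because it becomes the root from which spanning trees
-- are grown.
choose-all-but-one-↭ : ∀ n → All (λ ρ → ∃ λ k → k ∷ Vec.toList ρ ↭ allFin (suc n)) (choose (suc n) n)
choose-all-but-one-↭ zero    = (zero , ↭-refl) ∷ []
choose-all-but-one-↭ (suc n) = All.++⁺
  (All.map⁺ (All.map (λ {ρ} (k , p) → suc k , ↭-trans (↭-trans (swap (suc k) zero ↭-refl)
      (prep zero (toList-map-suc (k ∷ ρ) p))) (↭-reflexive (≡.sym (allFin-suc (suc n))))) (choose-all-but-one-↭ n)))
  (All.map⁺ (All.map (λ {ρ} p → zero , ↭-trans (prep zero (toList-map-suc ρ p)) (↭-reflexive (≡.sym (allFin-suc (suc n))))) (choose-all-↭ (suc n))))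

length-choose-all-but-one : ∀ n → length (choose (suc n) n) ≡ suc n
length-choose-all-but-one zero    = ≡.refl
length-choose-all-but-one (suc n) = begin
  length (map f (choose (suc n) n) ++ map (Vec.map suc) (choose (suc n) (suc n)))
    ≡⟨ List.length-++ (map f (choose (suc n) n)) ⟩
  length (map f (choose (suc n) n)) ℕ.+ length (map (Vec.map suc) (choose (suc n) (suc n)))
    ≡⟨ ≡.cong₂ ℕ._+_ (≡.trans (List.length-map f (choose (suc n) n)) (length-choose-all-but-one n))
         (≡.trans (List.length-map (Vec.map suc) (choose (suc n) (suc n))) (length-choose-all (suc n))) ⟩
  suc n ℕ.+ 1
    ≡⟨ ℕ.+-comm (suc n) 1 ⟩
  suc (suc n)  ∎
  where
  open ≡.≡-Reasoning
  f : Vec (Fin (suc n)) n → Vec (Fin (suc (suc n))) (suc n)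
  f v = zero ∷ Vec.map suc v

-- Rank and volume in the two cases

module Volume {c ℓ₁ ℓ₂} (ℝ : RealField c ℓ₁ ℓ₂) {n m} (G : OrientedGraph n m)
  (w : Fin m → ComplexNumbers.ℂ ℝ)
  (w≉0 : ∀ e → ¬ ComplexNumbers._≈ᶜ_ ℝ (w e) (ComplexNumbers.0ᶜ ℝ))
  (w∉ℝ⁻ : ∀ e → ¬ ComplexNumbers.ℝ⁻ ℝ (w e))
  (connected : Graphs.Connected G (Graphs.whole G)) where
  open RealField ℝ hiding (zero)
  open ComplexNumbers ℝ
  open RealFacts ℝ
  open ComplexFacts ℝ
  open Products ℝ
  open Sums ℝ
  open OrientedGraph G
  open Graphs G hiding (V; E)
  open Graphs.Subgraph using () renaming (E to edgeSet)
  open GraphFacts G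
  open SpanningFacts G
  open WeightedGraphs ℝ G w using (N; wt; W; α; unicyclicTerm; _·_)
  open IncidenceDet ℝ G w w≉0 w∉ℝ⁻
  open ComponentDet ℝ G w w≉0 w∉ℝ⁻
  open Laplace ℂ-commutativeRing using (sum-pair)
  open DecMembership {A = Fin m} _≟_ using (_∈?_)
  private
    module R = IntegerSolver commutativeRing
    module C = IntegerSolver ℂ-commutativeRing
  open RawMonoidOps (RawRing.+-rawMonoid ℂ-rawRing) using (sum)

  ∣det∣² : ∀ {r} (ρ : Vec (Fin n) r) (κ : Vec (Fin m) r) →
    ∣ det (submatrix N ρ κ) ∣ * ∣ det (submatrix N ρ κ) ∣ ≈ ∣ d (Vec.toList ρ) (Vec.toList κ) ∣²
  ∣det∣² ρ κ = trans (∣∣*∣∣ (det (submatrix N ρ κ))) (trans (∣∣²-cong (det≈d (Vec.lookup ρ) (Vec.lookup κ)))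
    (reflexive (≡.cong₂ (λ ρ κ → ∣ d ρ κ ∣²) (tabulate-lookup ρ) (tabulate-lookup κ))))

  ∑-minors : ∀ {r} (ρ : Vec (Fin n) r) →
    ∑ (choose m r) (λ κ → ∣ det (submatrix N ρ κ) ∣ * ∣ det (submatrix N ρ κ) ∣) ≈
    ∑ (allSubsets m) (λ S → ∣ d (Vec.toList ρ) (elements S) ∣²)
  ∑-minors {r} ρ = trans (∑-cong (choose m r) (∣det∣² ρ))
    (∑-choose m r (λ κ → ∣ d (Vec.toList ρ) κ ∣²) λ κ ≢r →
      ≈0⇒∣∣²≈0 (d-length (Vec.toList ρ) κ (≢r ∘ ≡.sym ∘ ≡.trans (≡.sym (Vec.length-toList ρ)))))

  α≈0 : ∀ {H} (C : Cycle H) → (Cycle.Even C → ℝ⁺ (wt C)) × (Cycle.Odd C → ℝ⁻ (wt C)) → α C ≈ 0#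
  α≈0 C (pos , neg) = by-parity (Cycle.even? C) pos neg
    where
    z = wt C
    real : ∀ {x} → Im z ≈ 0# → 0# ≤ x → x * x ≈ Re z * Re z → ∣ z ∣ ≈ x
    real im≈0 0≤x eq = ∣∣-unique 0≤x (trans eq (trans (R.solve 1 (λ x → x R.:* x R.:= x R.:* x R.:+ R.:0 R.:* R.:0) refl (Re z))
      (+-congˡ (*-cong (sym im≈0) (sym im≈0)))))
    by-parity : ∀ {p} {P : Set p} (P? : Dec P) → (P → ℝ⁺ z) → (¬ P → ℝ⁻ z) →
      (if does P? then ∣ z ∣ - Re z else ∣ z ∣ + Re z) ≈ 0#
    by-parity (yes p) pos neg with pos p
    ... | (0≤x , _) , im≈0 = trans (+-congʳ (real im≈0 0≤x refl)) (-‿inverseʳ _)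
    by-parity (no ¬p) pos neg with neg ¬p
    ... | (x≤0 , _) , im≈0 = trans (+-congʳ (real im≈0 (≤0⇒0≤- x≤0)
      (R.solve 1 (λ x → (R.:- x) R.:* (R.:- x) R.:= x R.:* x) refl (Re z)))) (-‿inverseˡ _)

  -- If α(C) = 0 then |wt(C)| = ± Re(wt(C)), so wt(C) is real. It is non-zero as a product of
  -- non-zero weights in modulus, so it lies strictly on the excluded side.
  α≉0 : ∀ {H} (C : Cycle H) → (Cycle.Even C × ¬ ℝ⁺ (wt C)) ⊎ (Cycle.Odd C × ¬ ℝ⁻ (wt C)) → α C ≉ 0#
  α≉0 C = by-parity (Cycle.even? C)
    where
    z = wt C
    ∣z∣≉0 : ∣ z ∣ ≉ 0#
    ∣z∣≉0 e = ∏-≉0 (CycleCore.κ (cycleCore (Cycle.isCycle C))) (λ e → ∣∣≉0 (w≉0 e)) (trans (sym (∣wt∣ C)) e)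
    Im≈0 : ∀ {x} → ∣ z ∣ ≈ x → x * x ≈ Re z * Re z → Im z ≈ 0#
    Im≈0 {x} ∣z∣≈x eq = square≈0 (begin
      Im z * Im z                   ≈⟨ R.solve 2 (λ a b → b R.:* b R.:= (a R.:* a R.:+ b R.:* b) R.:- a R.:* a) refl (Re z) (Im z) ⟩
      ∣ z ∣² - Re z * Re z          ≈⟨ +-congʳ (∣∣*∣∣ z) ⟨
      ∣ z ∣ * ∣ z ∣ - Re z * Re z   ≈⟨ +-congʳ (trans (*-cong ∣z∣≈x ∣z∣≈x) eq) ⟩
      Re z * Re z - Re z * Re z     ≈⟨ -‿inverseʳ _ ⟩
      0#                            ∎)
      where open import Relation.Binary.Reasoning.Setoid setoid
    by-parity : ∀ {p} {P : Set p} (P? : Dec P) → (P × ¬ ℝ⁺ z) ⊎ (¬ P × ¬ ℝ⁻ z) →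
      (if does P? then ∣ z ∣ - Re z else ∣ z ∣ + Re z) ≉ 0#
    by-parity (yes p) (inj₂ (¬p , _)) _ = ¬p p
    by-parity (no ¬p) (inj₁ (p , _))  _ = ¬p p
    by-parity (yes p) (inj₁ (_ , ¬pos)) e = ¬pos
      ((≤-resp refl ∣z∣≈x (∣∣-nonNeg z) , λ 0≈x → ∣z∣≉0 (trans ∣z∣≈x (sym 0≈x))) , Im≈0 ∣z∣≈x refl)
      where
      ∣z∣≈x : ∣ z ∣ ≈ Re z
      ∣z∣≈x = trans (R.solve 2 (λ a b → a R.:= (a R.:- b) R.:+ b) refl ∣ z ∣ (Re z)) (trans (+-congʳ e) (+-identityˡ _))
    by-parity (no ¬p) (inj₂ (_ , ¬neg)) e = ¬neg
      ((0≤-⇒≤ (≤-resp refl (trans ∣z∣≈-x (sym (+-identityˡ _))) (∣∣-nonNeg z)) , λ x≈0 → ∣z∣≉0 (trans ∣z∣≈-x (trans (-‿cong x≈0) -0≈0))) ,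
        Im≈0 ∣z∣≈-x (R.solve 1 (λ x → (R.:- x) R.:* (R.:- x) R.:= x R.:* x) refl (Re z)))
      where
      -0≈0 : - 0# ≈ 0#
      -0≈0 = R.solve 0 (R.:- R.:0 R.:= R.:0) refl
      ∣z∣≈-x : ∣ z ∣ ≈ - Re z
      ∣z∣≈-x = trans (R.solve 2 (λ a b → a R.:= (a R.:+ b) R.:- b) refl ∣ z ∣ (Re z)) (trans (+-congʳ e) (+-identityˡ _))

  -- A left null vector of N: along each edge its value at one end
  -- determines the value at the other.
  module _ (x : V → ℂ) (null : ∀ e → sum (λ i → x i *ᶜ N i e) ≈ᶜ 0ᶜ) where

    null-edge : ∀ {e u v} → Joins e u v → (x u *ᶜ N u e) +ᶜ (x v *ᶜ N v e) ≈ᶜ 0ᶜ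
    null-edge {e} {u} {v} j = transᶜ (symᶜ (sum-pair {f = λ i → x i *ᶜ N i e} u v (Joins-≢ j)
      (λ i i≢u i≢v → transᶜ (*ᶜ-cong reflᶜ (N-away {x = i} j i≢u i≢v)) (zeroʳᶜ (x i))))) (null e)

    null-adjacent : ∀ {e u v} → Joins e u v → x u ≈ᶜ 0ᶜ → x v ≈ᶜ 0ᶜ
    null-adjacent {e} {u} {v} j xu≈0 = [ id , (λ q → contradiction q (N≉0 (Joins-sym j))) ]′ (integralᶜ {x v} {N v e} (begin
      x v *ᶜ N v e                                ≈⟨ C.solve 2 (λ p q → q C.:= C.:0 C.:* p C.:+ q) reflᶜ (N u e) (x v *ᶜ N v e) ⟩
      (0ᶜ *ᶜ N u e) +ᶜ (x v *ᶜ N v e)             ≈⟨ +ᶜ-cong (*ᶜ-cong xu≈0 reflᶜ) reflᶜ ⟨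
      (x u *ᶜ N u e) +ᶜ (x v *ᶜ N v e)            ≈⟨ null-edge j ⟩
      0ᶜ                                          ∎))
      where open import Relation.Binary.Reasoning.Setoid ℂ-setoid

    null-reachable : ∀ {u v} → Star (Adj whole) u v → x u ≈ᶜ 0ᶜ → x v ≈ᶜ 0ᶜ
    null-reachable ε                 xu≈0 = xu≈0
    null-reachable ((e , _ , j) ◅ s) xu≈0 = null-reachable s (null-adjacent j xu≈0)

    null-everywhere : ∀ u → x u ≈ᶜ 0ᶜ → ∀ v → x v ≈ᶜ 0ᶜ
    null-everywhere u xu≈0 v = null-reachable (proj₂ connected u Subset.∈⊤ v Subset.∈⊤) xu≈0

    private
      slide : ∀ {e u v} → Joins e u v → x v *ᶜ N v e ≈ᶜ -ᶜ (x u *ᶜ N u e)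
      slide {e} {u} {v} j = begin
        x v *ᶜ N v e                                                  ≈⟨ C.solve 2 (λ p q → q C.:= (p C.:+ q) C.:- p) reflᶜ (x u *ᶜ N u e) (x v *ᶜ N v e) ⟩
        ((x u *ᶜ N u e) +ᶜ (x v *ᶜ N v e)) +ᶜ (-ᶜ (x u *ᶜ N u e))     ≈⟨ +ᶜ-cong (null-edge j) reflᶜ ⟩
        0ᶜ +ᶜ (-ᶜ (x u *ᶜ N u e))                                     ≈⟨ C.solve 1 (λ p → C.:0 C.:- p C.:= C.:- p) reflᶜ (x u *ᶜ N u e) ⟩
        -ᶜ (x u *ᶜ N u e)                                             ∎
        where open import Relation.Binary.Reasoning.Setoid ℂ-setoid

    -- The product of the relations x_v N_ve = - x_u N_ue along the trail, with one sign per edge.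
    -- In this multiplied form no entry is divided by.
    null-trail : ∀ u vs {v es} (t : Trail (u ∷ vs ∷ʳ v) es) → x v *ᶜ ends t ≈ᶜ sgn (length es) *ᶜ (x u *ᶜ starts t)
    null-trail u [] {v} (_∷_ {e = e} j [-]) = begin
      x v *ᶜ (N v e *ᶜ 1ᶜ)           ≈⟨ *ᶜ-assoc (x v) (N v e) 1ᶜ ⟨
      (x v *ᶜ N v e) *ᶜ 1ᶜ           ≈⟨ *ᶜ-cong (slide j) reflᶜ ⟩
      (-ᶜ (x u *ᶜ N u e)) *ᶜ 1ᶜ      ≈⟨ C.solve 2 (λ p q → (C.:- (p C.:* q)) C.:* C.:1 C.:= (C.:- C.:1) C.:* (p C.:* (q C.:* C.:1))) reflᶜ (x u) (N u e) ⟩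
      (-ᶜ 1ᶜ) *ᶜ (x u *ᶜ (N u e *ᶜ 1ᶜ))  ∎
      where open import Relation.Binary.Reasoning.Setoid ℂ-setoid
    null-trail u (y ∷ vs) {v} {_ ∷ es} (_∷_ {e = e} j t) = begin
      x v *ᶜ (N y e *ᶜ ends t)       ≈⟨ C.solve 3 (λ p q r → p C.:* (q C.:* r) C.:= q C.:* (p C.:* r)) reflᶜ (x v) (N y e) (ends t) ⟩
      N y e *ᶜ (x v *ᶜ ends t)       ≈⟨ *ᶜ-cong reflᶜ (null-trail y vs t) ⟩
      N y e *ᶜ (sgn (length es) *ᶜ (x y *ᶜ starts t))
        ≈⟨ C.solve 4 (λ p q r s → p C.:* (q C.:* (r C.:* s)) C.:= (q C.:* s) C.:* (r C.:* p)) reflᶜ (N y e) (sgn (length es)) (x y) (starts t) ⟩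
      (sgn (length es) *ᶜ starts t) *ᶜ (x y *ᶜ N y e)
        ≈⟨ *ᶜ-cong reflᶜ (slide j) ⟩
      (sgn (length es) *ᶜ starts t) *ᶜ (-ᶜ (x u *ᶜ N u e))
        ≈⟨ C.solve 4 (λ q s r p → (q C.:* s) C.:* (C.:- (r C.:* p)) C.:= (C.:- q) C.:* (r C.:* (p C.:* s))) reflᶜ (sgn (length es)) (starts t) (x u) (N u e) ⟩
      (-ᶜ sgn (length es)) *ᶜ (x u *ᶜ (N u e *ᶜ starts t))  ∎
      where open import Relation.Binary.Reasoning.Setoid ℂ-setoid

    -- Around a cycle with sign s, `null-trail` gives x_u B = s x_u A, so x_u (A - s B) = (1 - s²)
    -- x_u A = 0. The factor A - s B is the cycle determinant, which is non-zero because its squared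
    -- modulus is 2α(C).
    null-on-cycle : ∀ {H} (C : Cycle H) → α C ≉ 0# → ∃ λ u → x u ≈ᶜ 0ᶜ
    null-on-cycle (cycle [] (() , _)) _
    null-on-cycle C@(cycle (u ∷ vs) c@(3≤ , uu , _)) α≉ = u , [ id , d≉0 ]′ (integralᶜ {x u} {d (u ∷ vs) κ} x*d≈0)
      where
      open CycleCore (cycleCore c) using (κ; trail; size)
      A = starts trail
      B = ends trail
      s = sgn (length (u ∷ vs))
      open import Relation.Binary.Reasoning.Setoid ℂ-setoid
      xB : x u *ᶜ B ≈ᶜ s *ᶜ (x u *ᶜ A)
      xB = transᶜ (null-trail u vs trail) (*ᶜ-cong (reflexiveᶜ (≡.cong sgn size)) reflᶜ)
      x*d≈0 : x u *ᶜ d (u ∷ vs) κ ≈ᶜ 0ᶜ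
      x*d≈0 = begin
        x u *ᶜ d (u ∷ vs) κ                      ≈⟨ *ᶜ-cong reflᶜ (d-cycle 3≤ uu trail) ⟩
        x u *ᶜ (A +ᶜ (-ᶜ (s *ᶜ B)))              ≈⟨ C.solve 4 (λ x a s b → x C.:* (a C.:- s C.:* b) C.:= x C.:* a C.:- s C.:* (x C.:* b)) reflᶜ (x u) A s B ⟩
        (x u *ᶜ A) +ᶜ (-ᶜ (s *ᶜ (x u *ᶜ B)))     ≈⟨ +ᶜ-cong reflᶜ (-ᶜ-cong (*ᶜ-cong reflᶜ xB)) ⟩
        (x u *ᶜ A) +ᶜ (-ᶜ (s *ᶜ (s *ᶜ (x u *ᶜ A))))  ≈⟨ C.solve 2 (λ s y → y C.:- s C.:* (s C.:* y) C.:= (C.:1 C.:- s C.:* s) C.:* y) reflᶜ s (x u *ᶜ A) ⟩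
        (1ᶜ +ᶜ (-ᶜ (s *ᶜ s))) *ᶜ (x u *ᶜ A)      ≈⟨ *ᶜ-cong (+ᶜ-cong reflᶜ (-ᶜ-cong (sgn² (length (u ∷ vs))))) reflᶜ ⟩
        (1ᶜ +ᶜ (-ᶜ 1ᶜ)) *ᶜ (x u *ᶜ A)            ≈⟨ C.solve 1 (λ y → (C.:1 C.:- C.:1) C.:* y C.:= C.:0) reflᶜ (x u *ᶜ A) ⟩
        0ᶜ                                       ∎
      d≉0 : d (u ∷ vs) κ ≈ᶜ 0ᶜ → x u ≈ᶜ 0ᶜ
      d≉0 q = contradiction (trans (sym (∣d∣²-cycle C)) (≈0⇒∣∣²≈0 q)) (nonZero-* 2≉0 α≉)

  elements-⊤↭ : ∀ {n} → elements (⊤ {n}) ↭ allFin n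
  elements-⊤↭ = ⊆⊇⇒↭ (elements-Unique ⊤) (Unique.allFin⁺ _) (λ _ → ∈-allFin _) (λ _ → ∈-elements⁺ Subset.∈⊤)

  whole-Closed : ∀ S → Closed (spanning S)
  whole-Closed S _ = Subset.∈⊤ , Subset.∈⊤

  -- If rows i and j coincided, the vector with 1 at i, -1 at j and 0 elsewhere would be a relation.
  independent⇒injective : ∀ {s} (ρ : Fin s → V) → RowsIndependent N ρ → ∀ {i j} → ρ i ≡ ρ j → i ≡ j
  independent⇒injective {s} ρ ind {i} {j} ρi≡ρj with i ≟ j
  ... | yes i≡j = i≡j
  ... | no i≢j = contradiction (trans (sym (proj₁ (xᵢ))) (proj₁ (ind x null i))) (0≉1 ∘ sym)
    where
    x : Fin s → ℂ
    x k = if does (k ≟ i) then 1ᶜ else if does (k ≟ j) then -ᶜ 1ᶜ else 0ᶜ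
    xᵢ : x i ≈ᶜ 1ᶜ
    xᵢ with i ≟ i
    ... | yes _ = reflᶜ
    ... | no ¬p = contradiction ≡.refl ¬p
    xⱼ : x j ≈ᶜ -ᶜ 1ᶜ
    xⱼ with j ≟ i | j ≟ j
    ... | yes p | _     = contradiction (≡.sym p) i≢j
    ... | no _  | yes _ = reflᶜ
    ... | no _  | no ¬p = contradiction ≡.refl ¬p
    xₖ : ∀ k → k ≢ i → k ≢ j → x k ≈ᶜ 0ᶜ
    xₖ k k≢i k≢j with k ≟ i | k ≟ j
    ... | yes p | _     = contradiction p k≢i
    ... | no _  | yes p = contradiction p k≢j
    ... | no _  | no _  = reflᶜ
    null : ∀ e → sum (λ k → x k *ᶜ N (ρ k) e) ≈ᶜ 0ᶜ
    null e = begin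
      sum (λ k → x k *ᶜ N (ρ k) e)                      ≈⟨ sum-pair {f = λ k → x k *ᶜ N (ρ k) e} i j i≢j (λ k k≢i k≢j → transᶜ (*ᶜ-cong (xₖ k k≢i k≢j) reflᶜ) (zeroˡᶜ (N (ρ k) e))) ⟩
      (x i *ᶜ N (ρ i) e) +ᶜ (x j *ᶜ N (ρ j) e)          ≈⟨ +ᶜ-cong (*ᶜ-cong xᵢ (reflexiveᶜ (≡.cong (λ v → N v e) ρi≡ρj))) (*ᶜ-cong xⱼ reflᶜ) ⟩
      (1ᶜ *ᶜ N (ρ j) e) +ᶜ ((-ᶜ 1ᶜ) *ᶜ N (ρ j) e)       ≈⟨ C.solve 1 (λ p → C.:1 C.:* p C.:+ (C.:- C.:1) C.:* p C.:= C.:0) reflᶜ (N (ρ j) e) ⟩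
      0ᶜ                                                ∎
      where open import Relation.Binary.Reasoning.Setoid ℂ-setoid

  independent⇒≤ : ∀ {s} (ρ : Fin s → V) → RowsIndependent N ρ → s ℕ.≤ n
  independent⇒≤ ρ ind = injective⇒≤ (independent⇒injective ρ ind)

  unbalanced-vol² : 0 ℕ.< n → ∃ (λ (C : Cycle whole) → α C ≉ 0#) → IsVol² N (∑ unicyclicSpanningSubgraphs unicyclicTerm)
  unbalanced-vol² 0<n (C , α≉) = n , ((id , λ x null i → null-everywhere x null _ (proj₂ (null-on-cycle x null C α≉)) i) , independent⇒≤) , 0<n ,
    sym (begin
      ∑ (choose n n) (λ ρ → ∑ (choose m n) λ κ → ∣ det (submatrix N ρ κ) ∣ * ∣ det (submatrix N ρ κ) ∣)
        ≈⟨ ∑-const (All.map (λ {ρ} p → trans (∑-minors ρ) (∑-cong (allSubsets m) λ S → ∣d∣²-↭ p ↭-refl)) (choose-all-↭ n)) ⟩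
      length (choose n n) · ∑ (allSubsets m) (λ S → ∣ d (allFin n) (elements S) ∣²)
        ≡⟨ ≡.cong (_· ∑ (allSubsets m) (λ S → ∣ d (allFin n) (elements S) ∣²)) (length-choose-all n) ⟩
      -- There is a single choice of n rows, and `1 · y` computes to `y + 0#`.
      ∑ (allSubsets m) (λ S → ∣ d (allFin n) (elements S) ∣²) + 0#
        ≈⟨ +-identityʳ _ ⟩
      ∑ (allSubsets m) (λ S → ∣ d (allFin n) (elements S) ∣²)
        ≈⟨ ∑-unicyclicTerm ⟩
      ∑ unicyclicSpanningSubgraphs unicyclicTerm ∎)
    where open import Relation.Binary.Reasoning.Setoid setoid

  module Balanced (α-vanishes : (C : Cycle whole) → α C ≈ 0#) where

    -- A non-unicyclic component has a zero minor anyway; for a unicyclic one the factor α of its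
    -- cycle vanishes, that cycle being a cycle of G.
    component-singular : ∀ {S X} → IsComponent (spanning S) X → ∣ d (elements X) (inducedEdges S X) ∣² ≈ 0#
    component-singular {S} {X} (_ , conn , _) with unicyclic? (induced (spanning S) X)
    ... | no ¬u = ≈0⇒∣∣²≈0 (d-not-unicyclic conn (induced-Closed (spanning S) X) ¬u)
    ... | yes u@(_ , cycle vs c , _) = trans (∣d∣²-unicyclic (induced-Closed (spanning S) X) u)
      -- `α` depends only on the vertex list of a cycle, so its value is the same when the cycle is
      -- read in `whole`.
      (trans (*-congˡ (α-vanishes (cycle vs (IsCycleIn-map (λ _ → Subset.∈⊤) c)))) (zeroʳ _))

    -- Rows containing a whole component allow it to be split off as a diagonal block of determinant
    -- 0. This serves both for the full set of rows and for the rows without k, when the component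
    -- avoids k.
    rows-over-component-singular : ∀ S v {ρ} → Unique ρ → (∀ {i} → i ∈ˢ componentOf S v → i ∈ ρ) → ∣ d ρ (elements S) ∣² ≈ 0#
    rows-over-component-singular S v {ρ} uρ X⊆ρ = begin
      ∣ d ρ (elements S) ∣²                       ≈⟨ ∣d∣²-↭ ρ↭ κ↭ ⟩
      ∣ d (elements X ++ ρ′) (inducedEdges S X ++ κ′) ∣²  ≈⟨ ∣∣²-cong (d-block zeros₁ zeros₂) ⟩
      ∣ d (elements X) (inducedEdges S X) *ᶜ d ρ′ κ′ ∣²   ≈⟨ ∣∣²-* _ _ ⟩
      ∣ d (elements X) (inducedEdges S X) ∣² * ∣ d ρ′ κ′ ∣²   ≈⟨ *-congʳ (component-singular isComp) ⟩
      0# * ∣ d ρ′ κ′ ∣²                           ≈⟨ zeroˡ _ ⟩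
      0#                                          ∎
      where
      open import Relation.Binary.Reasoning.Setoid setoid
      X = componentOf S v
      isComp = componentOf-isComponent S v
      F = edgeSet (induced (spanning S) X)
      ρ′ = filter (¬? ∘ (Subset._∈? X)) ρ
      κ′ = filter (¬? ∘ (Subset._∈? F)) (elements S)
      ρ↭ : ρ ↭ elements X ++ ρ′
      ρ↭ = ↭-trans (↭-sym (filter-partition (Subset._∈? X) ρ)) (++⁺ʳ ρ′ (⊆⊇⇒↭ (Unique.filter⁺ (Subset._∈? X) uρ) (elements-Unique X)
        (λ i∈ → ∈-elements⁺ (proj₂ (∈-filter⁻ (Subset._∈? X) {xs = ρ} i∈)))
        (λ i∈ → ∈-filter⁺ (Subset._∈? X) (X⊆ρ (∈-elements⁻ i∈)) (∈-elements⁻ i∈))))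
      κ↭ : elements S ↭ inducedEdges S X ++ κ′
      κ↭ = ↭-trans (↭-sym (filter-partition (Subset._∈? F) (elements S))) (++⁺ʳ κ′ (⊆⊇⇒↭ (Unique.filter⁺ (Subset._∈? F) (elements-Unique S)) (elements-Unique F)
        (λ e∈ → ∈-elements⁺ (proj₂ (∈-filter⁻ (Subset._∈? F) {xs = elements S} e∈)))
        (λ e∈ → ∈-filter⁺ (Subset._∈? F) (∈-elements⁺ (proj₁ (∈-induced⁻ {spanning S} {X} (∈-elements⁻ e∈)))) (∈-elements⁻ e∈))))
      outside-edge : ∀ {i e} → i ∈ˢ X → e ∈ κ′ → N i e ≈ᶜ 0ᶜ
      outside-edge {i} {e} i∈ e∈ with ∈-filter⁻ (¬? ∘ (Subset._∈? F)) {xs = elements S} e∈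
      ... | e∈S , e∉F = N-vanish {i} {e}
        (λ { ≡.refl → e∉F (∈-induced⁺ {spanning S} {X} (∈-elements⁻ e∈S) i∈ (proj₁ (proj₂ (proj₂ isComp) e (∈-elements⁻ e∈S)) i∈)) })
        (λ { ≡.refl → e∉F (∈-induced⁺ {spanning S} {X} (∈-elements⁻ e∈S) (proj₂ (proj₂ (proj₂ isComp) e (∈-elements⁻ e∈S)) i∈) i∈) })
      zeros₁ : All (λ i → All (λ e → N i e ≈ᶜ 0ᶜ) κ′) (elements X)
      zeros₁ = All.tabulate λ i∈ → All.tabulate λ e∈ → outside-edge (∈-elements⁻ i∈) e∈
      zeros₂ : All (λ e → All (λ i → N i e ≈ᶜ 0ᶜ) ρ′) (inducedEdges S X)
      zeros₂ = All.tabulate λ {e} e∈ → All.tabulate λ {i} i∈ → N-outside {elements X} {i} {e}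
        (λ i∈X → proj₂ (∈-filter⁻ (¬? ∘ (Subset._∈? X)) {xs = ρ} i∈) (∈-elements⁻ i∈X))
        (∈-elements⁺ (proj₁ (induced-Closed (spanning S) X (∈-elements⁻ e∈))) , ∈-elements⁺ (proj₂ (induced-Closed (spanning S) X (∈-elements⁻ e∈))))

    module _ {k : V} {ρ : List V} (kρ↭ : k ∷ ρ ↭ allFin n) where
      private
        ukρ : Unique (k ∷ ρ)
        ukρ = Unique-resp-↭ (↭-sym kρ↭) (Unique.allFin⁺ n)

        ρ↭νs : ∀ {S} (sp : Spanning (spanning S) (k ∷ []) []) → ρ ↭ Spanning.νs sp
        ρ↭νs sp = drop-∷ (↭-trans kρ↭ (↭-trans (↭-sym elements-⊤↭) (↭-trans (↭-sym (Spanning.vertices↭ sp)) (++-comm (Spanning.νs sp) (k ∷ [])))))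

        no-cycle-in-[] : ∀ {vs} → ¬ IsCycleIn (_∈ []) vs
        no-cycle-in-[] {_ ∷ []}    (s≤s () , _)
        no-cycle-in-[] {_ ∷ _ ∷ _} (_ , _ , (_ , () , _) ∷ _)

        -- The rows ρ are the vertices grown from k, one per leaf edge. Hence the surplus decides:
        -- if empty, `S` is a tree and the minor is triangular; otherwise `S` has a cycle and there
        -- are more columns than rows.
        by-surplus : ∀ S → Connected (spanning S) → (sp : Spanning (spanning S) (k ∷ []) []) → ∀ zs → Spanning.surplus sp ≡ zs →
          (IsTree (spanning S) → ∣ d ρ (elements S) ∣² ≈ ∣ W S ∣) × (¬ IsTree (spanning S) → ∣ d ρ (elements S) ∣² ≈ 0#)
        by-surplus S conn sp [] eq = (λ _ → value) , λ ¬tree → contradiction (conn , λ C → no-cycle-in-[] (no-surplus-cycle eq [] (Cycle.isCycle C))) ¬tree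
          where
          open Spanning sp
          open import Relation.Binary.Reasoning.Setoid setoid
          es↭ : elements S ↭ es ++ []
          es↭ = ↭-trans (↭-sym edges↭) (↭-reflexive (≡.trans (≡.cong ((es ++ []) ++_) eq) (List.++-identityʳ (es ++ []))))
          value : ∣ d ρ (elements S) ∣² ≈ ∣ W S ∣
          value = begin
            ∣ d ρ (elements S) ∣²            ≈⟨ ∣d∣²-↭ (↭-trans (ρ↭νs sp) (↭-reflexive (≡.sym (List.++-identityʳ νs)))) es↭ ⟩
            ∣ d (νs ++ []) (es ++ []) ∣²     ≈⟨ ∣d∣²-Grown grown [] [] ⟩
            ∏ es ∣w∣ * ∣ 1ᶜ ∣²               ≈⟨ trans (*-congˡ ∣1∣²≈1) (*-identityʳ _) ⟩
            ∏ es ∣w∣                         ≈⟨ ∏-↭ ∣w∣ (↭-trans es↭ (↭-reflexive (List.++-identityʳ es))) ⟨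
            ∏ (elements S) ∣w∣               ≈⟨ ∣W∣ S ⟨
            ∣ W S ∣                          ∎
        by-surplus S conn sp (z ∷ zs) eq = (λ (_ , acyclic) → ⊥-elim (cyclic acyclic)) , λ _ → ≈0⇒∣∣²≈0 (d-length ρ (elements S) lengths≢)
          where
          open Spanning sp
          cyclic : ¬ Cycle (spanning S) → ⊥
          cyclic acyclic with surplus-cycle {z = z} [] (λ { (here ≡.refl) → ε }) (whole-Closed S) (≡.subst (z ∈_) (≡.sym eq) (here ≡.refl))
          ... | vs , c , _ = acyclic (cycle vs c)
          lengths≢ : length ρ ≢ length (elements S)
          lengths≢ eq′ = ℕ.m+1+n≢m (length es) (begin
            length es ℕ.+ suc (length zs)       ≡⟨ ≡.cong₂ (λ xs ys → length xs ℕ.+ length ys) (List.++-identityʳ es) eq ⟨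
            length (es ++ []) ℕ.+ length surplus  ≡⟨ List.length-++ (es ++ []) ⟨
            length ((es ++ []) ++ surplus)      ≡⟨ ↭-length edges↭ ⟩
            length (elements S)                 ≡⟨ eq′ ⟨
            length ρ                            ≡⟨ ↭-length (ρ↭νs sp) ⟩
            length νs                           ≡⟨ Grown-length _ grown ⟩
            length es                           ∎)
            where open ≡.≡-Reasoning

      spanning-tree-minor : ∀ S →
        (IsTree (spanning S) → ∣ d ρ (elements S) ∣² ≈ ∣ W S ∣) × (¬ IsTree (spanning S) → ∣ d ρ (elements S) ∣² ≈ 0#)
      spanning-tree-minor S with connected? (spanning S)
      ... | yes conn = by-surplus S conn (spanning-root conn (whole-Closed S) Subset.∈⊤) _ ≡.refl
      ... | no ¬conn = (λ (conn , _) → contradiction conn ¬conn) , λ _ → singular (¬∀⟶∃¬ n _ (star? k) all-reachable)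
        where
        open Reachability (adj? (spanning S)) using (star?)
        all-reachable : ¬ (∀ j → Star (Adj (spanning S)) k j)
        all-reachable r = ¬conn ((k , Subset.∈⊤) , λ i _ j _ → Star.reverse EdgeAdj-sym (r i) ◅◅ r j)
        singular : ∃ (λ j → ¬ Star (Adj (spanning S)) k j) → ∣ d ρ (elements S) ∣² ≈ 0#
        singular (j , ¬r) = rows-over-component-singular S j (Unique-++ʳ (k ∷ []) ukρ) covered
          where
          covered : ∀ {i} → i ∈ˢ componentOf S j → i ∈ ρ
          covered {i} i∈ with ∈-resp-↭ (↭-sym kρ↭) (∈-allFin i)
          ... | here ≡.refl = contradiction (Star.reverse EdgeAdj-sym (∈-componentOf⁻ S i∈)) ¬r
          ... | there i∈ρ   = i∈ρ

      ∑-spanningTrees : ∑ (allSubsets m) (λ S → ∣ d ρ (elements S) ∣²) ≈ ∑ spanningTrees (λ T → ∣ W (edgeSet T) ∣)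
      ∑-spanningTrees = ∑-filter-map spanning isTree? (λ S → proj₁ (spanning-tree-minor S)) (λ S → proj₂ (spanning-tree-minor S)) (allSubsets m)

    -- The list κ is arbitrary because an adjoined column may repeat an existing one. Distinct
    -- columns form an edge set, in which the component of v supplies the singular block.
    all-maximal-minors-vanish : ∀ (v : V) {ρ} κ → ρ ↭ allFin n → d ρ κ ≈ᶜ 0ᶜ
    all-maximal-minors-vanish v {ρ} κ ρ↭ with DecUnique.unique? _≟_ κ
    ... | yes u = ∣∣²≈0⇒≈0 {d ρ κ} (trans (∣d∣²-↭ ρ↭ κ↭) (rows-over-component-singular (Vec.tabulate (does ∘ (_∈? κ))) v (Unique.allFin⁺ n) (λ _ → ∈-allFin _)))
      where
      κ↭ : κ ↭ elements (Vec.tabulate (does ∘ (_∈? κ)))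
      κ↭ = ⊆⊇⇒↭ u (elements-Unique _) (λ e∈ → ∈-elements⁺ (∈-tabulate⁺ (_∈? κ) e∈)) (λ e∈ → ∈-tabulate⁻ (_∈? κ) (∈-elements⁻ e∈))
    ... | no ¬u with repetition κ ¬u
    ...   | e , κ′ , p = ∣∣²≈0⇒≈0 {d ρ κ} (trans (∣d∣²-↭ ρ↭ p) (≈0⇒∣∣²≈0 {d (allFin n) (e ∷ e ∷ κ′)} (d-repeated-column (allFin n) e κ′)))

    module _ {n′} (n≡ : n ≡ suc n′) where

      private
        -- The null vector consists of the cofactors along a column that is
        -- adjoined to the columns of a spanning tree.
        dependent-via : (ρ : Fin (suc n′) → V) → RowsIndependent N ρ → Spanning whole (ρ zero ∷ []) [] → ⊥
        dependent-via ρ ind sp = κ≉0 (begin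
          ∏ es ∣w∣                                ≈⟨ trans (*-congˡ ∣1∣²≈1) (*-identityʳ _) ⟨
          ∏ es ∣w∣ * ∣ 1ᶜ ∣²                      ≈⟨ ∣d∣²-Grown grown [] [] ⟨
          ∣ d (νs ++ []) κ ∣²                     ≈⟨ ∣d∣²-↭ νs↭ (↭-refl {x = κ}) ⟩
          ∣ d (List.tabulate (ρ ∘ suc)) κ ∣²      ≈⟨ ≈0⇒∣∣²≈0 {d (List.tabulate (ρ ∘ suc)) κ} (ind x null zero) ⟩
          0#                                      ∎)
          where
          open import Relation.Binary.Reasoning.Setoid setoid
          open Spanning sp
          κ = es ++ []
          κ≉0 : ∏ es ∣w∣ ≉ 0#
          κ≉0 = ∏-≉0 es (λ e → ∣∣≉0 (w≉0 e))
          ρ↭ : List.tabulate ρ ↭ allFin n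
          ρ↭ = Unique-↭-allFin (Unique.tabulate⁺ (independent⇒injective ρ ind)) (≡.trans (List.length-tabulate ρ) (≡.sym n≡))
          νs↭ : νs ++ [] ↭ List.tabulate (ρ ∘ suc)
          νs↭ = ↭-trans (↭-reflexive (List.++-identityʳ νs)) (drop-∷ (↭-trans (++-comm (ρ zero ∷ []) νs)
            (↭-trans vertices↭ (↭-trans elements-⊤↭ (↭-sym ρ↭)))))
          minors : Fin (suc n′) → ℂ
          minors i = d (List.tabulate (ρ ∘ punchIn i)) κ
          x : Fin (suc n′) → ℂ
          x = alternating minors
          null : ∀ e → sum (λ i → x i *ᶜ N (ρ i) e) ≈ᶜ 0ᶜ
          null e = ≈ᶜ.begin
            sum (λ i → x i *ᶜ N (ρ i) e)   ≈ᶜ.≈⟨ cofactors-column ρ e κ ⟩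
            d (List.tabulate ρ) (e ∷ κ)    ≈ᶜ.≈⟨ all-maximal-minors-vanish (ρ zero) (e ∷ κ) ρ↭ ⟩
            0ᶜ                             ≈ᶜ.∎
            where module ≈ᶜ = SetoidReasoning ℂ-setoid

      dependent : (ρ : Fin (suc n′) → V) → ¬ RowsIndependent N ρ
      dependent ρ ind = dependent-via ρ ind (spanning-root connected (whole-Closed ⊤) Subset.∈⊤)

  -- All rows but that of vertex `zero` are independent, while n rows never are, so the rank is n -
  -- 1. Each of the n row choices contributes the same sum over spanning trees.
  balanced-vol² : ∀ {n′} → n ≡ suc n′ → 0 ℕ.< n′ → ((C : Cycle whole) → α C ≈ 0#) →
    IsVol² N (n · ∑ spanningTrees (λ T → ∣ W (edgeSet T) ∣))
  balanced-vol² {n′} ≡.refl 0<n′ α-vanishes = n′ , ((suc , rows-independent) , rank≤) , 0<n′ , sym (begin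
      ∑ (choose (suc n′) n′) (λ ρ → ∑ (choose m n′) λ κ → ∣ det (submatrix N ρ κ) ∣ * ∣ det (submatrix N ρ κ) ∣)
        ≈⟨ ∑-const (All.map (λ {ρ} (k , p) → trans (∑-minors ρ) (Balanced.∑-spanningTrees α-vanishes p)) (choose-all-but-one-↭ n′)) ⟩
      length (choose (suc n′) n′) · ∑ spanningTrees (λ T → ∣ W (edgeSet T) ∣)
        ≡⟨ ≡.cong (_· ∑ spanningTrees (λ T → ∣ W (edgeSet T) ∣)) (length-choose-all-but-one n′) ⟩
      suc n′ · ∑ spanningTrees (λ T → ∣ W (edgeSet T) ∣)  ∎)
    where
    open import Relation.Binary.Reasoning.Setoid setoid
    -- Padding a combination of the rows other than zero by 0 gives a null
    -- vector that vanishes at the vertex zero.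
    pad : (Fin n′ → ℂ) → V → ℂ
    pad x zero    = 0ᶜ
    pad x (suc i) = x i
    rows-independent : RowsIndependent N suc
    rows-independent x null i = null-everywhere (pad x) padded zero reflᶜ (suc i)
      where
      padded : ∀ e → sum (λ i → pad x i *ᶜ N i e) ≈ᶜ 0ᶜ
      padded e = transᶜ (+ᶜ-cong (zeroˡᶜ (N zero e)) (null e)) (+ᶜ-identityˡ 0ᶜ)
    rank≤ : ∀ {s} (ρ : Fin s → V) → RowsIndependent N ρ → s ℕ.≤ n′
    rank≤ {s} ρ ind with ℕ.m≤n⇒m<n∨m≡n (independent⇒≤ ρ ind)
    ... | inj₁ (s≤s s≤n′) = s≤n′
    ... | inj₂ ≡.refl     = contradiction ind (Balanced.dependent α-vanishes ≡.refl ρ)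

open import Data.Nat.Base using (_≤_)

theorem4p7 : ∀ {c ℓ₁ ℓ₂} (ℝ : RealField c ℓ₁ ℓ₂) {n m : ℕ} (G : OrientedGraph n m)
    (w : Fin m → ComplexNumbers.ℂ ℝ) →
    let open WeightedGraphs ℝ G w in
    2 ≤ n →
    Connected whole →
    Cycle whole →
    (∀ e → ¬ (w e ≈ᶜ 0ᶜ)) →
    (∀ e → ¬ ℝ⁻ (w e)) →
    ((∀ (C : Cycle whole) →
    (Cycle.Even C → ℝ⁺ (wt C)) × (Cycle.Odd C → ℝ⁻ (wt C))) →
    IsVol² N (n · ∑ spanningTrees (λ T → ∣ W (E T) ∣)))
    ×
    (Σ (Cycle whole) (λ C →
    (Cycle.Even C × ¬ ℝ⁺ (wt C)) ⊎ (Cycle.Odd C × ¬ ℝ⁻ (wt C))) →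
    IsVol² N (∑ unicyclicSpanningSubgraphs unicyclicTerm))
theorem4p7 ℝ G w (s≤s (s≤s z≤n)) connected _ w≉0 w∉ℝ⁻ =
  -- Since `2 ≤ n`, the rank n - 1 is positive, as `IsVol²` demands.
  (λ balanced → balanced-vol² ≡.refl (s≤s z≤n) λ C → α≈0 C (balanced C)) ,
  λ (C , unbalanced) → unbalanced-vol² (s≤s z≤n) (C , α≉0 C unbalanced)
  where
  open Volume ℝ G w w≉0 w∉ℝ⁻ connected using (balanced-vol²; unbalanced-vol²; α≈0; α≉0)
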